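{- Fix an integer $n>1$ and let $p$ be a prime. Let $$c_7(n) = \max_{0\le d\le n-1} \frac{d(n-1-d)}{n-1+d},$$ where the maximum is over all integers $d$ with $0\le d\le n-1$. Then the series $\zeta^R_{\mathbb{Z}^n,\,p}(s)$ diverges for all $s\in\mathbb{C}$ such that $\operatorname{Re}(s)\le c_7(n)$.
   Context: A subring of $\mathbb{Z}^n$ is a sublattice (additive subgroup) of $\mathbb{Z}^n$ that contains the multiplicative identity $(1,1,\ldots,1)$ and is closed under componentwise multiplication. For a positive integer $m$, $f_n(m)$ denotes the number of subrings of $\mathbb{Z}^n$ of finite index $m$. For a prime $p$, the local factor at $p$ of the subring zeta function of $\mathbb{Z}^n$ is the series $\zeta^R_{\mathbb{Z}^n,\,p}(s) = \sum_{e=0}^\infty f_n(p^e)p^{ -es}$. -}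

module Defs where

open import Data.Empty using (⊥-elim)
open import Data.Fin.Base as Fin using (Fin; toℕ)
open import Data.Fin.Properties as Fin using (pigeonhole; injective⇒≤)
open import Data.Integer.Base as ℤ using (ℤ; +_; 0ℤ; 1ℤ)
open import Data.Integer.DivMod as ℤ using (_%ℕ_; _/ℕ_; n%ℕd<d; a≡a%ℕn+[a/ℕn]*n)
open import Data.Integer.Divisibility.Signed as ℤ∣ using (divides) renaming (_∣_ to _∣ᶻ_)
import Data.Integer.Properties as ℤ
open import Data.Integer.Solver using () renaming (module +-*-Solver to ℤ-Solver)
open import Data.List.Base as List using (List; []; _∷_)
import Data.List.Membership.Propositional as ∈
open import Data.List.Membership.Propositional.Properties
  using (∈-map⁺; ∈-++⁺ˡ; ∈-++⁺ʳ; ∈-upTo⁺; ∈-filter⁺; ∈-filter⁻; ∈-cartesianProductWith⁺; ∈-lookup)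
open import Data.List.Relation.Unary.All as All using (All)
open import Data.List.Relation.Unary.AllPairs as AllPairs using (AllPairs)
open import Data.List.Relation.Unary.Any as Any using (Any; here; there)
open import Data.List.Relation.Unary.Enumerates.Setoid using (IsEnumeration)
import Data.List.Relation.Unary.Enumerates.Setoid.Properties as Enum
open import Data.List.Relation.Unary.Unique.DecSetoid.Properties using (deduplicate-!)
open import Data.Nat.Base as ℕ using (ℕ; zero; suc; _!)
import Data.Nat.Divisibility as ℕ∣
import Data.Nat.Properties as ℕ
open import Data.Product.Base using (Σ; ∃; _×_; _,_; proj₁; proj₂)
open import Data.Rational.Base as ℚ using (ℚ; mkℚ; 0ℚ; 1ℚ; ½)
import Data.Rational.Properties as ℚ
open import Data.Rational.Solver using () renaming (module +-*-Solver to ℚ-Solver)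
import Data.Rational.Unnormalised.Base as ℚᵘ
import Data.Rational.Unnormalised.Properties as ℚᵘ
open import Data.Vec.Base as Vec using (Vec; []; _∷_; zipWith; replicate)
open import Data.Vec.Relation.Binary.Pointwise.Inductive as PW using (Pointwise; []; _∷_)
open import Function.Base using (_∘_; id)
open import Function.Bundles using (Bijection)
open import Level using (0ℓ) renaming (suc to lsuc)
open import Relation.Binary.Bundles using (Setoid; DecSetoid; DecTotalOrder)
import Relation.Binary.Definitions as B
open import Relation.Binary.PropositionalEquality as ≡
  using (_≡_; refl; sym; trans; cong; cong₂; subst; subst₂)
open import Relation.Nullary using (Dec; yes; no; ¬_)
open import Relation.Nullary.Decidable as Dec using (_×-dec_; _→-dec_)
open import Relation.Unary using (Pred; Decidable; _∈_; _⊆_; _≐_)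
open import Relation.Unary.Properties using (≐-sym; ≐-trans)
open import Data.List.Extrema (DecTotalOrder.totalOrder ℚ.≤-decTotalOrder) using (max)
open import Data.Nat.Primality using (Prime; prime⇒nonZero)

infixl 6 _⊕_ _⊝_
infixl 7 _⊗_
infix  8 ⊖_

variable
  n m k : ℕ

_⊕_ _⊗_ _⊝_ : Vec ℤ n → Vec ℤ n → Vec ℤ n
_⊕_ = zipWith ℤ._+_
_⊗_ = zipWith ℤ._*_

⊖_ : Vec ℤ n → Vec ℤ n
⊖_ = Vec.map (ℤ.-_)

x ⊝ y = x ⊕ ⊖ y

𝟘 𝟙 : Vec ℤ n
𝟘 = replicate _ 0ℤ
𝟙 = replicate _ 1ℤ

record IsSubring (L : Pred (Vec ℤ n) 0ℓ) : Set where
  field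
    0-mem    : 𝟘 ∈ L
    1-mem    : 𝟙 ∈ L
    +-closed : ∀ {x y} → x ∈ L → y ∈ L → x ⊕ y ∈ L
    -‿closed : ∀ {x} → x ∈ L → ⊖ x ∈ L
    *-closed : ∀ {x y} → x ∈ L → y ∈ L → x ⊗ y ∈ L

module ⊝-Properties where

  open ℤ-Solver using (solve; _:+_; _:*_; :-_; _:=_)

  ⊝-self : ∀ (x : Vec ℤ n) → x ⊝ x ≡ 𝟘
  ⊝-self []      = refl
  ⊝-self (a ∷ x) = cong₂ _∷_ (ℤ.+-inverseʳ a) (⊝-self x)

  ⊝-swap : ∀ (x y : Vec ℤ n) → ⊖ (x ⊝ y) ≡ y ⊝ x
  ⊝-swap []      []      = refl
  ⊝-swap (a ∷ x) (b ∷ y) = cong₂ _∷_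
    (solve 2 (λ a b → :- (a :+ :- b) := b :+ :- a) refl a b) (⊝-swap x y)

  ⊝-chain : ∀ (x y z : Vec ℤ n) → (x ⊝ y) ⊕ (y ⊝ z) ≡ x ⊝ z
  ⊝-chain []      []      []      = refl
  ⊝-chain (a ∷ x) (b ∷ y) (c ∷ z) = cong₂ _∷_
    (solve 3 (λ a b c → (a :+ :- b) :+ (b :+ :- c) := a :+ :- c) refl a b c) (⊝-chain x y z)

  ⊝-𝟘 : ∀ (x : Vec ℤ n) → x ⊝ 𝟘 ≡ x
  ⊝-𝟘 []      = refl
  ⊝-𝟘 (a ∷ x) = cong₂ _∷_ (ℤ.+-identityʳ a) (⊝-𝟘 x)

open ⊝-Properties

quotient : {L : Pred (Vec ℤ n) 0ℓ} → IsSubring L → Setoid 0ℓ 0ℓ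
quotient {n} {L} S = record
  { Carrier       = Vec ℤ n
  ; _≈_           = λ x y → x ⊝ y ∈ L
  ; isEquivalence = record
    { refl  = λ {x} → subst L (sym (⊝-self x)) 0-mem
    ; sym   = λ {x} {y} xy → subst L (⊝-swap x y) (-‿closed xy)
    ; trans = λ {x} {y} {z} xy yz → subst L (⊝-chain x y z) (+-closed xy yz)
    }
  } where open IsSubring S

HasCardinality : ∀ {a ℓ} → Setoid a ℓ → ℕ → Set _
HasCardinality S k = Bijection (≡.setoid (Fin k)) S

HasIndex : {L : Pred (Vec ℤ n) 0ℓ} → IsSubring L → ℕ → Set
HasIndex S m = HasCardinality (quotient S) m

record Subring (n m : ℕ) : Set₁ where
  field
    carrier   : Pred (Vec ℤ n) 0ℓ
    isSubring : IsSubring carrier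
    hasIndex  : HasIndex isSubring m

  open IsSubring isSubring public

-- Subrings of ℤⁿ of index m, two of them being identified when they have the same elements.
subrings : ℕ → ℕ → Setoid (lsuc 0ℓ) 0ℓ
subrings n m = record
  { Carrier       = Subring n m
  ; _≈_           = λ A B → carrier A ≐ carrier B
  ; isEquivalence = record
    { refl  = id , id
    ; sym   = λ (p , q) → q , p
    ; trans = λ (p , q) (p′ , q′) → p′ ∘ p , q ∘ q′
    }
  } where open Subring

module Finiteness where

  open ℤ-Solver using (solve; _:+_; _:*_; :-_; _:=_)

  lookup-inj : ∀ {a ℓ} (S : Setoid a ℓ) {xs : List (Setoid.Carrier S)} → let open Setoid S in
               AllPairs (λ x y → ¬ x ≈ y) xs →
               ∀ i j → List.lookup xs i ≈ List.lookup xs j → i ≡ j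
  lookup-inj S (a AllPairs.∷ as) Fin.zero    Fin.zero    _  = refl
  lookup-inj S (a AllPairs.∷ as) Fin.zero    (Fin.suc j) eq =
    ⊥-elim (All.lookup a (∈-lookup j) eq)
  lookup-inj S (a AllPairs.∷ as) (Fin.suc i) Fin.zero    eq =
    ⊥-elim (All.lookup a (∈-lookup i) (Setoid.sym S eq))
  lookup-inj S (a AllPairs.∷ as) (Fin.suc i) (Fin.suc j) eq = cong Fin.suc (lookup-inj S as i j eq)

  enumerable⇒finite : ∀ {a ℓ} (S : Setoid a ℓ) → B.Decidable (Setoid._≈_ S) →
                      (xs : List (Setoid.Carrier S)) → IsEnumeration S xs → ∃ (HasCardinality S)
  enumerable⇒finite S _≈?_ xs enum = List.length ys , record
    { to        = List.lookup ys
    ; cong      = λ { refl → Setoid.refl S }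
    ; bijective = (λ {i} {j} → lookup-inj S (deduplicate-! D xs) i j)
                , Enum.lookup-surjective S (Enum.deduplicate⁺ D enum)
    }
    where
    D : DecSetoid _ _
    D = record { isDecEquivalence = record { isEquivalence = Setoid.isEquivalence S ; _≟_ = _≈?_ } }
    ys = List.deduplicate _≈?_ xs

  cardinality-≤ : ∀ {a ℓ} (S : Setoid a ℓ) → HasCardinality S k → HasCardinality S m → k ℕ.≤ m
  cardinality-≤ S f g = injective⇒≤ {f = h} λ {i} {j} eq → Bijection.injective f
      (Setoid.trans S (Setoid.sym S (gh i)) (Setoid.trans S (Bijection.cong g eq) (gh j)))
    where
    h  = λ i → proj₁ (Bijection.surjective g (Bijection.to f i))
    gh = λ i → proj₂ (Bijection.surjective g (Bijection.to f i)) refl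

  cardinality-unique : ∀ {a ℓ} (S : Setoid a ℓ) → HasCardinality S k → HasCardinality S m → k ≡ m
  cardinality-unique S f g = ℕ.≤-antisym (cardinality-≤ S f g) (cardinality-≤ S g f)

  hasCardinality? : ∀ {a ℓ} (S : Setoid a ℓ) → ∃ (HasCardinality S) → ∀ m → Dec (HasCardinality S m)
  hasCardinality? S (k , f) m with k ℕ.≟ m
  ... | yes refl = yes f
  ... | no  k≢m  = no λ g → k≢m (cardinality-unique S f g)

  index-resp : ∀ {P Q : Pred (Vec ℤ n) 0ℓ} (S : IsSubring P) (T : IsSubring Q) →
               P ≐ Q → HasIndex S m → HasIndex T m
  index-resp S T (p , q) i = record
    { to        = I.to
    ; cong      = λ e → p (I.cong e)
    ; bijective = (λ e → I.injective (q e))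
                , λ x → proj₁ (I.surjective x) , λ e → p (proj₂ (I.surjective x) e)
    } where module I = Bijection i

  module Residues (M : ℕ) .{{_ : ℕ.NonZero M}} where


    infix 4 _∼_ _∼?_

    _∼_ : Vec ℤ n → Vec ℤ n → Set
    _∼_ = Pointwise (λ a b → + M ∣ᶻ a ℤ.- b)

    _∼?_ : B.Decidable (_∼_ {n})
    _∼?_ = PW.decidable (λ a b → + M ℤ∣.∣? a ℤ.- b)

    ≡⇒∼ : ∀ {x y : Vec ℤ n} → x ≡ y → x ∼ y
    ≡⇒∼ refl = PW.refl (λ {a} → divides 0ℤ (ℤ.+-inverseʳ a))

    ∼-sym : ∀ {x y : Vec ℤ n} → x ∼ y → y ∼ x
    ∼-sym = PW.sym λ {a} {b} p → subst (+ M ∣ᶻ_)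
      (solve 2 (λ a b → :- (a :+ :- b) := b :+ :- a) refl a b) (ℤ∣.∣m⇒∣-m p)

    ∼-trans : ∀ {x y z : Vec ℤ n} → x ∼ y → y ∼ z → x ∼ z
    ∼-trans = PW.trans λ {a} {b} {c} p q → subst (+ M ∣ᶻ_)
      (solve 3 (λ a b c → (a :+ :- b) :+ (b :+ :- c) := a :+ :- c) refl a b c) (ℤ∣.∣m∣n⇒∣m+n p q)

    ⊕-∼ : ∀ {x x′ y y′ : Vec ℤ n} → x ∼ x′ → y ∼ y′ → x ⊕ y ∼ x′ ⊕ y′
    ⊕-∼ [] [] = []
    ⊕-∼ {x = a ∷ _} {a′ ∷ _} {b ∷ _} {b′ ∷ _} (p ∷ ps) (q ∷ qs) = subst (+ M ∣ᶻ_)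
      (solve 4 (λ a a′ b b′ → (a :+ :- a′) :+ (b :+ :- b′) := (a :+ b) :+ :- (a′ :+ b′)) refl a a′ b b′)
      (ℤ∣.∣m∣n⇒∣m+n p q) ∷ ⊕-∼ ps qs

    ⊗-∼ : ∀ {x x′ y y′ : Vec ℤ n} → x ∼ x′ → y ∼ y′ → x ⊗ y ∼ x′ ⊗ y′
    ⊗-∼ [] [] = []
    ⊗-∼ {x = a ∷ _} {a′ ∷ _} {b ∷ _} {b′ ∷ _} (p ∷ ps) (q ∷ qs) = subst (+ M ∣ᶻ_)
      (solve 4 (λ a a′ b b′ → (a :+ :- a′) :* b :+ a′ :* (b :+ :- b′) := (a :* b) :+ :- (a′ :* b′)) refl a a′ b b′)
      (ℤ∣.∣m∣n⇒∣m+n (ℤ∣.∣m⇒∣m*n b p) (ℤ∣.∣n⇒∣m*n a′ q)) ∷ ⊗-∼ ps qs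

    ⊖-∼ : ∀ {x x′ : Vec ℤ n} → x ∼ x′ → ⊖ x ∼ ⊖ x′
    ⊖-∼ [] = []
    ⊖-∼ {x = a ∷ _} {a′ ∷ _} (p ∷ ps) = subst (+ M ∣ᶻ_)
      (solve 2 (λ a a′ → :- (a :+ :- a′) := :- a :+ :- (:- a′)) refl a a′) (ℤ∣.∣m⇒∣-m p) ∷ ⊖-∼ ps

    residues : ∀ n → List (Vec ℤ n)
    residues zero    = [] ∷ []
    residues (suc n) = List.cartesianProductWith _∷_ (List.map +_ (List.upTo M)) (residues n)

    residue : ∀ (x : Vec ℤ n) → ∃ λ r → (r ∈.∈ residues n) × x ∼ r
    residue []      = [] , here refl , []
    residue (a ∷ x) =
      let r , r∈ , x∼r = residue x in
      + (a %ℕ M) ∷ r ,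
      ∈-cartesianProductWith⁺ _∷_ (∈-map⁺ +_ (∈-upTo⁺ (n%ℕd<d a M))) r∈ ,
      divides (a /ℕ M) (trans (cong (ℤ._- + (a %ℕ M)) (a≡a%ℕn+[a/ℕn]*n a M))
        (solve 2 (λ u v → (u :+ v) :+ :- u := v) refl (+ (a %ℕ M)) ((a /ℕ M) ℤ.* + M))) ∷ x∼r

    ⟦_⟧ : List (Vec ℤ n) → Pred (Vec ℤ n) 0ℓ
    ⟦ xs ⟧ x = Any (x ∼_) xs

    _∈⟦_⟧? : ∀ (x : Vec ℤ n) xs → Dec (x ∈ ⟦ xs ⟧)
    x ∈⟦ xs ⟧? = Any.any? (x ∼?_) xs

    ⟦⟧-resp : ∀ {xs} {x y : Vec ℤ n} → x ∼ y → y ∈ ⟦ xs ⟧ → x ∈ ⟦ xs ⟧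
    ⟦⟧-resp x∼y = Any.map (∼-trans x∼y)

    ∈⇒∈⟦⟧ : ∀ {xs} {x : Vec ℤ n} → x ∈.∈ xs → x ∈ ⟦ xs ⟧
    ∈⇒∈⟦⟧ = Any.map ≡⇒∼

    isSubring? : ∀ (xs : List (Vec ℤ n)) → Dec (IsSubring ⟦ xs ⟧)
    isSubring? xs = Dec.map′
      (λ (z , o , p , q , r) → record
        { 0-mem    = z
        ; 1-mem    = o
        ; +-closed = bin _⊕_ ⊕-∼ p
        ; -‿closed = λ x∈ → let _ , a∈ , x∼a = ∈.find x∈ in
                            ⟦⟧-resp (⊖-∼ x∼a) (All.lookup q a∈)
        ; *-closed = bin _⊗_ ⊗-∼ r
        })
      (λ S → let open IsSubring S in
        0-mem , 1-mem ,
        All.tabulate (λ a∈ → All.tabulate λ b∈ → +-closed (∈⇒∈⟦⟧ a∈) (∈⇒∈⟦⟧ b∈)) ,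
        All.tabulate (λ a∈ → -‿closed (∈⇒∈⟦⟧ a∈)) ,
        All.tabulate (λ a∈ → All.tabulate λ b∈ → *-closed (∈⇒∈⟦⟧ a∈) (∈⇒∈⟦⟧ b∈)))
      (𝟘 ∈⟦ xs ⟧? ×-dec 𝟙 ∈⟦ xs ⟧?
        ×-dec All.all? (λ a → All.all? (λ b → (a ⊕ b) ∈⟦ xs ⟧?) xs) xs
        ×-dec All.all? (λ a → (⊖ a) ∈⟦ xs ⟧?) xs
        ×-dec All.all? (λ a → All.all? (λ b → (a ⊗ b) ∈⟦ xs ⟧?) xs) xs)
      where
      bin : ∀ (_∙_ : Vec ℤ _ → Vec ℤ _ → Vec ℤ _) →
            (∀ {x x′ y y′} → x ∼ x′ → y ∼ y′ → (x ∙ y) ∼ (x′ ∙ y′)) →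
            All (λ a → All (λ b → (a ∙ b) ∈ ⟦ xs ⟧) xs) xs →
            ∀ {x y} → x ∈ ⟦ xs ⟧ → y ∈ ⟦ xs ⟧ → (x ∙ y) ∈ ⟦ xs ⟧
      bin _∙_ ∙-∼ p x∈ y∈ =
        let _ , a∈ , x∼a = ∈.find x∈
            _ , b∈ , y∼b = ∈.find y∈
        in ⟦⟧-resp (∙-∼ x∼a y∼b) (All.lookup (All.lookup p a∈) b∈)

    hasIndex? : ∀ {xs : List (Vec ℤ n)} (S : IsSubring ⟦ xs ⟧) m → Dec (HasIndex S m)
    hasIndex? {n} {xs} S = hasCardinality? (quotient S)
      (enumerable⇒finite (quotient S) (λ x y → (x ⊝ y) ∈⟦ xs ⟧?) (residues n)
        λ x → let r , r∈ , x∼r = residue x in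
              ∈.lose {P = λ r → x ⊝ r ∈ ⟦ xs ⟧} r∈
                (⟦⟧-resp (∼-trans (⊕-∼ x∼r (≡⇒∼ refl)) (≡⇒∼ (⊝-self r))) (IsSubring.0-mem S)))

    sublists : ∀ {a} {A : Set a} → List A → List (List A)
    sublists []       = [] ∷ []
    sublists (x ∷ xs) = List.map (x ∷_) (sublists xs) List.++ sublists xs

    filter-sublist : ∀ {a p} {A : Set a} {P : Pred A p} (P? : Decidable P) xs →
                     List.filter P? xs ∈.∈ sublists xs
    filter-sublist P? []       = here refl
    filter-sublist P? (x ∷ xs) with P? x
    ... | yes _ = ∈-++⁺ˡ (∈-map⁺ (x ∷_) (filter-sublist P? xs))
    ... | no  _ = ∈-++⁺ʳ _ (filter-sublist P? xs)

    subring? : ∀ (xs : List (Vec ℤ n)) m → Dec (Σ (IsSubring ⟦ xs ⟧) λ S → HasIndex S m)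
    subring? xs m with isSubring? xs
    ... | no ¬S = no (¬S ∘ proj₁)
    ... | yes S with hasIndex? S m
    ...   | yes i = yes (S , i)
    ...   | no ¬i = no λ (S′ , i) → ¬i (index-resp S′ S (id , id) i)

    candidates : ∀ m → List (List (Vec ℤ n)) → List (Subring n m)
    candidates m []         = []
    candidates m (xs ∷ xss) with subring? xs m
    ... | yes (S , i) = record { carrier = ⟦ xs ⟧ ; isSubring = S ; hasIndex = i } ∷ candidates m xss
    ... | no  _       = candidates m xss

    candidates⁺ : ∀ {xss} {xs : List (Vec ℤ n)} → xs ∈.∈ xss →
                  (S : IsSubring ⟦ xs ⟧) → HasIndex S m →
                  Any (λ A → ⟦ xs ⟧ ≐ Subring.carrier A) (candidates m xss)
    candidates⁺ {m = m} {xss = xs ∷ _} (here refl) S i with subring? xs m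
    ... | yes _ = here (id , id)
    ... | no ¬p = ⊥-elim (¬p (S , i))
    candidates⁺ {m = m} {xss = xs ∷ _} (there xs∈) S i with subring? xs m
    ... | yes _ = there (candidates⁺ xs∈ S i)
    ... | no  _ = candidates⁺ xs∈ S i

  k∣k! : ∀ k .{{_ : ℕ.NonZero k}} → k ℕ∣.∣ k !
  k∣k! (suc k) = ℕ∣.m∣m*n (k !)

  infixr 8 _•_

  _•_ : ℕ → Vec ℤ n → Vec ℤ n
  k • x = Vec.map (+ k ℤ.*_) x

  module _ where

    0•x : ∀ (x : Vec ℤ n) → 0 • x ≡ 𝟘
    0•x []      = refl
    0•x (a ∷ x) = cong₂ _∷_ (ℤ.*-zeroˡ a) (0•x x)

    suc•x : ∀ k (x : Vec ℤ n) → suc k • x ≡ x ⊕ k • x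
    suc•x k []      = refl
    suc•x k (a ∷ x) = cong₂ _∷_ (ℤ.suc-* (+ k) a) (suc•x k x)

    *•x : ∀ j k (x : Vec ℤ n) → (j ℕ.* k) • x ≡ j • k • x
    *•x j k []      = refl
    *•x j k (a ∷ x) = cong₂ _∷_ (trans (cong (ℤ._* a) (ℤ.pos-* j k)) (ℤ.*-assoc (+ j) (+ k) a)) (*•x j k x)

    +•x : ∀ j k (x : Vec ℤ n) → (j ℕ.+ k) • x ⊝ j • x ≡ k • x
    +•x j k []      = refl
    +•x j k (a ∷ x) = cong₂ _∷_
      (trans (cong (λ u → u ℤ.* a ℤ.- + j ℤ.* a) (ℤ.pos-+ j k))
        (solve 3 (λ j k a → (j :+ k) :* a :+ :- (j :* a) := k :* a) refl (+ j) (+ k) a)) (+•x j k x)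

    split : ∀ M .{{_ : ℕ.NonZero M}} {x y : Vec ℤ n} → Residues._∼_ M x y → ∃ λ v → x ≡ y ⊕ M • v
    split M []                          = [] , refl
    split M {a ∷ _} {b ∷ _} (divides q eq ∷ ps) =
      let v , eq′ = split M ps in q ∷ v , cong₂ _∷_
        (trans (solve 2 (λ a b → a := b :+ (a :+ :- b)) refl a b)
               (cong (λ u → b ℤ.+ u) (trans eq (ℤ.*-comm q (+ M))))) eq′

  module FiniteIndex {n m} (A : Subring n m) where
    open Subring A renaming (carrier to L)
    module I = Bijection hasIndex

    class : Vec ℤ n → Fin m
    class x = proj₁ (I.surjective x)

    class⁻ : ∀ {x y} → class x ≡ class y → x ⊝ y ∈ L
    class⁻ {x} {y} eq = Setoid.trans (quotient isSubring)
      (Setoid.sym (quotient isSubring) (proj₂ (I.surjective x) refl))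
      (Setoid.trans (quotient isSubring) (I.cong eq) (proj₂ (I.surjective y) refl))

    class⁺ : ∀ {x y} → x ⊝ y ∈ L → class x ≡ class y
    class⁺ {x} {y} p = I.injective (Setoid.trans (quotient isSubring) (proj₂ (I.surjective x) refl)
      (Setoid.trans (quotient isSubring) p (Setoid.sym (quotient isSubring) (proj₂ (I.surjective y) refl))))

    L? : Decidable L
    L? x = Dec.map′ (λ p → subst L (⊝-𝟘 x) (class⁻ p)) (λ x∈ → class⁺ (subst L (sym (⊝-𝟘 x)) x∈))
                    (class x Fin.≟ class 𝟘)

    •-closed : ∀ k {x} → x ∈ L → k • x ∈ L
    •-closed zero    {x} _  = subst L (sym (0•x x)) 0-mem
    •-closed (suc k) {x} x∈ = subst L (sym (suc•x k x)) (+-closed x∈ (•-closed k x∈))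

    m!•x∈L : ∀ x → (m !) • x ∈ L
    m!•x∈L x with pigeonhole (ℕ.n<1+n m) (λ i → class (toℕ i • x))
    ... | i , j , i<j , eq =
      let k = toℕ j ℕ.∸ toℕ i
          i+k≡j = ℕ.m+[n∸m]≡n (ℕ.<⇒≤ i<j)
          k•x∈ = subst L (+•x (toℕ i) k x)
                   (subst (λ j → j • x ⊝ toℕ i • x ∈ L) (sym i+k≡j) (class⁻ (sym eq)))
          k≤m = ℕ.≤-trans (ℕ.m∸n≤m (toℕ j) (toℕ i)) (ℕ.≤-pred (Fin.toℕ<n j))
          instance k≢0 = ℕ.>-nonZero (ℕ.m<n⇒0<n∸m i<j)
          ℕ∣.divides q m!≡q*k = ℕ∣.∣-trans (k∣k! k) (ℕ∣.m≤n⇒m!∣n! k≤m)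
      in subst (λ u → u • x ∈ L) (sym m!≡q*k) (subst L (sym (*•x q k x)) (•-closed q k•x∈))


  finite : ∀ n m → ∃ (HasCardinality (subrings n m))
  finite n m = enumerable⇒finite (subrings n m) _≐?_
      (candidates m (sublists (residues n))) enum
    where
    instance M≢0 = m ℕ.!≢0
    open Residues (m !)

    module _ (A : Subring n m) where
      open Subring A renaming (carrier to L)
      open FiniteIndex A public using (L?; m!•x∈L)

      resp : ∀ {x y} → x ∼ y → y ∈ L → x ∈ L
      resp x∼y y∈ = let v , eq = split (m !) x∼y in subst L (sym eq) (+-closed y∈ (m!•x∈L v))

      ⟦filter⟧ : ⟦ List.filter L? (residues n) ⟧ ≐ L
      ⟦filter⟧ =
        (λ x∈ → let _ , a∈ , x∼a = ∈.find x∈ in resp x∼a (proj₂ (∈-filter⁻ L? {xs = residues n} a∈))) ,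
        (λ {x} x∈ → let r , r∈ , x∼r = residue x in
                    ∈.lose (∈-filter⁺ L? r∈ (resp (∼-sym x∼r) x∈)) x∼r)

    ⊆? : ∀ (A B : Subring n m) → Dec (Subring.carrier A ⊆ Subring.carrier B)
    ⊆? A B = Dec.map′
      (λ p {x} x∈ → let r , r∈ , x∼r = residue x in
                    resp B x∼r (All.lookup p r∈ (resp A (∼-sym x∼r) x∈)))
      (λ p → All.tabulate λ _ → p)
      (All.all? (λ r → L? A r →-dec L? B r) (residues n))

    _≐?_ : ∀ (A B : Subring n m) → Dec (Subring.carrier A ≐ Subring.carrier B)
    A ≐? B = ⊆? A B ×-dec ⊆? B A

    transport : ∀ {P Q : Pred (Vec ℤ n) 0ℓ} → P ≐ Q → IsSubring Q → IsSubring P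
    transport (f , g) S = record
      { 0-mem    = g 0-mem
      ; 1-mem    = g 1-mem
      ; +-closed = λ p q → g (+-closed (f p) (f q))
      ; -‿closed = λ p → g (-‿closed (f p))
      ; *-closed = λ p q → g (*-closed (f p) (f q))
      } where open IsSubring S

    enum : IsEnumeration (subrings n m) (candidates m (sublists (residues n)))
    enum A = Any.map (≐-trans (≐-sym eqv))
        (candidates⁺ (filter-sublist (L? A) (residues n)) T
          (index-resp (Subring.isSubring A) T (proj₂ eqv , proj₁ eqv) (Subring.hasIndex A)))
      where
      eqv = ⟦filter⟧ A
      T   = transport eqv (Subring.isSubring A)

abstract
  subrings-finite : ∀ n m → ∃ (HasCardinality (subrings n m))
  subrings-finite = Finiteness.finite

-- proj₂ (subrings-finite n m) is the bijection of Fin (f n m) with the subrings of index m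
-- which characterises f n m.
f : ℕ → ℕ → ℕ
f n m = proj₁ (subrings-finite n m)

open ℚ.≤-Reasoning

IsCauchy : (ℕ → ℚ) → Set
IsCauchy s = ∀ ε → 0ℚ ℚ.< ε → ∃ λ N → ∀ i j → N ℕ.≤ i → N ℕ.≤ j → ℚ.∣ s i ℚ.- s j ∣ ℚ.≤ ε

record ℝ : Set where
  field
    seq    : ℕ → ℚ
    cauchy : IsCauchy seq

module ℚ-Lemmas where

  ½-pos : ∀ {ε} → 0ℚ ℚ.< ε → 0ℚ ℚ.< ½ ℚ.* ε
  ½-pos {ε} 0<ε = subst (ℚ._< ½ ℚ.* ε) (ℚ.*-zeroʳ ½) (ℚ.*-monoʳ-<-pos ½ 0<ε)

  ½+½ : ∀ ε → ½ ℚ.* ε ℚ.+ ½ ℚ.* ε ≡ ε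
  ½+½ ε = trans (sym (ℚ.*-distribʳ-+ ε ½ ½)) (ℚ.*-identityˡ ε)

  tri : ∀ a b c → ℚ.∣ a ℚ.- c ∣ ℚ.≤ ℚ.∣ a ℚ.- b ∣ ℚ.+ ℚ.∣ b ℚ.- c ∣
  tri a b c = subst (λ u → ℚ.∣ u ∣ ℚ.≤ ℚ.∣ a ℚ.- b ∣ ℚ.+ ℚ.∣ b ℚ.- c ∣)
    (solve 3 (λ a b c → (a :+ :- b) :+ (b :+ :- c) := a :+ :- c) refl a b c)
    (ℚ.∣p+q∣≤∣p∣+∣q∣ (a ℚ.- b) (b ℚ.- c))
    where open ℚ-Solver

  abs-sym : ∀ a b → ℚ.∣ a ℚ.- b ∣ ≡ ℚ.∣ b ℚ.- a ∣
  abs-sym a b = trans (sym (ℚ.∣-p∣≡∣p∣ (a ℚ.- b)))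
    (cong ℚ.∣_∣ (solve 2 (λ a b → :- (a :+ :- b) := b :+ :- a) refl a b))
    where open ℚ-Solver

  ½-pos′ : ∀ ε → 0ℚ ℚ.< ε → 0ℚ ℚ.≤ ½ ℚ.* ε
  ½-pos′ ε p = ℚ.<⇒≤ (½-pos p)

  *-mono : ∀ {r p q} → 0ℚ ℚ.≤ r → p ℚ.≤ q → r ℚ.* p ℚ.≤ r ℚ.* q
  *-mono {r} 0≤r = ℚ.*-monoˡ-≤-nonNeg r {{ℚ.nonNegative 0≤r}}

  *-mono₂ : ∀ {p q r s} → 0ℚ ℚ.≤ r → 0ℚ ℚ.≤ q → p ℚ.≤ q → r ℚ.≤ s → p ℚ.* r ℚ.≤ q ℚ.* s
  *-mono₂ {p} {q} {r} {s} 0≤r 0≤q p≤q r≤s =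
    ℚ.≤-trans (ℚ.*-monoʳ-≤-nonNeg r {{ℚ.nonNegative 0≤r}} p≤q) (*-mono 0≤q r≤s)

  *-nonNeg : ∀ {p q} → 0ℚ ℚ.≤ p → 0ℚ ℚ.≤ q → 0ℚ ℚ.≤ p ℚ.* q
  *-nonNeg {p} {q} 0≤p 0≤q = subst (ℚ._≤ p ℚ.* q) (ℚ.*-zeroʳ p) (*-mono 0≤p 0≤q)

  +-nonNeg : ∀ {p q} → 0ℚ ℚ.≤ p → 0ℚ ℚ.≤ q → 0ℚ ℚ.≤ p ℚ.+ q
  +-nonNeg = ℚ.+-mono-≤

  p≤q⇒0≤q-p : ∀ {p q} → p ℚ.≤ q → 0ℚ ℚ.≤ q ℚ.- p
  p≤q⇒0≤q-p {p} {q} p≤q = subst (ℚ._≤ q ℚ.- p) (ℚ.+-inverseʳ p) (ℚ.+-monoˡ-≤ (ℚ.- p) p≤q)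

  0≤q-p⇒p≤q : ∀ {p q} → 0ℚ ℚ.≤ q ℚ.- p → p ℚ.≤ q
  0≤q-p⇒p≤q {p} {q} h = subst₂ ℚ._≤_ (ℚ.+-identityˡ p)
    (solve 2 (λ p q → (q :+ :- p) :+ p := q) refl p q) (ℚ.+-monoˡ-≤ p h)
    where open ℚ-Solver

  cauchy-from : ∀ s → (∀ ε → 0ℚ ℚ.< ε → ∃ λ N → ∀ j → ℚ.∣ s (N ℕ.+ j) ℚ.- s N ∣ ℚ.≤ ε) →
                IsCauchy s
  cauchy-from s h ε 0<ε =
    let N , p = h (½ ℚ.* ε) (½-pos 0<ε)
        p′ : ∀ i → N ℕ.≤ i → ℚ.∣ s i ℚ.- s N ∣ ℚ.≤ ½ ℚ.* ε
        p′ i N≤i = subst (λ i → ℚ.∣ s i ℚ.- s N ∣ ℚ.≤ ½ ℚ.* ε) (ℕ.m+[n∸m]≡n N≤i) (p (i ℕ.∸ N))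
    in N , λ i j N≤i N≤j → begin
      ℚ.∣ s i ℚ.- s j ∣                           ≤⟨ tri (s i) (s N) (s j) ⟩
      ℚ.∣ s i ℚ.- s N ∣ ℚ.+ ℚ.∣ s N ℚ.- s j ∣     ≡⟨ cong (λ u → ℚ.∣ s i ℚ.- s N ∣ ℚ.+ u) (abs-sym (s N) (s j)) ⟩
      ℚ.∣ s i ℚ.- s N ∣ ℚ.+ ℚ.∣ s j ℚ.- s N ∣     ≤⟨ ℚ.+-mono-≤ (p′ i N≤i) (p′ j N≤j) ⟩
      ½ ℚ.* ε ℚ.+ ½ ℚ.* ε                         ≡⟨ ½+½ ε ⟩
      ε ∎

  const-cauchy : ∀ q → IsCauchy (λ _ → q)
  const-cauchy q ε 0<ε = 0 , λ _ _ _ _ →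
    subst (λ u → ℚ.∣ u ∣ ℚ.≤ ε) (sym (ℚ.+-inverseʳ q)) (ℚ.<⇒≤ 0<ε)

  +-cauchy : ∀ {s t} → IsCauchy s → IsCauchy t → IsCauchy (λ i → s i ℚ.+ t i)
  +-cauchy {s} {t} cs ct ε 0<ε =
    let N , p = cs (½ ℚ.* ε) (½-pos 0<ε)
        M , q = ct (½ ℚ.* ε) (½-pos 0<ε)
    in N ℕ.⊔ M , λ i j N≤i N≤j → begin
      ℚ.∣ (s i ℚ.+ t i) ℚ.- (s j ℚ.+ t j) ∣     ≡⟨ cong ℚ.∣_∣ (regroup (s i) (t i) (s j) (t j)) ⟩
      ℚ.∣ (s i ℚ.- s j) ℚ.+ (t i ℚ.- t j) ∣     ≤⟨ ℚ.∣p+q∣≤∣p∣+∣q∣ (s i ℚ.- s j) (t i ℚ.- t j) ⟩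
      ℚ.∣ s i ℚ.- s j ∣ ℚ.+ ℚ.∣ t i ℚ.- t j ∣   ≤⟨ ℚ.+-mono-≤ (p i j (ℕ.m⊔n≤o⇒m≤o N M N≤i) (ℕ.m⊔n≤o⇒m≤o N M N≤j)) (q i j (ℕ.m⊔n≤o⇒n≤o N M N≤i) (ℕ.m⊔n≤o⇒n≤o N M N≤j)) ⟩
      ½ ℚ.* ε ℚ.+ ½ ℚ.* ε                       ≡⟨ ½+½ ε ⟩
      ε ∎
    where
    regroup : ∀ a b c d → (a ℚ.+ b) ℚ.- (c ℚ.+ d) ≡ (a ℚ.- c) ℚ.+ (b ℚ.- d)
    regroup = solve 4 (λ a b c d → (a :+ b) :+ :- (c :+ d) := (a :+ :- c) :+ (b :+ :- d)) refl
      where open ℚ-Solver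

  neg-cauchy : ∀ {s} → IsCauchy s → IsCauchy (λ i → ℚ.- s i)
  neg-cauchy {s} cs ε 0<ε =
    let N , p = cs ε 0<ε in N , λ i j N≤i N≤j → begin
      ℚ.∣ (ℚ.- s i) ℚ.- (ℚ.- s j) ∣   ≡⟨ cong ℚ.∣_∣ (sym (ℚ.neg-distrib-+ (s i) (ℚ.- s j))) ⟩
      ℚ.∣ ℚ.- (s i ℚ.- s j) ∣         ≡⟨ ℚ.∣-p∣≡∣p∣ (s i ℚ.- s j) ⟩
      ℚ.∣ s i ℚ.- s j ∣               ≤⟨ p i j N≤i N≤j ⟩
      ε ∎

  fromℕ : ℕ → ℚ
  fromℕ n = + n ℚ./ 1

  recip : ℕ → ℚ
  recip k = + 1 ℚ./ suc k

  /-toℚᵘ : ∀ i k → ℚ.toℚᵘ (i ℚ./ suc k) ℚᵘ.≃ ℚᵘ.mkℚᵘ i k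
  /-toℚᵘ i k = ℚ.toℚᵘ-fromℚᵘ (ℚᵘ.mkℚᵘ i k)

  fromℕ-suc : ∀ n → fromℕ (suc n) ≡ 1ℚ ℚ.+ fromℕ n
  fromℕ-suc n = ℚ.toℚᵘ-injective (ℚᵘ.≃-trans (/-toℚᵘ (+ suc n) 0) (ℚᵘ.≃-sym (ℚᵘ.≃-trans
    (ℚ.toℚᵘ-homo-+ 1ℚ (fromℕ n)) (ℚᵘ.≃-trans (ℚᵘ.+-cong (ℚᵘ.≃-refl {ℚᵘ.1ℚᵘ}) (/-toℚᵘ (+ n) 0))
      (ℚᵘ.*≡* (cong (ℤ._* + 1) (cong (λ u → 1ℤ ℤ.+ u) (ℤ.*-identityʳ (+ n)))))))))

  fromℕ-*-recip : ∀ a b k → a ℕ.* suc k ≡ suc b → fromℕ a ℚ.* recip b ≡ recip k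
  fromℕ-*-recip a b k eq = ℚ.toℚᵘ-injective (ℚᵘ.≃-trans (ℚ.toℚᵘ-homo-* (fromℕ a) (recip b))
    (ℚᵘ.≃-trans (ℚᵘ.*-cong (/-toℚᵘ (+ a) 0) (/-toℚᵘ (+ 1) b)) (ℚᵘ.≃-trans
      (ℚᵘ.*≡* lemma) (ℚᵘ.≃-sym (/-toℚᵘ (+ 1) k)))))
    where
    lemma : (+ a ℤ.* + 1) ℤ.* + suc k ≡ + 1 ℤ.* + (1 ℕ.* suc b)
    lemma = trans (cong (ℤ._* + suc k) (ℤ.*-identityʳ (+ a))) (trans (sym (ℤ.pos-* a (suc k)))
      (trans (cong +_ (trans eq (sym (ℕ.*-identityˡ (suc b))))) (sym (ℤ.*-identityˡ _))))

  recip-nonNeg : ∀ k → 0ℚ ℚ.≤ recip k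
  recip-nonNeg k = ℚ.nonNegative⁻¹ (recip k) {{ℚ.normalize-nonNeg 1 (suc k)}}

  recip-pos : ∀ k → 0ℚ ℚ.< recip k
  recip-pos k = ℚ.positive⁻¹ (recip k) {{ℚ.normalize-pos 1 (suc k)}}

  fromℕ-nonNeg : ∀ n → 0ℚ ℚ.≤ fromℕ n
  fromℕ-nonNeg n = ℚ.nonNegative⁻¹ (fromℕ n) {{ℚ.normalize-nonNeg n 1}}

  fromℕ-mono : ∀ {m n} → m ℕ.≤ n → fromℕ m ℚ.≤ fromℕ n
  fromℕ-mono {m} {n} m≤n = ℚ.toℚᵘ-cancel-≤ (ℚᵘ.≤-respˡ-≃ (ℚᵘ.≃-sym (/-toℚᵘ (+ m) 0))
    (ℚᵘ.≤-respʳ-≃ (ℚᵘ.≃-sym (/-toℚᵘ (+ n) 0))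
      (ℚᵘ.*≤* (ℤ.*-monoʳ-≤-nonNeg (+ 1) (ℤ.+≤+ m≤n)))))

  recip-antimono : ∀ {j k} → j ℕ.≤ k → recip k ℚ.≤ recip j
  recip-antimono {j} {k} j≤k = ℚ.toℚᵘ-cancel-≤ (ℚᵘ.≤-respˡ-≃ (ℚᵘ.≃-sym (/-toℚᵘ (+ 1) k))
    (ℚᵘ.≤-respʳ-≃ (ℚᵘ.≃-sym (/-toℚᵘ (+ 1) j))
      (ℚᵘ.*≤* (ℤ.*-monoˡ-≤-nonNeg (+ 1) (ℤ.+≤+ (ℕ.s≤s j≤k))))))

  archimedean : ∀ q → ∃ λ n → q ℚ.≤ fromℕ n
  archimedean q@(mkℚ i d _) = ℤ.∣ i ∣ , ℚ.toℚᵘ-cancel-≤ (ℚᵘ.≤-respʳ-≃ (ℚᵘ.≃-sym (/-toℚᵘ (+ ℤ.∣ i ∣) 0))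
    (ℚᵘ.*≤* (ℤ.≤-trans (ℤ.≤-reflexive (ℤ.*-identityʳ i)) (lemma i))))
    where
    lemma : ∀ i → i ℤ.≤ + ℤ.∣ i ∣ ℤ.* + suc d
    lemma (+ n)        = subst (+ n ℤ.≤_) (ℤ.pos-* n (suc d)) (ℤ.+≤+ (ℕ.m≤m*n n (suc d)))
    lemma ℤ.-[1+ n ]   = ℤ.-≤+

  small : ∀ B ε → 0ℚ ℚ.< ε → ∃ λ k → B ℚ.* recip k ℚ.≤ ε
  small B ε 0<ε =
    let instance
          ε≢0 = ℚ.pos⇒nonZero ε {{ℚ.positive 0<ε}}
        n , h = archimedean (B ℚ.* (ℚ.1/ ε))
    in n , (begin
      B ℚ.* recip n                            ≡⟨ cong (ℚ._* recip n) (sym (ℚ.*-identityʳ B)) ⟩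
      (B ℚ.* 1ℚ) ℚ.* recip n                   ≡⟨ cong (λ u → (B ℚ.* u) ℚ.* recip n) (sym (ℚ.*-inverseˡ ε)) ⟩
      (B ℚ.* ((ℚ.1/ ε) ℚ.* ε)) ℚ.* recip n     ≡⟨ assoc B (ℚ.1/ ε) ε (recip n) ⟩
      (B ℚ.* (ℚ.1/ ε)) ℚ.* (ε ℚ.* recip n)     ≤⟨ ℚ.*-monoʳ-≤-nonNeg (ε ℚ.* recip n) {{ℚ.nonNegative (*-nonNeg (ℚ.<⇒≤ 0<ε) (recip-nonNeg n))}} (ℚ.≤-trans h (fromℕ-mono (ℕ.n≤1+n n))) ⟩
      fromℕ (suc n) ℚ.* (ε ℚ.* recip n)        ≡⟨ comm (fromℕ (suc n)) ε (recip n) ⟩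
      ε ℚ.* (fromℕ (suc n) ℚ.* recip n)        ≡⟨ cong (ε ℚ.*_) (fromℕ-*-recip (suc n) n 0 (ℕ.*-identityʳ (suc n))) ⟩
      ε ℚ.* 1ℚ                                 ≡⟨ ℚ.*-identityʳ ε ⟩
      ε ∎)
    where
    open ℚ-Solver
    assoc : ∀ b c e r → (b ℚ.* (c ℚ.* e)) ℚ.* r ≡ (b ℚ.* c) ℚ.* (e ℚ.* r)
    assoc = solve 4 (λ b c e r → (b :* (c :* e)) :* r := (b :* c) :* (e :* r)) refl
    comm : ∀ n e r → n ℚ.* (e ℚ.* r) ≡ e ℚ.* (n ℚ.* r)
    comm = solve 3 (λ n e r → n :* (e :* r) := e :* (n :* r)) refl

  bounded : ∀ {s} → IsCauchy s → ∃ λ B → ∃ λ N → ∀ i → N ℕ.≤ i → ℚ.∣ s i ∣ ℚ.≤ fromℕ B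
  bounded {s} cs =
    let N , p = cs 1ℚ (ℚ.positive⁻¹ 1ℚ)
        B , h = archimedean (1ℚ ℚ.+ ℚ.∣ s N ∣)
    in B , N , λ i N≤i → begin
      ℚ.∣ s i ∣                         ≡⟨ cong ℚ.∣_∣ (add (s i) (s N)) ⟩
      ℚ.∣ (s i ℚ.- s N) ℚ.+ s N ∣       ≤⟨ ℚ.∣p+q∣≤∣p∣+∣q∣ (s i ℚ.- s N) (s N) ⟩
      ℚ.∣ s i ℚ.- s N ∣ ℚ.+ ℚ.∣ s N ∣   ≤⟨ ℚ.+-monoˡ-≤ ℚ.∣ s N ∣ (p i N N≤i ℕ.≤-refl) ⟩
      1ℚ ℚ.+ ℚ.∣ s N ∣                  ≤⟨ h ⟩
      fromℕ B ∎
    where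
    open ℚ-Solver
    add : ∀ a b → a ≡ (a ℚ.- b) ℚ.+ b
    add = solve 2 (λ a b → a := (a :+ :- b) :+ b) refl

  *-cauchy : ∀ {s t} → IsCauchy s → IsCauchy t → IsCauchy (λ i → s i ℚ.* t i)
  *-cauchy {s} {t} cs ct ε 0<ε =
    let B , N₁ , bs = bounded {s} cs
        C , N₂ , bt = bounded {t} ct
        j₁ , d₁ = small (fromℕ B) (½ ℚ.* ε) (½-pos 0<ε)
        j₂ , d₂ = small (fromℕ C) (½ ℚ.* ε) (½-pos 0<ε)
        N₃ , p  = cs (recip j₂) (recip-pos j₂)
        N₄ , q  = ct (recip j₁) (recip-pos j₁)
        N = (N₁ ℕ.⊔ N₂) ℕ.⊔ (N₃ ℕ.⊔ N₄)
        l₁ : ∀ {i} → N ℕ.≤ i → N₁ ℕ.≤ i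
        l₁ = ℕ.≤-trans (ℕ.≤-trans (ℕ.m≤m⊔n N₁ N₂) (ℕ.m≤m⊔n (N₁ ℕ.⊔ N₂) (N₃ ℕ.⊔ N₄)))
        l₂ : ∀ {i} → N ℕ.≤ i → N₂ ℕ.≤ i
        l₂ = ℕ.≤-trans (ℕ.≤-trans (ℕ.m≤n⊔m N₁ N₂) (ℕ.m≤m⊔n (N₁ ℕ.⊔ N₂) (N₃ ℕ.⊔ N₄)))
        l₃ : ∀ {i} → N ℕ.≤ i → N₃ ℕ.≤ i
        l₃ = ℕ.≤-trans (ℕ.≤-trans (ℕ.m≤m⊔n N₃ N₄) (ℕ.m≤n⊔m (N₁ ℕ.⊔ N₂) (N₃ ℕ.⊔ N₄)))
        l₄ : ∀ {i} → N ℕ.≤ i → N₄ ℕ.≤ i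
        l₄ = ℕ.≤-trans (ℕ.≤-trans (ℕ.m≤n⊔m N₃ N₄) (ℕ.m≤n⊔m (N₁ ℕ.⊔ N₂) (N₃ ℕ.⊔ N₄)))
    in N , λ i j N≤i N≤j → begin
      ℚ.∣ s i ℚ.* t i ℚ.- s j ℚ.* t j ∣
        ≡⟨ cong ℚ.∣_∣ (regroup (s i) (t i) (s j) (t j)) ⟩
      ℚ.∣ s i ℚ.* (t i ℚ.- t j) ℚ.+ t j ℚ.* (s i ℚ.- s j) ∣
        ≤⟨ ℚ.∣p+q∣≤∣p∣+∣q∣ (s i ℚ.* (t i ℚ.- t j)) (t j ℚ.* (s i ℚ.- s j)) ⟩
      ℚ.∣ s i ℚ.* (t i ℚ.- t j) ∣ ℚ.+ ℚ.∣ t j ℚ.* (s i ℚ.- s j) ∣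
        ≡⟨ cong₂ ℚ._+_ (ℚ.∣p*q∣≡∣p∣*∣q∣ (s i) (t i ℚ.- t j)) (ℚ.∣p*q∣≡∣p∣*∣q∣ (t j) (s i ℚ.- s j)) ⟩
      ℚ.∣ s i ∣ ℚ.* ℚ.∣ t i ℚ.- t j ∣ ℚ.+ ℚ.∣ t j ∣ ℚ.* ℚ.∣ s i ℚ.- s j ∣
        ≤⟨ ℚ.+-mono-≤
            (*-mono₂ (ℚ.0≤∣p∣ (t i ℚ.- t j)) (fromℕ-nonNeg B) (bs i (l₁ N≤i)) (q i j (l₄ N≤i) (l₄ N≤j)))
            (*-mono₂ (ℚ.0≤∣p∣ (s i ℚ.- s j)) (fromℕ-nonNeg C) (bt j (l₂ N≤j)) (p i j (l₃ N≤i) (l₃ N≤j))) ⟩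
      fromℕ B ℚ.* recip j₁ ℚ.+ fromℕ C ℚ.* recip j₂
        ≤⟨ ℚ.+-mono-≤ d₁ d₂ ⟩
      ½ ℚ.* ε ℚ.+ ½ ℚ.* ε
        ≡⟨ ½+½ ε ⟩
      ε ∎
    where
    open ℚ-Solver
    regroup : ∀ a b c d → a ℚ.* b ℚ.- c ℚ.* d ≡ a ℚ.* (b ℚ.- d) ℚ.+ d ℚ.* (a ℚ.- c)
    regroup = solve 4 (λ a b c d → (a :* b) :+ :- (c :* d) := a :* (b :+ :- d) :+ d :* (a :+ :- c)) refl

open ℚ-Lemmas
open ℝ public

infix  4 _≤ᴿ_
infixl 6 _+ᴿ_ _+ᶜ_ _-ᶜ_
infixl 7 _*ᴿ_ _*ᶜ_
infix  8 -ᴿ_ -ᶜ_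

_≤ᴿ_ : ℝ → ℝ → Set
x ≤ᴿ y = ∀ ε → 0ℚ ℚ.< ε → ∃ λ N → ∀ i → N ℕ.≤ i → seq x i ℚ.≤ seq y i ℚ.+ ε

fromℚ : ℚ → ℝ
fromℚ q = record { seq = λ _ → q ; cauchy = const-cauchy q }

_+ᴿ_ _*ᴿ_ : ℝ → ℝ → ℝ
x +ᴿ y = record { seq = λ i → seq x i ℚ.+ seq y i ; cauchy = +-cauchy {seq x} {seq y} (cauchy x) (cauchy y) }
x *ᴿ y = record { seq = λ i → seq x i ℚ.* seq y i ; cauchy = *-cauchy {seq x} {seq y} (cauchy x) (cauchy y) }

-ᴿ_ : ℝ → ℝ
-ᴿ x = record { seq = λ i → ℚ.- seq x i ; cauchy = neg-cauchy {seq x} (cauchy x) }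

record ℂ : Set where
  constructor _+𝕚_
  field
    Re Im : ℝ

open ℂ public

_+ᶜ_ _*ᶜ_ : ℂ → ℂ → ℂ
(a +𝕚 b) +ᶜ (c +𝕚 d) = (a +ᴿ c) +𝕚 (b +ᴿ d)
(a +𝕚 b) *ᶜ (c +𝕚 d) = (a *ᴿ c +ᴿ -ᴿ (b *ᴿ d)) +𝕚 (a *ᴿ d +ᴿ b *ᴿ c)

-ᶜ_ : ℂ → ℂ
-ᶜ (a +𝕚 b) = (-ᴿ a) +𝕚 (-ᴿ b)

_-ᶜ_ : ℂ → ℂ → ℂ
z -ᶜ w = z +ᶜ -ᶜ w

∣_∣² : ℂ → ℝ
∣ a +𝕚 b ∣² = a *ᴿ a +ᴿ b *ᴿ b

ℕ→ℂ : ℕ → ℂ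
ℕ→ℂ n = fromℚ (+ n ℚ./ 1) +𝕚 fromℚ 0ℚ

-- pairs (real part , imaginary part)

ℚ[i] : Set
ℚ[i] = ℚ × ℚ

_+ᵍ_ _*ᵍ_ : ℚ[i] → ℚ[i] → ℚ[i]
(a , b) +ᵍ (c , d) = a ℚ.+ c , b ℚ.+ d
(a , b) *ᵍ (c , d) = a ℚ.* c ℚ.- b ℚ.* d , a ℚ.* d ℚ.+ b ℚ.* c

_·ᵍ_ : ℚ → ℚ[i] → ℚ[i]
q ·ᵍ (a , b) = q ℚ.* a , q ℚ.* b

-- expTerm k z = zᵏ / k!
expTerm : ℕ → ℚ[i] → ℚ[i]
expTerm zero    z = 1ℚ , 0ℚ
expTerm (suc k) z = (+ 1 ℚ./ suc k) ·ᵍ (z *ᵍ expTerm k z)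

expSum : ℕ → ℚ[i] → ℚ[i]
expSum zero    z = 0ℚ , 0ℚ
expSum (suc k) z = expSum k z +ᵍ expTerm k z

approx : ℂ → ℕ → ℚ[i]
approx z i = seq (Re z) i , seq (Im z) i

module ExpConvergence where

  norm : ℚ[i] → ℚ
  norm (a , b) = ℚ.∣ a ∣ ℚ.+ ℚ.∣ b ∣

  norm-nonNeg : ∀ z → 0ℚ ℚ.≤ norm z
  norm-nonNeg (a , b) = +-nonNeg (ℚ.0≤∣p∣ a) (ℚ.0≤∣p∣ b)

  norm-+ : ∀ z w → norm (z +ᵍ w) ℚ.≤ norm z ℚ.+ norm w
  norm-+ (a , b) (c , d) = ℚ.≤-trans (ℚ.+-mono-≤ (ℚ.∣p+q∣≤∣p∣+∣q∣ a c) (ℚ.∣p+q∣≤∣p∣+∣q∣ b d))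
    (ℚ.≤-reflexive (solve 4 (λ a b c d → (a :+ c) :+ (b :+ d) := (a :+ b) :+ (c :+ d)) refl ℚ.∣ a ∣ ℚ.∣ b ∣ ℚ.∣ c ∣ ℚ.∣ d ∣))
    where open ℚ-Solver

  norm-* : ∀ z w → norm (z *ᵍ w) ℚ.≤ norm z ℚ.* norm w
  norm-* (a , b) (c , d) = begin
    ℚ.∣ a ℚ.* c ℚ.- b ℚ.* d ∣ ℚ.+ ℚ.∣ a ℚ.* d ℚ.+ b ℚ.* c ∣
      ≤⟨ ℚ.+-mono-≤ (ℚ.∣p-q∣≤∣p∣+∣q∣ (a ℚ.* c) (b ℚ.* d)) (ℚ.∣p+q∣≤∣p∣+∣q∣ (a ℚ.* d) (b ℚ.* c)) ⟩
    (ℚ.∣ a ℚ.* c ∣ ℚ.+ ℚ.∣ b ℚ.* d ∣) ℚ.+ (ℚ.∣ a ℚ.* d ∣ ℚ.+ ℚ.∣ b ℚ.* c ∣)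
      ≡⟨ cong₂ ℚ._+_ (cong₂ ℚ._+_ (ℚ.∣p*q∣≡∣p∣*∣q∣ a c) (ℚ.∣p*q∣≡∣p∣*∣q∣ b d))
                     (cong₂ ℚ._+_ (ℚ.∣p*q∣≡∣p∣*∣q∣ a d) (ℚ.∣p*q∣≡∣p∣*∣q∣ b c)) ⟩
    (ℚ.∣ a ∣ ℚ.* ℚ.∣ c ∣ ℚ.+ ℚ.∣ b ∣ ℚ.* ℚ.∣ d ∣) ℚ.+ (ℚ.∣ a ∣ ℚ.* ℚ.∣ d ∣ ℚ.+ ℚ.∣ b ∣ ℚ.* ℚ.∣ c ∣)
      ≡⟨ solve 4 (λ a b c d → (a :* c :+ b :* d) :+ (a :* d :+ b :* c) := (a :+ b) :* (c :+ d)) refl ℚ.∣ a ∣ ℚ.∣ b ∣ ℚ.∣ c ∣ ℚ.∣ d ∣ ⟩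
    (ℚ.∣ a ∣ ℚ.+ ℚ.∣ b ∣) ℚ.* (ℚ.∣ c ∣ ℚ.+ ℚ.∣ d ∣) ∎
    where open ℚ-Solver

  norm-· : ∀ {q} → 0ℚ ℚ.≤ q → ∀ z → norm (q ·ᵍ z) ≡ q ℚ.* norm z
  norm-· {q} 0≤q (a , b) = trans
    (cong₂ ℚ._+_ (trans (ℚ.∣p*q∣≡∣p∣*∣q∣ q a) (cong (ℚ._* ℚ.∣ a ∣) (ℚ.0≤p⇒∣p∣≡p 0≤q)))
                 (trans (ℚ.∣p*q∣≡∣p∣*∣q∣ q b) (cong (ℚ._* ℚ.∣ b ∣) (ℚ.0≤p⇒∣p∣≡p 0≤q))))
    (sym (ℚ.*-distribˡ-+ q ℚ.∣ a ∣ ℚ.∣ b ∣))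

  _-ᵍ_ : ℚ[i] → ℚ[i] → ℚ[i]
  (a , b) -ᵍ (c , d) = a ℚ.- c , b ℚ.- d

  module ExpTail (B : ℕ) where

    -- the series for e^B dominates

    D S : ℕ → ℚ
    D zero    = 1ℚ
    D (suc k) = recip k ℚ.* (fromℕ B ℚ.* D k)
    S zero    = 0ℚ
    S (suc k) = S k ℚ.+ D k

    D-nonNeg : ∀ k → 0ℚ ℚ.≤ D k
    D-nonNeg zero    = ℚ.nonNegative⁻¹ 1ℚ
    D-nonNeg (suc k) = *-nonNeg (recip-nonNeg k) (*-nonNeg (fromℕ-nonNeg B) (D-nonNeg k))

    K : ℕ
    K = B ℕ.+ B

    halve : ∀ k → K ℕ.≤ suc k → D (suc k) ℚ.≤ ½ ℚ.* D k
    halve k K≤ = begin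
      recip k ℚ.* (fromℕ B ℚ.* D k)    ≡⟨ sym (ℚ.*-assoc (recip k) (fromℕ B) (D k)) ⟩
      (recip k ℚ.* fromℕ B) ℚ.* D k    ≤⟨ ℚ.*-monoʳ-≤-nonNeg (D k) {{ℚ.nonNegative (D-nonNeg k)}} lem ⟩
      ½ ℚ.* D k ∎
      where
      open ℚ-Solver using (solve; _:=_; _:+_; _:*_; con)
      fromℕ-+ : ∀ a b → fromℕ (a ℕ.+ b) ≡ fromℕ a ℚ.+ fromℕ b
      fromℕ-+ zero    b = sym (ℚ.+-identityˡ (fromℕ b))
      fromℕ-+ (suc a) b = trans (fromℕ-suc (a ℕ.+ b)) (trans (cong (1ℚ ℚ.+_) (fromℕ-+ a b))
        (trans (sym (ℚ.+-assoc 1ℚ (fromℕ a) (fromℕ b))) (cong (ℚ._+ fromℕ b) (sym (fromℕ-suc a)))))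
      lem : recip k ℚ.* fromℕ B ℚ.≤ ½
      lem = begin
        recip k ℚ.* fromℕ B
          ≡⟨ solve 2 (λ r b → r :* b := con ½ :* (r :* (b :+ b))) refl (recip k) (fromℕ B) ⟩
        ½ ℚ.* (recip k ℚ.* (fromℕ B ℚ.+ fromℕ B))
          ≡⟨ cong (λ u → ½ ℚ.* (recip k ℚ.* u)) (sym (fromℕ-+ B B)) ⟩
        ½ ℚ.* (recip k ℚ.* fromℕ K)
          ≤⟨ *-mono (ℚ.nonNegative⁻¹ ½) (*-mono (recip-nonNeg k) (fromℕ-mono K≤)) ⟩
        ½ ℚ.* (recip k ℚ.* fromℕ (suc k))
          ≡⟨ cong (½ ℚ.*_) (trans (ℚ.*-comm (recip k) (fromℕ (suc k))) (fromℕ-*-recip (suc k) k 0 (ℕ.*-identityʳ (suc k)))) ⟩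
        ½ ℚ.* 1ℚ
          ≡⟨ ℚ.*-identityʳ ½ ⟩
        ½ ∎

    decay : ∀ j → fromℕ (suc j) ℚ.* D (K ℕ.+ j) ℚ.≤ D K
    decay zero    = ℚ.≤-reflexive (trans (ℚ.*-identityˡ (D (K ℕ.+ 0))) (cong D (ℕ.+-identityʳ K)))
    decay (suc j) = begin
      fromℕ (2 ℕ.+ j) ℚ.* D (K ℕ.+ suc j)
        ≡⟨ cong₂ (λ u v → u ℚ.* D v) (fromℕ-suc (suc j)) (ℕ.+-suc K j) ⟩
      (1ℚ ℚ.+ c) ℚ.* D (suc (K ℕ.+ j))
        ≤⟨ *-mono₂ (D-nonNeg (suc (K ℕ.+ j))) (+-nonNeg (fromℕ-nonNeg (suc j)) (fromℕ-nonNeg (suc j)))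
             (ℚ.+-monoˡ-≤ c (fromℕ-mono {1} {suc j} (ℕ.s≤s ℕ.z≤n)))
             (halve (K ℕ.+ j) (ℕ.≤-trans (ℕ.m≤m+n K j) (ℕ.n≤1+n _))) ⟩
      (c ℚ.+ c) ℚ.* (½ ℚ.* D (K ℕ.+ j))
        ≡⟨ solve 2 (λ n d → (n :+ n) :* (con ½ :* d) := n :* d) refl c (D (K ℕ.+ j)) ⟩
      c ℚ.* D (K ℕ.+ j)
        ≤⟨ decay j ⟩
      D K ∎
      where
      open ℚ-Solver using (solve; _:=_; _:+_; _:*_; con)
      c = fromℕ (suc j)

    S+2D : ∀ k j → K ℕ.≤ k → S (k ℕ.+ j) ℚ.+ (D (k ℕ.+ j) ℚ.+ D (k ℕ.+ j)) ℚ.≤ S k ℚ.+ (D k ℚ.+ D k)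
    S+2D k zero    K≤k = ℚ.≤-reflexive (cong (λ k → S k ℚ.+ (D k ℚ.+ D k)) (ℕ.+-identityʳ k))
    S+2D k (suc j) K≤k = begin
      S (k ℕ.+ suc j) ℚ.+ (D (k ℕ.+ suc j) ℚ.+ D (k ℕ.+ suc j))
        ≡⟨ cong (λ k → S k ℚ.+ (D k ℚ.+ D k)) (ℕ.+-suc k j) ⟩
      (S l ℚ.+ D l) ℚ.+ (D (suc l) ℚ.+ D (suc l))
        ≤⟨ ℚ.+-monoʳ-≤ (S l ℚ.+ D l) (ℚ.+-mono-≤ h h) ⟩
      (S l ℚ.+ D l) ℚ.+ (½ ℚ.* D l ℚ.+ ½ ℚ.* D l)
        ≡⟨ trans (cong ((S l ℚ.+ D l) ℚ.+_) (½+½ (D l))) (ℚ.+-assoc (S l) (D l) (D l)) ⟩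
      S l ℚ.+ (D l ℚ.+ D l)
        ≤⟨ S+2D k j K≤k ⟩
      S k ℚ.+ (D k ℚ.+ D k) ∎
      where
      l = k ℕ.+ j
      h = halve l (ℕ.≤-trans K≤k (ℕ.≤-trans (ℕ.m≤m+n k j) (ℕ.n≤1+n l)))

    module _ (z : ℚ[i]) (z≤B : norm z ℚ.≤ fromℕ B) where

      term≤D : ∀ k → norm (expTerm k z) ℚ.≤ D k
      term≤D zero    = ℚ.≤-refl
      term≤D (suc k) = begin
        norm (recip k ·ᵍ (z *ᵍ expTerm k z))       ≡⟨ norm-· (recip-nonNeg k) (z *ᵍ expTerm k z) ⟩
        recip k ℚ.* norm (z *ᵍ expTerm k z)        ≤⟨ *-mono (recip-nonNeg k) (norm-* z (expTerm k z)) ⟩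
        recip k ℚ.* (norm z ℚ.* norm (expTerm k z)) ≤⟨ *-mono (recip-nonNeg k) (*-mono₂ (norm-nonNeg (expTerm k z)) (fromℕ-nonNeg B) z≤B (term≤D k)) ⟩
        recip k ℚ.* (fromℕ B ℚ.* D k) ∎

      sum≤S : ∀ k j → norm (expSum (k ℕ.+ j) z -ᵍ expSum k z) ℚ.≤ S (k ℕ.+ j) ℚ.- S k
      sum≤S k zero    rewrite ℕ.+-identityʳ k = ℚ.≤-reflexive
        (trans (cong₂ (λ u v → ℚ.∣ u ∣ ℚ.+ ℚ.∣ v ∣) (ℚ.+-inverseʳ (proj₁ (expSum k z))) (ℚ.+-inverseʳ (proj₂ (expSum k z))))
               (sym (ℚ.+-inverseʳ (S k))))
      sum≤S k (suc j) rewrite ℕ.+-suc k j = begin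
        norm ((expSum (k ℕ.+ j) z +ᵍ expTerm (k ℕ.+ j) z) -ᵍ expSum k z)
          ≡⟨ cong₂ (λ u v → ℚ.∣ u ∣ ℚ.+ ℚ.∣ v ∣) (move (proj₁ (expSum (k ℕ.+ j) z)) _ _) (move (proj₂ (expSum (k ℕ.+ j) z)) _ _) ⟩
        norm ((expSum (k ℕ.+ j) z -ᵍ expSum k z) +ᵍ expTerm (k ℕ.+ j) z)
          ≤⟨ norm-+ (expSum (k ℕ.+ j) z -ᵍ expSum k z) (expTerm (k ℕ.+ j) z) ⟩
        norm (expSum (k ℕ.+ j) z -ᵍ expSum k z) ℚ.+ norm (expTerm (k ℕ.+ j) z)
          ≤⟨ ℚ.+-mono-≤ (sum≤S k j) (term≤D (k ℕ.+ j)) ⟩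
        (S (k ℕ.+ j) ℚ.- S k) ℚ.+ D (k ℕ.+ j)
          ≡⟨ sym (move (S (k ℕ.+ j)) (D (k ℕ.+ j)) (S k)) ⟩
        (S (k ℕ.+ j) ℚ.+ D (k ℕ.+ j)) ℚ.- S k ∎
        where
        open ℚ-Solver using (solve; _:=_; _:+_; :-_)
        move : ∀ a b c → (a ℚ.+ b) ℚ.- c ≡ (a ℚ.- c) ℚ.+ b
        move = solve 3 (λ a b c → (a :+ b) :+ :- c := (a :+ :- c) :+ b) refl

    tail : ∀ ε → 0ℚ ℚ.< ε → ∃ λ k → ∀ z → norm z ℚ.≤ fromℕ B → ∀ i → k ℕ.≤ i →
           norm (expSum i z -ᵍ expSum k z) ℚ.≤ ε
    tail ε 0<ε =
      let j , h = small (D K ℚ.+ D K) ε 0<ε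
          k = K ℕ.+ j
          d : D k ℚ.≤ recip j ℚ.* D K
          d = begin
            D k                                       ≡⟨ sym (ℚ.*-identityˡ (D k)) ⟩
            1ℚ ℚ.* D k                                ≡⟨ cong (ℚ._* D k) (sym (trans (ℚ.*-comm (recip j) (fromℕ (suc j))) (fromℕ-*-recip (suc j) j 0 (ℕ.*-identityʳ (suc j))))) ⟩
            (recip j ℚ.* fromℕ (suc j)) ℚ.* D k       ≡⟨ ℚ.*-assoc (recip j) (fromℕ (suc j)) (D k) ⟩
            recip j ℚ.* (fromℕ (suc j) ℚ.* D k)       ≤⟨ *-mono (recip-nonNeg j) (decay j) ⟩
            recip j ℚ.* D K ∎
      in k , λ z z≤B i k≤i → subst (λ i → norm (expSum i z -ᵍ expSum k z) ℚ.≤ ε) (ℕ.m+[n∸m]≡n k≤i) (begin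
        norm (expSum (k ℕ.+ (i ℕ.∸ k)) z -ᵍ expSum k z)
          ≤⟨ sum≤S z z≤B k (i ℕ.∸ k) ⟩
        S (k ℕ.+ (i ℕ.∸ k)) ℚ.- S k
          ≤⟨ bound k (i ℕ.∸ k) (ℕ.m≤m+n K j) ⟩
        D k ℚ.+ D k
          ≤⟨ ℚ.+-mono-≤ d d ⟩
        recip j ℚ.* D K ℚ.+ recip j ℚ.* D K
          ≡⟨ solve 2 (λ r d → r :* d :+ r :* d := (d :+ d) :* r) refl (recip j) (D K) ⟩
        (D K ℚ.+ D K) ℚ.* recip j
          ≤⟨ h ⟩
        ε ∎)
      where
      open ℚ-Solver using (solve; _:=_; _:+_; _:*_; :-_)
      bound : ∀ k j → K ℕ.≤ k → S (k ℕ.+ j) ℚ.- S k ℚ.≤ D k ℚ.+ D k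
      bound k j K≤k = begin
        S (k ℕ.+ j) ℚ.- S k
          ≡⟨ cong (ℚ._- S k) (sym (ℚ.+-identityʳ (S (k ℕ.+ j)))) ⟩
        (S (k ℕ.+ j) ℚ.+ 0ℚ) ℚ.- S k
          ≤⟨ ℚ.+-monoˡ-≤ (ℚ.- S k) (ℚ.≤-trans (ℚ.+-monoʳ-≤ (S (k ℕ.+ j)) (+-nonNeg (D-nonNeg (k ℕ.+ j)) (D-nonNeg (k ℕ.+ j)))) (S+2D k j K≤k)) ⟩
        (S k ℚ.+ (D k ℚ.+ D k)) ℚ.- S k
          ≡⟨ solve 2 (λ s d → (s :+ d) :+ :- s := d) refl (S k) (D k ℚ.+ D k) ⟩
        D k ℚ.+ D k ∎

  cauchy-approx : ∀ s → (∀ ε → 0ℚ ℚ.< ε → Σ (ℕ → ℚ) λ t → IsCauchy t ×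
                    ∃ λ N → ∀ i → N ℕ.≤ i → ℚ.∣ s i ℚ.- t i ∣ ℚ.≤ ε) → IsCauchy s
  cauchy-approx s h ε 0<ε =
    let δ = ½ ℚ.* (½ ℚ.* ε)
        0<δ = ½-pos (½-pos 0<ε)
        t , ct , N , p = h δ 0<δ
        M , q = ct (½ ℚ.* ε) (½-pos 0<ε)
        N≤ : ∀ {i} → N ℕ.⊔ M ℕ.≤ i → N ℕ.≤ i
        N≤ = ℕ.m⊔n≤o⇒m≤o N M
        M≤ : ∀ {i} → N ℕ.⊔ M ℕ.≤ i → M ℕ.≤ i
        M≤ = ℕ.m⊔n≤o⇒n≤o N M
    in N ℕ.⊔ M , λ i j l≤i l≤j → begin
      ℚ.∣ s i ℚ.- s j ∣
        ≤⟨ tri (s i) (t i) (s j) ⟩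
      ℚ.∣ s i ℚ.- t i ∣ ℚ.+ ℚ.∣ t i ℚ.- s j ∣
        ≤⟨ ℚ.+-mono-≤ (p i (N≤ l≤i)) (tri (t i) (t j) (s j)) ⟩
      δ ℚ.+ (ℚ.∣ t i ℚ.- t j ∣ ℚ.+ ℚ.∣ t j ℚ.- s j ∣)
        ≡⟨ cong (λ u → δ ℚ.+ (ℚ.∣ t i ℚ.- t j ∣ ℚ.+ u)) (abs-sym (t j) (s j)) ⟩
      δ ℚ.+ (ℚ.∣ t i ℚ.- t j ∣ ℚ.+ ℚ.∣ s j ℚ.- t j ∣)
        ≤⟨ ℚ.+-monoʳ-≤ δ (ℚ.+-mono-≤ (q i j (M≤ l≤i) (M≤ l≤j)) (p j (N≤ l≤j))) ⟩
      δ ℚ.+ (½ ℚ.* ε ℚ.+ δ)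
        ≡⟨ solve 2 (λ d h → d :+ (h :+ d) := (d :+ d) :+ h) refl δ (½ ℚ.* ε) ⟩
      (δ ℚ.+ δ) ℚ.+ ½ ℚ.* ε
        ≡⟨ cong (ℚ._+ ½ ℚ.* ε) (½+½ (½ ℚ.* ε)) ⟩
      ½ ℚ.* ε ℚ.+ ½ ℚ.* ε
        ≡⟨ ½+½ ε ⟩
      ε ∎
    where open ℚ-Solver

  module ExpCauchy (z : ℂ) where

    x y : ℕ → ℚ
    x = seq (Re z)
    y = seq (Im z)

    IsCauchyᵍ : (ℕ → ℚ[i]) → Set
    IsCauchyᵍ s = IsCauchy (λ i → proj₁ (s i)) × IsCauchy (λ i → proj₂ (s i))

    term-cauchy : ∀ k → IsCauchyᵍ (λ i → expTerm k (approx z i))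
    term-cauchy zero    = const-cauchy 1ℚ , const-cauchy 0ℚ
    term-cauchy (suc k) =
      let u = λ i → proj₁ (expTerm k (approx z i))
          v = λ i → proj₂ (expTerm k (approx z i))
          cx = cauchy (Re z)
          cy = cauchy (Im z)
          cu , cv = term-cauchy k
      in *-cauchy {λ _ → recip k} {λ i → x i ℚ.* u i ℚ.- y i ℚ.* v i} (const-cauchy (recip k))
           (+-cauchy {λ i → x i ℚ.* u i} {λ i → ℚ.- (y i ℚ.* v i)} (*-cauchy {x} {u} cx cu) (neg-cauchy {λ i → y i ℚ.* v i} (*-cauchy {y} {v} cy cv)))
       , *-cauchy {λ _ → recip k} {λ i → x i ℚ.* v i ℚ.+ y i ℚ.* u i} (const-cauchy (recip k))
           (+-cauchy {λ i → x i ℚ.* v i} {λ i → y i ℚ.* u i} (*-cauchy {x} {v} cx cv) (*-cauchy {y} {u} cy cu))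

    sum-cauchy : ∀ k → IsCauchyᵍ (λ i → expSum k (approx z i))
    sum-cauchy zero    = const-cauchy 0ℚ , const-cauchy 0ℚ
    sum-cauchy (suc k) =
      let a , b = sum-cauchy k ; c , d = term-cauchy k in
      +-cauchy {λ i → proj₁ (expSum k (approx z i))} {λ i → proj₁ (expTerm k (approx z i))} a c ,
      +-cauchy {λ i → proj₂ (expSum k (approx z i))} {λ i → proj₂ (expTerm k (approx z i))} b d

    close : ∀ ε → 0ℚ ℚ.< ε → ∃ λ k → ∃ λ N → ∀ i → N ℕ.≤ i →
            norm (expSum i (approx z i) -ᵍ expSum k (approx z i)) ℚ.≤ ε
    close ε 0<ε =
      let A , N₁ , p = bounded {x} (cauchy (Re z))
          C , N₂ , q = bounded {y} (cauchy (Im z))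
          B , r = archimedean (fromℕ A ℚ.+ fromℕ C)
          k , t = ExpTail.tail B ε 0<ε
      in k , (N₁ ℕ.⊔ N₂) ℕ.⊔ k , λ i N≤i →
         let N≤ = ℕ.m⊔n≤o⇒m≤o (N₁ ℕ.⊔ N₂) k N≤i in
         t (approx z i)
           (ℚ.≤-trans (ℚ.+-mono-≤ (p i (ℕ.m⊔n≤o⇒m≤o N₁ N₂ N≤)) (q i (ℕ.m⊔n≤o⇒n≤o N₁ N₂ N≤))) r)
           i (ℕ.m⊔n≤o⇒n≤o (N₁ ℕ.⊔ N₂) k N≤i)

    re-cauchy : IsCauchy (λ i → proj₁ (expSum i (approx z i)))
    re-cauchy = cauchy-approx (λ i → proj₁ (expSum i (approx z i))) λ ε 0<ε → let k , N , p = close ε 0<ε in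
      (λ i → proj₁ (expSum k (approx z i))) , proj₁ (sum-cauchy k) , N , λ i N≤i →
      ℚ.≤-trans (fst≤ (expSum i (approx z i) -ᵍ expSum k (approx z i))) (p i N≤i)
      where
      fst≤ : ∀ w → ℚ.∣ proj₁ w ∣ ℚ.≤ norm w
      fst≤ (a , b) = subst (ℚ._≤ ℚ.∣ a ∣ ℚ.+ ℚ.∣ b ∣) (ℚ.+-identityʳ ℚ.∣ a ∣) (ℚ.+-monoʳ-≤ ℚ.∣ a ∣ (ℚ.0≤∣p∣ b))

    im-cauchy : IsCauchy (λ i → proj₂ (expSum i (approx z i)))
    im-cauchy = cauchy-approx (λ i → proj₂ (expSum i (approx z i))) λ ε 0<ε → let k , N , p = close ε 0<ε in
      (λ i → proj₂ (expSum k (approx z i))) , proj₂ (sum-cauchy k) , N , λ i N≤i →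
      ℚ.≤-trans (snd≤ (expSum i (approx z i) -ᵍ expSum k (approx z i))) (p i N≤i)
      where
      snd≤ : ∀ w → ℚ.∣ proj₂ w ∣ ℚ.≤ norm w
      snd≤ (a , b) = subst (ℚ._≤ ℚ.∣ a ∣ ℚ.+ ℚ.∣ b ∣) (ℚ.+-identityˡ ℚ.∣ b ∣) (ℚ.+-monoˡ-≤ ℚ.∣ b ∣ (ℚ.0≤∣p∣ a))

open ExpConvergence

-- exp z = Σₖ zᵏ / k!, along the diagonal: the i-th approximation is the i-th partial sum
-- evaluated at the i-th approximation of z.
exp : ℂ → ℂ
exp z = record { seq = λ i → proj₁ (expSum i (approx z i)) ; cauchy = ExpCauchy.re-cauchy z }
     +𝕚 record { seq = λ i → proj₂ (expSum i (approx z i)) ; cauchy = ExpCauchy.im-cauchy z }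

harmonic : ℕ → ℚ
harmonic zero    = 0ℚ
harmonic (suc k) = harmonic k ℚ.+ + 1 ℚ./ suc k

module LogConvergence where

  module LogCauchy (q : ℕ) where
    open ℚ-Solver using (solve; _:=_; _:+_; _:*_; :-_; con)

    p = suc q

    block-lower : ∀ a j k → a ℕ.+ j ℕ.≤ suc k → fromℕ j ℚ.* recip k ℚ.≤ harmonic (a ℕ.+ j) ℚ.- harmonic a
    block-lower a zero    k _ rewrite ℕ.+-identityʳ a =
      ℚ.≤-reflexive (trans (ℚ.*-zeroˡ (recip k)) (sym (ℚ.+-inverseʳ (harmonic a))))
    block-lower a (suc j) k h rewrite ℕ.+-suc a j = begin
      fromℕ (suc j) ℚ.* recip k                    ≡⟨ cong (ℚ._* recip k) (fromℕ-suc j) ⟩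
      (1ℚ ℚ.+ fromℕ j) ℚ.* recip k                 ≡⟨ solve 2 (λ n r → (con 1ℚ :+ n) :* r := n :* r :+ r) refl (fromℕ j) (recip k) ⟩
      fromℕ j ℚ.* recip k ℚ.+ recip k              ≤⟨ ℚ.+-mono-≤ (block-lower a j k (ℕ.≤-trans (ℕ.n≤1+n _) h)) (recip-antimono (ℕ.≤-pred h)) ⟩
      (harmonic (a ℕ.+ j) ℚ.- harmonic a) ℚ.+ recip (a ℕ.+ j)
                                                   ≡⟨ solve 3 (λ x y z → (x :+ :- y) :+ z := (x :+ z) :+ :- y) refl (harmonic (a ℕ.+ j)) (harmonic a) (recip (a ℕ.+ j)) ⟩
      (harmonic (a ℕ.+ j) ℚ.+ recip (a ℕ.+ j)) ℚ.- harmonic a ∎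

    block-upper : ∀ a j → harmonic (a ℕ.+ j) ℚ.- harmonic a ℚ.≤ fromℕ j ℚ.* recip a
    block-upper a zero    rewrite ℕ.+-identityʳ a =
      ℚ.≤-reflexive (trans (ℚ.+-inverseʳ (harmonic a)) (sym (ℚ.*-zeroˡ (recip a))))
    block-upper a (suc j) rewrite ℕ.+-suc a j = begin
      (harmonic (a ℕ.+ j) ℚ.+ recip (a ℕ.+ j)) ℚ.- harmonic a
                                                   ≡⟨ solve 3 (λ x y z → (x :+ z) :+ :- y := (x :+ :- y) :+ z) refl (harmonic (a ℕ.+ j)) (harmonic a) (recip (a ℕ.+ j)) ⟩
      (harmonic (a ℕ.+ j) ℚ.- harmonic a) ℚ.+ recip (a ℕ.+ j)
                                                   ≤⟨ ℚ.+-mono-≤ (block-upper a j) (recip-antimono (ℕ.m≤m+n a j)) ⟩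
      fromℕ j ℚ.* recip a ℚ.+ recip a              ≡⟨ solve 2 (λ n r → n :* r :+ r := (con 1ℚ :+ n) :* r) refl (fromℕ j) (recip a) ⟩
      (1ℚ ℚ.+ fromℕ j) ℚ.* recip a                 ≡⟨ cong (ℚ._* recip a) (sym (fromℕ-suc j)) ⟩
      fromℕ (suc j) ℚ.* recip a ∎

    s : ℕ → ℚ
    s N = harmonic (p ℕ.* N) ℚ.- harmonic N

    index : ∀ N → p ℕ.* suc N ≡ suc (p ℕ.* N ℕ.+ q)
    index N = trans (ℕ.*-suc p N) (trans (ℕ.+-comm p (p ℕ.* N)) (ℕ.+-suc (p ℕ.* N) q))

    diff : ∀ N → s (suc N) ℚ.- s N ≡ (harmonic (p ℕ.* N ℕ.+ p) ℚ.- harmonic (p ℕ.* N)) ℚ.- recip N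
    diff N = trans (cong (λ u → (harmonic u ℚ.- harmonic (suc N)) ℚ.- s N)
                     (trans (ℕ.*-suc p N) (ℕ.+-comm p (p ℕ.* N))))
      (solve 4 (λ a b c d → (a :+ :- (c :+ d)) :+ :- (b :+ :- c) := (a :+ :- b) :+ :- d) refl
        (harmonic (p ℕ.* N ℕ.+ p)) (harmonic (p ℕ.* N)) (harmonic N) (recip N))

    step-lower : ∀ N → s N ℚ.≤ s (suc N)
    step-lower N = 0≤q-p⇒p≤q (subst (0ℚ ℚ.≤_) (sym (diff N)) (p≤q⇒0≤q-p (subst (ℚ._≤ harmonic (p ℕ.* N ℕ.+ p) ℚ.- harmonic (p ℕ.* N))
      (fromℕ-*-recip p (p ℕ.* N ℕ.+ q) N (index N))
      (block-lower (p ℕ.* N) p (p ℕ.* N ℕ.+ q) (ℕ.≤-reflexive (ℕ.+-suc (p ℕ.* N) q))))))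

    step-upper : ∀ N → s (2 ℕ.+ N) ℚ.- s (suc N) ℚ.≤ recip N ℚ.- recip (suc N)
    step-upper N = begin
      s (2 ℕ.+ N) ℚ.- s (suc N)
        ≡⟨ diff (suc N) ⟩
      (harmonic (p ℕ.* suc N ℕ.+ p) ℚ.- harmonic (p ℕ.* suc N)) ℚ.- recip (suc N)
        ≤⟨ ℚ.+-monoˡ-≤ (ℚ.- recip (suc N)) (block-upper (p ℕ.* suc N) p) ⟩
      fromℕ p ℚ.* recip (p ℕ.* suc N) ℚ.- recip (suc N)
        ≤⟨ ℚ.+-monoˡ-≤ (ℚ.- recip (suc N)) (*-mono (fromℕ-nonNeg p) (recip-antimono
             (ℕ.≤-trans (ℕ.n≤1+n _) (ℕ.≤-reflexive (sym (index N)))))) ⟩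
      fromℕ p ℚ.* recip (p ℕ.* N ℕ.+ q) ℚ.- recip (suc N)
        ≡⟨ cong (ℚ._- recip (suc N)) (fromℕ-*-recip p (p ℕ.* N ℕ.+ q) N (index N)) ⟩
      recip N ℚ.- recip (suc N) ∎

    mono : ∀ N j → s N ℚ.≤ s (N ℕ.+ j)
    mono N zero    rewrite ℕ.+-identityʳ N = ℚ.≤-refl
    mono N (suc j) rewrite ℕ.+-suc N j = ℚ.≤-trans (mono N j) (step-lower (N ℕ.+ j))

    telescope : ∀ N j → s (suc N ℕ.+ j) ℚ.- s (suc N) ℚ.≤ recip N ℚ.- recip (N ℕ.+ j)
    telescope N zero    rewrite ℕ.+-identityʳ N =
      ℚ.≤-reflexive (trans (ℚ.+-inverseʳ (s (suc N))) (sym (ℚ.+-inverseʳ (recip N))))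
    telescope N (suc j) rewrite ℕ.+-suc N j = begin
      s (2 ℕ.+ (N ℕ.+ j)) ℚ.- s (suc N)
        ≡⟨ chain (s (2 ℕ.+ (N ℕ.+ j))) (s (suc (N ℕ.+ j))) (s (suc N)) ⟩
      (s (suc (N ℕ.+ j)) ℚ.- s (suc N)) ℚ.+ (s (2 ℕ.+ (N ℕ.+ j)) ℚ.- s (suc (N ℕ.+ j)))
        ≤⟨ ℚ.+-mono-≤ (telescope N j) (step-upper (N ℕ.+ j)) ⟩
      (recip N ℚ.- recip (N ℕ.+ j)) ℚ.+ (recip (N ℕ.+ j) ℚ.- recip (suc (N ℕ.+ j)))
        ≡⟨ solve 3 (λ a b c → (a :+ :- b) :+ (b :+ :- c) := a :+ :- c) refl (recip N) (recip (N ℕ.+ j)) (recip (suc (N ℕ.+ j))) ⟩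
      recip N ℚ.- recip (suc (N ℕ.+ j)) ∎
      where
      chain : ∀ a b c → a ℚ.- c ≡ (b ℚ.- c) ℚ.+ (a ℚ.- b)
      chain = solve 3 (λ a b c → a :+ :- c := (b :+ :- c) :+ (a :+ :- b)) refl

    log-cauchy : IsCauchy s
    log-cauchy = cauchy-from s λ ε 0<ε → let N , h = small 1ℚ ε 0<ε in suc N , λ j → begin
      ℚ.∣ s (suc N ℕ.+ j) ℚ.- s (suc N) ∣   ≡⟨ ℚ.0≤p⇒∣p∣≡p (p≤q⇒0≤q-p (mono (suc N) j)) ⟩
      s (suc N ℕ.+ j) ℚ.- s (suc N)         ≤⟨ telescope N j ⟩
      recip N ℚ.- recip (N ℕ.+ j)           ≤⟨ ℚ.+-monoʳ-≤ (recip N) (ℚ.neg-antimono-≤ (recip-nonNeg (N ℕ.+ j))) ⟩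
      recip N ℚ.+ 0ℚ                        ≡⟨ trans (ℚ.+-identityʳ (recip N)) (sym (ℚ.*-identityˡ (recip N))) ⟩
      1ℚ ℚ.* recip N                        ≤⟨ h ⟩
      ε ∎

open LogConvergence

-- log p = ∫₁ᵖ dt/t, as the limit of the Riemann sums with mesh 1/N, namely Σ 1/k over N < k ≤ pN.
log : (p : ℕ) .{{_ : ℕ.NonZero p}} → ℝ
log p@(suc q) = record
  { seq    = λ N → harmonic (p ℕ.* N) ℚ.- harmonic N
  ; cauchy = LogCauchy.log-cauchy q
  }

infixr 8 _^ᶜ_

_^ᶜ_ : (p : ℕ) .{{_ : ℕ.NonZero p}} → ℂ → ℂ
p ^ᶜ w = exp (w *ᶜ (log p +𝕚 fromℚ 0ℚ))

partialSum : (ℕ → ℂ) → ℕ → ℂ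
partialSum a zero    = ℕ→ℂ 0
partialSum a (suc k) = partialSum a k +ᶜ a k

-- ∣ Sₖ - L ∣ ≤ ε is expressed by squares, which avoids the square root in the modulus.
SumsTo : (ℕ → ℂ) → ℂ → Set
SumsTo a L = ∀ ε → 0ℚ ℚ.< ε → ∃ λ N → ∀ k → N ℕ.≤ k → ∣ partialSum a k -ᶜ L ∣² ≤ᴿ fromℚ (ε ℚ.* ε)

Converges Diverges : (ℕ → ℂ) → Set
Converges a = ∃ (SumsTo a)
Diverges  a = ¬ Converges a

-- the terms f_n(pᵉ) p^{-es}, e ≥ 0, of the local factor at p
localFactor : (n : ℕ) {p : ℕ} → Prime p → ℂ → ℕ → ℂ
localFactor n {p} p-prime s e = ℕ→ℂ (f n (p ℕ.^ e)) *ᶜ p ^ᶜ (-ᶜ (ℕ→ℂ e *ᶜ s))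
  where instance p≢0 = prime⇒nonZero p-prime

c₇-quotient : (n : ℕ) .{{_ : ℕ.NonTrivial n}} → ℕ → ℚ
c₇-quotient n@(suc (suc _)) d = + (d ℕ.* (n ℕ.∸ 1 ℕ.∸ d)) ℚ./ (n ℕ.∸ 1 ℕ.+ d)

-- `max` takes a default element, for which d = 0 serves; `upTo n` runs over 0 ≤ d ≤ n - 1.
c₇ : (n : ℕ) .{{_ : ℕ.NonTrivial n}} → ℚ
c₇ n = max (c₇-quotient n 0) (List.map (c₇-quotient n) (List.upTo n))

{-# OPTIONS --safe #-}

-- Put N = n - 1 = a + d, q = pᵏ and D = N + d. The subrings of ℤⁿ consisting of the (z , y , x₀) with
-- yⱼ ≡ x₀ mod q and zᵢ ≡ x₀ + Σⱼ Aᵢⱼ (yⱼ - x₀) mod q², for d × a matrices A over ℤ/q, are pairwise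
-- distinct and have index q^(a + 2 d) = p^(k D). So f n (p^(k D)) ≥ p^(k d a), and when
-- Re s ≤ d a / D the terms of the series at e = k D have modulus at least 1: they do not tend to 0.
--
-- The modulus of an exponential is controlled by exp z · exp w = exp (z + w), which gives
-- ∣ exp z ∣² = exp (2 Re z), and by exp (log p) ≤ p. Both are used for partial sums evaluated at
-- rational approximations, which costs a constant factor: the squared moduli are bounded below by 1 / 4p.
module Submission where

open import Algebra.Bundles using (CommutativeRing)
open import Data.Fin.Base as Fin using (Fin; toℕ; remQuot; fromℕ<)
import Data.Fin.Properties as Fin
open import Data.Integer.Base as ℤ using (ℤ; +_; 0ℤ; 1ℤ)
open import Data.Integer.DivMod using (_%ℕ_; _/ℕ_; n%ℕd<d; a≡a%ℕn+[a/ℕn]*n)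
open import Data.Integer.Divisibility.Signed as ℤ∣ using (divides) renaming (_∣_ to _∣ᶻ_)
import Data.Integer.Properties as ℤ
open import Data.Integer.Solver using () renaming (module +-*-Solver to ℤ-Solver)
open import Data.List.Base as List using (_∷_)
import Data.List.Membership.Propositional as List
open import Data.List.Membership.Propositional.Properties using (∈-map⁻; ∈-upTo⁻)
open import Data.List.Relation.Unary.Any using (here; there)
open import Data.Nat.Base as ℕ using (ℕ; zero; suc; NonTrivial)
import Data.Nat.Divisibility as ℕ∣
open import Data.Nat.Primality using (Prime; ¬prime[0]; prime⇒nonZero)
import Data.Nat.Properties as ℕ
open import Data.Nat.Solver using () renaming (module +-*-Solver to ℕ-Solver)
open import Data.Product.Base using (∃; _×_; _,_; proj₁; proj₂)
open import Data.Rational.Base as ℚ using (ℚ; 0ℚ; 1ℚ; ½)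
import Data.Rational.Properties as ℚ
open import Data.Rational.Solver using () renaming (module +-*-Solver to ℚ-Solver)
import Data.Rational.Unnormalised.Base as ℚᵘ
import Data.Rational.Unnormalised.Properties as ℚᵘ
open import Data.Sum.Base using (inj₁; inj₂; [_,_]′)
open import Data.Unit.Base using (⊤)
open import Data.Vec.Base as Vec using (Vec; []; _∷_; drop)
open import Data.Vec.Properties using (zipWith-identityˡ; drop-zipWith; ∷-injective)
open import Defs
open import Function.Base using (id; _∘_)
open import Function.Bundles using (Bijection)
open import Level using (0ℓ)
open import Relation.Binary.Bundles using (Setoid; DecTotalOrder)
open import Relation.Binary.PropositionalEquality as ≡ using (_≡_; module ≡-Reasoning)
open import Relation.Nullary using (contradiction)
open import Relation.Unary using (Pred; _∈_; _⊆_)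
open import Data.List.Extrema (DecTotalOrder.totalOrder ℚ.≤-decTotalOrder) using (max; argmax-sel)

-- The Cauchy product

-- Closure under multiplication rests on a square-zero effect: if q divides every yⱼ - x₀, products
-- of two such differences vanish mod q², so x₀ + Σⱼ Aⱼ (yⱼ - x₀) is a ring homomorphism to ℤ/q² for
-- every row A. A row adds one coordinate and multiplies the index by q², and there are q^a rows to
-- choose from; hence the ratio d a / (a + 2 d).
--
-- On the analytic side the obstacle is that `exp` is a diagonal: its i-th approximation is the i-th
-- partial sum at the i-th approximation of the argument. Identities between exponentials are
-- therefore replaced by estimates for m-term sums that are uniform over bounded sets of arguments.
-- At a negative real argument the terms alternate in sign and give no evident lower bound, so ∣ exp
-- z ∣² is bounded below through its product with exp b, where b + 2 Re z ≥ 0 and exp b has a known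
-- upper bound.
--
-- In the boundary case Re s = c there is no room: the hypothesis only makes the approximations of
-- Re s eventually at most c + r. The factor p in 4p pays for this: r is chosen with 2 e r ≤ 1 and
-- costs one power of p.

module CauchyProduct (R : CommutativeRing 0ℓ 0ℓ) where

  open CommutativeRing R hiding (zero)
  open import Algebra.Properties.Semiring.Mult semiring
    using (×-homo-1; ×-comm-*) renaming (_×_ to _×#_)
  open import Algebra.Properties.CommutativeMonoid.Mult +-commutativeMonoid using (×-distrib-+)
  open import Algebra.Solver.Ring.NaturalCoefficients.Default commutativeSemiring
    using (solve; _:=_; _:+_; _:*_)
  open import Relation.Binary.Reasoning.Setoid setoid

  Sequence : Set
  Sequence = ℕ → Carrier

  -- Coefficients of a product of power series. Shifting the left factor avoids the index k - i.
  conv : Sequence → Sequence → Sequence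
  conv a b zero    = a 0 * b 0
  conv a b (suc k) = a 0 * b (suc k) + conv (a ∘ suc) b k

  -- Coefficients of the formal derivative.
  ∂ : Sequence → Sequence
  ∂ a k = suc k ×# a (suc k)

  conv-cong : ∀ {a a′ b b′} → (∀ i → a i ≈ a′ i) → (∀ i → b i ≈ b′ i) → ∀ k → conv a b k ≈ conv a′ b′ k
  conv-cong p q zero    = *-cong (p 0) (q 0)
  conv-cong p q (suc k) = +-cong (*-cong (p 0) (q (suc k))) (conv-cong (p ∘ suc) q k)

  conv-+ˡ : ∀ a a′ b k → conv (λ i → a i + a′ i) b k ≈ conv a b k + conv a′ b k
  conv-+ˡ a a′ b zero    = distribʳ (b 0) (a 0) (a′ 0)
  conv-+ˡ a a′ b (suc k) = trans (+-congˡ (conv-+ˡ (a ∘ suc) (a′ ∘ suc) b k))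
    (solve 5 (λ x x′ y c d → (x :+ x′) :* y :+ (c :+ d) := (x :* y :+ c) :+ (x′ :* y :+ d)) refl
      (a 0) (a′ 0) (b (suc k)) (conv (a ∘ suc) b k) (conv (a′ ∘ suc) b k))

  conv-*ˡ : ∀ z a b k → conv (λ i → z * a i) b k ≈ z * conv a b k
  conv-*ˡ z a b zero    = *-assoc z (a 0) (b 0)
  conv-*ˡ z a b (suc k) = trans (+-congˡ (conv-*ˡ z (a ∘ suc) b k))
    (solve 4 (λ z x y c → (z :* x) :* y :+ z :* c := z :* (x :* y :+ c)) refl
      z (a 0) (b (suc k)) (conv (a ∘ suc) b k))

  conv-*ʳ : ∀ w a b k → conv a (λ i → w * b i) k ≈ w * conv a b k
  conv-*ʳ w a b zero    = solve 3 (λ x w y → x :* (w :* y) := w :* (x :* y)) refl (a 0) w (b 0)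
  conv-*ʳ w a b (suc k) = trans (+-congˡ (conv-*ʳ w (a ∘ suc) b k))
    (solve 4 (λ x w y c → x :* (w :* y) :+ w :* c := w :* (x :* y :+ c)) refl
      (a 0) w (b (suc k)) (conv (a ∘ suc) b k))

  leibniz : ∀ a b k → ∂ (conv a b) k ≈ conv (∂ a) b k + conv a (∂ b) k
  leibniz a b zero = begin
    1 ×# (a 0 * b 1 + a 1 * b 0)          ≈⟨ ×-homo-1 _ ⟩
    a 0 * b 1 + a 1 * b 0                 ≈⟨ +-comm _ _ ⟩
    a 1 * b 0 + a 0 * b 1                 ≈⟨ +-cong (*-congʳ (×-homo-1 _)) (*-congˡ (×-homo-1 _)) ⟨
    (1 ×# a 1) * b 0 + a 0 * (1 ×# b 1)   ∎
  leibniz a b (suc j) = begin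
    (2 ℕ.+ j) ×# (a 0 * b (2 ℕ.+ j) + C)
      ≈⟨ ×-distrib-+ _ _ (2 ℕ.+ j) ⟩
    (2 ℕ.+ j) ×# (a 0 * b (2 ℕ.+ j)) + (C + suc j ×# C)
      ≈⟨ +-cong (sym (×-comm-* (2 ℕ.+ j) (a 0) (b (2 ℕ.+ j)))) (+-congˡ (leibniz (a ∘ suc) b j)) ⟩
    a 0 * ∂ b (suc j) + ((a 1 * b (suc j) + E) + (F + G))
      ≈⟨ solve 5 (λ x y e f g → x :+ ((y :+ e) :+ (f :+ g)) := (y :+ (e :+ f)) :+ (x :+ g)) refl
           (a 0 * ∂ b (suc j)) (a 1 * b (suc j)) E F G ⟩
    (a 1 * b (suc j) + (E + F)) + (a 0 * ∂ b (suc j) + G)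
      -- By definition `∂ a (suc i)` is `a (2 + i) + ∂ (a ∘ suc) i`: the single copy of C split off
      -- above makes up for the index shift between `∂ a ∘ suc` and `∂ (a ∘ suc)`.
      ≈⟨ +-congʳ (+-cong (*-congʳ (×-homo-1 (a 1))) (conv-+ˡ (a ∘ suc ∘ suc) (∂ (a ∘ suc)) b j)) ⟨
    (∂ a 0 * b (suc j) + conv (∂ a ∘ suc) b j) + (a 0 * ∂ b (suc j) + G) ∎
    where
    C = conv (a ∘ suc) b (suc j)
    E = conv (a ∘ suc ∘ suc) b j
    F = conv (∂ (a ∘ suc)) b j
    G = conv (a ∘ suc) (∂ b) j

  -- aₖ = zᵏ / k!, stated without division.
  record IsExp (z : Carrier) (a : Sequence) : Set where
    constructor isExp
    field
      initial : a 0 ≈ 1#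
      step    : ∀ k → ∂ a k ≈ z * a k

  -- The product rule: F′ = z F and G′ = w G give (F G)′ = (z + w) F G. Together with uniqueness of
  -- the solution this takes the place of the binomial theorem.
  conv-isExp : ∀ {a b z w} → IsExp z a → IsExp w b → IsExp (z + w) (conv a b)
  conv-isExp {a} {b} {z} {w} (isExp a₀ a₊) (isExp b₀ b₊) =
    isExp (trans (*-cong a₀ b₀) (*-identityˡ 1#)) λ k → begin
      ∂ (conv a b) k                                          ≈⟨ leibniz a b k ⟩
      conv (∂ a) b k + conv a (∂ b) k                         ≈⟨ +-cong (conv-cong a₊ (λ _ → refl) k) (conv-cong (λ _ → refl) b₊ k) ⟩
      conv (λ i → z * a i) b k + conv a (λ i → w * b i) k     ≈⟨ +-cong (conv-*ˡ z a b k) (conv-*ʳ w a b k) ⟩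
      z * conv a b k + w * conv a b k                         ≈⟨ distribʳ (conv a b k) z w ⟨
      (z + w) * conv a b k                                    ∎

  isExp-unique : (∀ k {x y} → suc k ×# x ≈ suc k ×# y → x ≈ y) →
                 ∀ {a b z} → IsExp z a → IsExp z b → ∀ k → a k ≈ b k
  isExp-unique cancel (isExp a₀ a₊) (isExp b₀ b₊) zero    = trans a₀ (sym b₀)
  isExp-unique cancel (isExp a₀ a₊) (isExp b₀ b₊) (suc k) = cancel k
    (trans (a₊ k) (trans (*-congˡ (isExp-unique cancel (isExp a₀ a₊) (isExp b₀ b₊) k)) (sym (b₊ k))))

  Sum : Sequence → Sequence
  Sum a zero    = 0#
  Sum a (suc m) = Sum a m + a m

  Sum-cong : ∀ {a b} → (∀ i → a i ≈ b i) → ∀ m → Sum a m ≈ Sum b m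
  Sum-cong p zero    = refl
  Sum-cong p (suc m) = +-cong (Sum-cong p m) (p m)

  Sum-head : ∀ a m → Sum a (suc m) ≈ a 0 + Sum (a ∘ suc) m
  Sum-head a zero    = +-comm 0# (a 0)
  Sum-head a (suc m) = trans (+-congʳ (Sum-head a m)) (+-assoc (a 0) _ _)

  -- The sum of aᵢ bⱼ over i + j < m, taken row by row; `Sum-conv` takes the same sum along
  -- antidiagonals.
  triangle : Sequence → Sequence → Sequence
  triangle a b zero    = 0#
  triangle a b (suc m) = a 0 * Sum b (suc m) + triangle (a ∘ suc) b m

  triangle-suc : ∀ a b m → triangle a b (suc m) ≈ triangle a b m + conv a b m
  triangle-suc a b zero    = trans (+-identityʳ _) (trans (*-congˡ (+-identityˡ (b 0))) (sym (+-identityˡ _)))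
  triangle-suc a b (suc m) = trans (+-congˡ (triangle-suc (a ∘ suc) b m))
    (solve 5 (λ x s y t c → x :* (s :+ y) :+ (t :+ c) := (x :* s :+ t) :+ (x :* y :+ c)) refl
      (a 0) (Sum b (suc m)) (b (suc m)) (triangle (a ∘ suc) b m) (conv (a ∘ suc) b m))

  Sum-conv : ∀ a b m → Sum (conv a b) m ≈ triangle a b m
  Sum-conv a b zero    = refl
  Sum-conv a b (suc m) = trans (+-congʳ (Sum-conv a b m)) (sym (triangle-suc a b m))

  -- The sum of the products aᵢ bⱼ over i < m, j < M outside the triangle i + j < m.
  corner : Sequence → Sequence → ℕ → Sequence
  corner a b M zero    = 0#
  corner a b M (suc m) = a 0 * (Sum b M - Sum b (suc m)) + corner (a ∘ suc) b M m

  -- The two lengths are kept apart because the induction strips one row off the m × M rectangle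
  -- while M stays fixed.
  Sum-*-Sum : ∀ a b M m → Sum a m * Sum b M ≈ triangle a b m + corner a b M m
  Sum-*-Sum a b M zero    = trans (zeroˡ (Sum b M)) (sym (+-identityˡ 0#))
  Sum-*-Sum a b M (suc m) = begin
    Sum a (suc m) * Sum b M
      ≈⟨ *-congʳ (Sum-head a m) ⟩
    (a 0 + Sum (a ∘ suc) m) * Sum b M
      ≈⟨ distribʳ (Sum b M) (a 0) _ ⟩
    a 0 * Sum b M + Sum (a ∘ suc) m * Sum b M
      ≈⟨ +-cong (*-congˡ split) (Sum-*-Sum (a ∘ suc) b M m) ⟩
    a 0 * (Sum b (suc m) + (Sum b M - Sum b (suc m))) + (triangle (a ∘ suc) b m + corner (a ∘ suc) b M m)
      ≈⟨ solve 5 (λ x s d t c → x :* (s :+ d) :+ (t :+ c) := (x :* s :+ t) :+ (x :* d :+ c)) refl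
           (a 0) (Sum b (suc m)) (Sum b M - Sum b (suc m)) (triangle (a ∘ suc) b m) (corner (a ∘ suc) b M m) ⟩
    triangle a b (suc m) + corner a b M (suc m) ∎
    where
    split : Sum b M ≈ Sum b (suc m) + (Sum b M - Sum b (suc m))
    split = sym (trans (+-comm _ _) (trans (+-assoc _ _ _) (trans (+-congˡ (-‿inverseˡ _)) (+-identityʳ _))))

open ≡ using (refl; sym; trans; cong; cong₂; subst; subst₂; isEquivalence)

-- Lower bound for the number of subrings

injection-≤-cardinality : ∀ {a ℓ k m} (S : Setoid a ℓ) → HasCardinality S m →
                          (g : Fin k → Setoid.Carrier S) →
                          (∀ {i j} → Setoid._≈_ S (g i) (g j) → i ≡ j) → k ℕ.≤ m
injection-≤-cardinality S b g g-inj = Fin.injective⇒≤ {f = h} λ {i} {j} eq → g-inj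
    (S.trans (S.sym (bh i)) (S.trans (B.cong eq) (bh j)))
  where
  module S = Setoid S
  module B = Bijection b
  h  = λ i → proj₁ (B.surjective (g i))
  bh = λ i → proj₂ (B.surjective (g i)) refl

module _ (M : ℕ) where

  infix 4 _≡ₘ_

  _≡ₘ_ : ℤ → ℤ → Set
  a ≡ₘ b = + M ∣ᶻ a ℤ.- b

  ∣-resp : ∀ {a b} → a ≡ b → + M ∣ᶻ a → + M ∣ᶻ b
  ∣-resp = subst (+ M ∣ᶻ_)

  ≡ₘ-refl : ∀ a → a ≡ₘ a
  ≡ₘ-refl a = divides 0ℤ (ℤ.+-inverseʳ a)

≡ₘ⇒≡ : ∀ {M} (r s : Fin M) → _≡ₘ_ M (+ toℕ r) (+ toℕ s) → r ≡ s
≡ₘ⇒≡ {M} r s M∣ = Fin.toℕ-injective (ℤ.+-injective (ℤ.i-j≡0⇒i≡j (+ toℕ r) (+ toℕ s)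
    (ℤ.∣i∣≡0⇒i≡0 (multiple≡0 _ <M (ℤ∣.∣⇒∣ᵤ M∣)))))
  where
  <M : ℤ.∣ + toℕ r ℤ.- + toℕ s ∣ ℕ.< M
  <M = subst (λ u → ℤ.∣ u ∣ ℕ.< M) (sym (ℤ.m-n≡m⊖n (toℕ r) (toℕ s)))
    (ℕ.≤-<-trans (ℤ.∣m⊝n∣≤m⊔n (toℕ r) (toℕ s)) (ℕ.⊔-lub (Fin.toℕ<n r) (Fin.toℕ<n s)))
  multiple≡0 : ∀ u → u ℕ.< M → M ℕ∣.∣ u → u ≡ 0
  multiple≡0 zero    _   _   = refl
  multiple≡0 (suc u) u<M M∣u = contradiction u<M (ℕ.≤⇒≯ (ℕ∣.∣⇒≤ M∣u))

-- A ring homomorphism φ : L → ℤ/M has the graph { z ∷ x ∣ x ∈ L, z ≡ φ x mod M }.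
module Graph {n m : ℕ} (A : Subring n m) (M : ℕ) .{{_ : ℕ.NonZero M}} (φ : Vec ℤ n → ℤ)
  (φ-+ : ∀ x y → φ (x ⊕ y) ≡ φ x ℤ.+ φ y)
  (φ-1 : φ 𝟙 ≡ 1ℤ)
  (φ-* : ∀ {x y} → x ∈ Subring.carrier A → y ∈ Subring.carrier A → _≡ₘ_ M (φ (x ⊗ y)) (φ x ℤ.* φ y))
  where

  open Subring A renaming (carrier to L)
  open ⊝-Properties
  open ℤ-Solver using (solve; _:+_; _:*_; :-_; _:=_)
  open import Algebra.Properties.AbelianGroup ℤ.+-0-abelianGroup
    using (identityʳ-unique; inverseʳ-unique)
  private module I = Bijection hasIndex

  φ-0 : φ 𝟘 ≡ 0ℤ
  φ-0 = identityʳ-unique (φ 𝟘) (φ 𝟘)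
    (trans (sym (φ-+ 𝟘 𝟘)) (cong φ (zipWith-identityˡ ℤ.+-identityˡ 𝟘)))

  φ-neg : ∀ x → φ (⊖ x) ≡ ℤ.- φ x
  φ-neg x = inverseʳ-unique (φ x) (φ (⊖ x))
    (trans (sym (φ-+ x (⊖ x))) (trans (cong φ (⊝-self x)) φ-0))

  carrier : Pred (Vec ℤ (suc n)) 0ℓ
  carrier (z ∷ x) = x ∈ L × _≡ₘ_ M z (φ x)

  isSubring′ : IsSubring carrier
  isSubring′ = record
    { 0-mem    = 0-mem , ∣-resp M (cong (λ u → 0ℤ ℤ.- u) (sym φ-0)) (≡ₘ-refl M 0ℤ)
    ; 1-mem    = 1-mem , ∣-resp M (cong (λ u → 1ℤ ℤ.- u) (sym φ-1)) (≡ₘ-refl M 1ℤ)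
    ; +-closed = λ { {z ∷ x} {w ∷ y} (x∈ , p) (y∈ , q) → +-closed x∈ y∈ , ∣-resp M
        (trans (solve 4 (λ z w a b → (z :+ :- a) :+ (w :+ :- b) := (z :+ w) :+ :- (a :+ b)) refl z w (φ x) (φ y))
               (cong (λ u → z ℤ.+ w ℤ.- u) (sym (φ-+ x y))))
        (ℤ∣.∣m∣n⇒∣m+n p q) }
    ; -‿closed = λ { {z ∷ x} (x∈ , p) → -‿closed x∈ , ∣-resp M
        (trans (solve 2 (λ z a → :- (z :+ :- a) := :- z :+ :- (:- a)) refl z (φ x))
               (cong (λ u → ℤ.- z ℤ.- u) (sym (φ-neg x))))
        (ℤ∣.∣m⇒∣-m p) }
    -- z w - φ (x ⊗ y) is (z - φ x) w + φ x (w - φ y) minus the defect of multiplicativity of φ, and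
    -- M divides all three.
    ; *-closed = λ { {z ∷ x} {w ∷ y} (x∈ , p) (y∈ , q) → *-closed x∈ y∈ , ∣-resp M
        (solve 5 (λ z w a b c → ((z :+ :- a) :* w :+ a :* (w :+ :- b)) :+ :- (c :+ :- (a :* b))
                                := z :* w :+ :- c) refl z w (φ x) (φ y) (φ (x ⊗ y)))
        (ℤ∣.∣m∣n⇒∣m+n (ℤ∣.∣m∣n⇒∣m+n (ℤ∣.∣m⇒∣m*n w p) (ℤ∣.∣n⇒∣m*n (φ x) q)) (ℤ∣.∣m⇒∣-m (φ-* x∈ y∈))) }
    }

  to : Fin (M ℕ.* m) → Vec ℤ (suc n)
  to k = let r , i = remQuot {M} m k in + toℕ r ∷ I.to i

  to-injective : ∀ {k l} → to k ⊝ to l ∈ carrier → k ≡ l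
  to-injective {k} {l} (x∈ , p) = trans (sym (Fin.combine-remQuot {M} m k))
      (trans (cong₂ Fin.combine r≡s i≡j) (Fin.combine-remQuot {M} m l))
    where
    r = proj₁ (remQuot {M} m k)
    s = proj₁ (remQuot {M} m l)
    i≡j : proj₂ (remQuot {M} m k) ≡ proj₂ (remQuot {M} m l)
    i≡j = I.injective x∈
    φ≡0 : φ (I.to (proj₂ (remQuot {M} m k)) ⊝ I.to (proj₂ (remQuot {M} m l))) ≡ 0ℤ
    φ≡0 rewrite i≡j = trans (cong φ (⊝-self _)) φ-0
    r≡s : r ≡ s
    r≡s = ≡ₘ⇒≡ r s (∣-resp M
      (trans (cong (λ u → (+ toℕ r ℤ.- + toℕ s) ℤ.- u) φ≡0) (ℤ.+-identityʳ _)) p)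

  to-surjective : ∀ x → ∃ λ k → to k ⊝ x ∈ carrier
  to-surjective (z ∷ x) =
    Fin.combine r i , subst (λ (r , i) → (+ toℕ r ∷ I.to i) ⊝ (z ∷ x) ∈ carrier)
                        (sym (Fin.remQuot-combine r i)) (x∈ , divides (ℤ.- (a /ℕ M)) eq)
    where
    i  = proj₁ (I.surjective x)
    x∈ = proj₂ (I.surjective x) refl
    b  = φ (I.to i ⊝ x)
    -- Membership in the graph demands r - z ≡ φ (I.to i ⊝ x) mod M, which forces r to be the
    -- residue of this sum.
    a  = z ℤ.+ b
    r  = fromℕ< (n%ℕd<d a M)
    open ≡-Reasoning
    eq : (+ toℕ r ℤ.- z) ℤ.- b ≡ ℤ.- (a /ℕ M) ℤ.* + M
    eq = begin
      (+ toℕ r ℤ.- z) ℤ.- b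
        ≡⟨ cong (λ u → (+ u ℤ.- z) ℤ.- b) (Fin.toℕ-fromℕ< (n%ℕd<d a M)) ⟩
      (+ (a %ℕ M) ℤ.- z) ℤ.- b
        ≡⟨ solve 3 (λ r z b → (r :+ :- z) :+ :- b := r :+ :- (z :+ b)) refl (+ (a %ℕ M)) z b ⟩
      + (a %ℕ M) ℤ.- a
        ≡⟨ cong (λ u → + (a %ℕ M) ℤ.- u) (a≡a%ℕn+[a/ℕn]*n a M) ⟩
      + (a %ℕ M) ℤ.- (+ (a %ℕ M) ℤ.+ (a /ℕ M) ℤ.* + M)
        ≡⟨ solve 3 (λ r q M → r :+ :- (r :+ q :* M) := :- q :* M) refl (+ (a %ℕ M)) (a /ℕ M) (+ M) ⟩
      ℤ.- (a /ℕ M) ℤ.* + M ∎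

  graph : Subring (suc n) (M ℕ.* m)
  graph = record
    { carrier   = carrier
    ; isSubring = isSubring′
    ; hasIndex  = record
      { to        = to
      ; cong      = λ { {k} refl → Setoid.refl (quotient isSubring′) {to k} }
      ; bijective = to-injective
                  , λ x → proj₁ (to-surjective x) , λ { refl → proj₂ (to-surjective x) }
      }
    }

-- The subrings attached to matrices over ℤ/q

whole : Subring 1 1
whole = record
  { carrier   = λ _ → ⊤
  ; isSubring = record
    { 0-mem = _ ; 1-mem = _ ; +-closed = _ ; -‿closed = _ ; *-closed = _ }
  ; hasIndex  = record
    { to        = λ _ → 𝟘
    ; cong      = _
    ; bijective = (λ { {Fin.zero} {Fin.zero} _ → refl }) , λ _ → Fin.zero , _
    }
  }

-- The coordinate x₀. It stands last because every graph adds its new coordinate in front.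
base : ∀ {a} → Vec ℤ (suc a) → ℤ
base {zero}  (x ∷ []) = x
base {suc a} (_ ∷ x)  = base x

base-+ : ∀ {a} (x y : Vec ℤ (suc a)) → base (x ⊕ y) ≡ base x ℤ.+ base y
base-+ {zero}  (x ∷ []) (y ∷ []) = refl
base-+ {suc a} (_ ∷ x)  (_ ∷ y)  = base-+ x y

base-* : ∀ {a} (x y : Vec ℤ (suc a)) → base (x ⊗ y) ≡ base x ℤ.* base y
base-* {zero}  (x ∷ []) (y ∷ []) = refl
base-* {suc a} (_ ∷ x)  (_ ∷ y)  = base-* x y

base-0 : ∀ a → base {a} 𝟘 ≡ 0ℤ
base-0 zero    = refl
base-0 (suc a) = base-0 a

base-1 : ∀ a → base {a} 𝟙 ≡ 1ℤ
base-1 zero    = refl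
base-1 (suc a) = base-1 a

module Lattices (q : ℕ) .{{q≢0 : ℕ.NonZero q}} where

  open ℤ-Solver using (solve; _:+_; _:*_; :-_; _:=_; con)

  instance
    q*q≢0 : ℕ.NonZero (q ℕ.* q)
    q*q≢0 = ℕ.m*n≢0 q q

  -- This is ℤ 𝟙 + q ℤᵃ⁺¹, built as an iterated graph of x₀ mod q.
  diagonal : ∀ a → Subring (suc a) (q ℕ.^ a)
  diagonal zero    = whole
  diagonal (suc a) = Graph.graph (diagonal a) q base base-+ (base-1 a)
    λ {x} {y} _ _ → ∣-resp q (cong (λ u → u ℤ.- base x ℤ.* base y) (sym (base-* x y))) (≡ₘ-refl q (base x ℤ.* base y))

  Diagonal : ∀ a → Pred (Vec ℤ (suc a)) 0ℓ
  Diagonal a = Subring.carrier (diagonal a)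

  -- The form x₀ + Σⱼ αⱼ (yⱼ - x₀). It is additive on all of ℤᵃ⁺¹ and sends 𝟙 to 1 exactly; only
  -- multiplicativity needs a congruence.
  comb : ∀ {a} → Vec (Fin q) a → Vec ℤ (suc a) → ℤ
  comb []      x       = base x
  comb (α ∷ A) (y ∷ x) = + toℕ α ℤ.* (y ℤ.- base x) ℤ.+ comb A x

  comb-+ : ∀ {a} (A : Vec (Fin q) a) x y → comb A (x ⊕ y) ≡ comb A x ℤ.+ comb A y
  comb-+ []      x       y       = base-+ x y
  comb-+ (α ∷ A) (u ∷ x) (v ∷ y) = trans
    (cong₂ (λ b c → + toℕ α ℤ.* (u ℤ.+ v ℤ.- b) ℤ.+ c) (base-+ x y) (comb-+ A x y))
    (solve 7 (λ α u v b c s t → α :* ((u :+ v) :+ :- (b :+ c)) :+ (s :+ t)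
                := (α :* (u :+ :- b) :+ s) :+ (α :* (v :+ :- c) :+ t))
       refl (+ toℕ α) u v (base x) (base y) (comb A x) (comb A y))

  comb-0 : ∀ {a} (A : Vec (Fin q) a) → comb A 𝟘 ≡ 0ℤ
  comb-0         []      = refl
  comb-0 {suc a} (α ∷ A) = trans (cong₂ (λ b c → + toℕ α ℤ.* (0ℤ ℤ.- b) ℤ.+ c) (base-0 a) (comb-0 A))
    (trans (ℤ.+-identityʳ _) (ℤ.*-zeroʳ (+ toℕ α)))

  comb-1 : ∀ {a} (A : Vec (Fin q) a) → comb A 𝟙 ≡ 1ℤ
  comb-1         []      = refl
  comb-1 {suc a} (α ∷ A) = trans (cong₂ (λ b c → + toℕ α ℤ.* (1ℤ ℤ.- b) ℤ.+ c) (base-1 a) (comb-1 A))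
    (cong (ℤ._+ 1ℤ) (ℤ.*-zeroʳ (+ toℕ α)))

  comb≡base : ∀ {a} (A : Vec (Fin q) a) {x} → x ∈ Diagonal a → _≡ₘ_ q (comb A x) (base x)
  comb≡base []      {x}     _        = ≡ₘ-refl q (base x)
  comb≡base (α ∷ A) {y ∷ x} (x∈ , p) = ∣-resp q
    (sym (ℤ.+-assoc (+ toℕ α ℤ.* (y ℤ.- base x)) (comb A x) (ℤ.- base x)))
    (ℤ∣.∣m∣n⇒∣m+n (ℤ∣.∣n⇒∣m*n (+ toℕ α) p) (comb≡base A x∈))

  q∣×q∣⇒q²∣ : ∀ {i j} → + q ∣ᶻ i → + q ∣ᶻ j → + (q ℕ.* q) ∣ᶻ i ℤ.* j
  q∣×q∣⇒q²∣ (divides s refl) (divides t refl) = divides (s ℤ.* t) (trans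
    (solve 3 (λ s t q → (s :* q) :* (t :* q) := (s :* t) :* (q :* q)) refl s t (+ q))
    (cong ((s ℤ.* t) ℤ.*_) (sym (ℤ.pos-* q q))))

  -- Modulo products of two differences, y y′ - x₀ x₀′ is x₀ (y′ - x₀′) + x₀′ (y - x₀), so the
  -- correction to x₀ behaves like a derivation. On `Diagonal a` the neglected products are
  -- multiples of q², which is why the modulus is q².
  comb-* : ∀ {a} (A : Vec (Fin q) a) {x y} → x ∈ Diagonal a → y ∈ Diagonal a →
           _≡ₘ_ (q ℕ.* q) (comb A (x ⊗ y)) (comb A x ℤ.* comb A y)
  comb-* []      {x}     {y}     _        _        =
    ∣-resp (q ℕ.* q) (cong (λ u → u ℤ.- base x ℤ.* base y) (sym (base-* x y))) (≡ₘ-refl (q ℕ.* q) (base x ℤ.* base y))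
  comb-* (α ∷ A) {u ∷ x} {v ∷ y} (x∈ , p) (y∈ , r) = ∣-resp (q ℕ.* q)
    (trans
      (solve 8 (λ α u v b c s t w →
        ((((α :+ :- (α :* α)) :* ((u :+ :- b) :* (v :+ :- c)) :+ :- (α :* ((u :+ :- b) :* (t :+ :- c))))
           :+ :- (α :* ((v :+ :- c) :* (s :+ :- b)))) :+ (w :+ :- (s :* t)))
        := (α :* (u :* v :+ :- (b :* c)) :+ w) :+ :- ((α :* (u :+ :- b) :+ s) :* (α :* (v :+ :- c) :+ t)))
        refl α′ u v (base x) (base y) (comb A x) (comb A y) (comb A (x ⊗ y)))
      (cong (λ b → (α′ ℤ.* (u ℤ.* v ℤ.- b) ℤ.+ comb A (x ⊗ y)) ℤ.- comb (α ∷ A) (u ∷ x) ℤ.* comb (α ∷ A) (v ∷ y))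
        (sym (base-* x y))))
    -- Three terms containing a product of two multiples of q, then the induction hypothesis for the
    -- shorter row.
    (ℤ∣.∣m∣n⇒∣m+n (ℤ∣.∣m∣n⇒∣m+n (ℤ∣.∣m∣n⇒∣m+n
      (ℤ∣.∣n⇒∣m*n (α′ ℤ.- α′ ℤ.* α′) (q∣×q∣⇒q²∣ p r))
      (ℤ∣.∣m⇒∣-m (ℤ∣.∣n⇒∣m*n α′ (q∣×q∣⇒q²∣ p (comb≡base A y∈)))))
      (ℤ∣.∣m⇒∣-m (ℤ∣.∣n⇒∣m*n α′ (q∣×q∣⇒q²∣ r (comb≡base A x∈)))))
      (comb-* A x∈ y∈))
    where α′ = + toℕ α

  -- Two kinds of test vectors: `+ q ∷ 𝟘` gives q² ∣ q (α - β), so q ∣ α - β and the two residues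
  -- coincide; `base x ∷ x` annihilates the first coefficient and leaves the shorter rows.
  comb-injective : ∀ {a} (A B : Vec (Fin q) a) →
                   (∀ {x} → x ∈ Diagonal a → _≡ₘ_ (q ℕ.* q) (comb A x) (comb B x)) → A ≡ B
  comb-injective         []      []      _ = refl
  comb-injective {suc a} (α ∷ A) (β ∷ B) h = cong₂ _∷_
    (≡ₘ⇒≡ α β (ℤ∣.*-cancelˡ-∣ (+ q) {{q≢0}} (subst (_∣ᶻ + q ℤ.* (+ toℕ α ℤ.- + toℕ β)) (ℤ.pos-* q q)
      (∣-resp (q ℕ.* q) eq₁ (h {+ q ∷ 𝟘} (Subring.0-mem (diagonal a) , q∈))))))
    (comb-injective A B λ {x} x∈ → ∣-resp (q ℕ.* q)
      (solve 5 (λ α β b s t → (α :* (b :+ :- b) :+ s) :+ :- (β :* (b :+ :- b) :+ t) := s :+ :- t)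
        refl (+ toℕ α) (+ toℕ β) (base x) (comb A x) (comb B x))
      (h {base x ∷ x} (x∈ , ≡ₘ-refl q (base x))))
    where
    q∈ : _≡ₘ_ q (+ q) (base {a} 𝟘)
    q∈ = divides 1ℤ (trans (cong (λ u → + q ℤ.- u) (base-0 a))
      (trans (ℤ.+-identityʳ (+ q)) (sym (ℤ.*-identityˡ (+ q)))))
    eq₁ : comb (α ∷ A) (+ q ∷ 𝟘) ℤ.- comb (β ∷ B) (+ q ∷ 𝟘) ≡ + q ℤ.* (+ toℕ α ℤ.- + toℕ β)
    eq₁ rewrite base-0 a | comb-0 A | comb-0 B =
      solve 3 (λ α β q → (α :* (q :+ con 0ℤ) :+ con 0ℤ) :+ :- (β :* (q :+ con 0ℤ) :+ con 0ℤ) := q :* (α :+ :- β))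
        refl (+ toℕ α) (+ toℕ β) (+ q)

  index : ℕ → ℕ → ℕ
  index a zero    = q ℕ.^ a
  index a (suc d) = (q ℕ.* q) ℕ.* index a d

  drop-𝟙 : ∀ {a} d → drop d {a} 𝟙 ≡ 𝟙
  drop-𝟙 zero    = refl
  drop-𝟙 (suc d) = drop-𝟙 d

  module _ {a : ℕ} where

    -- With x = (z , y , x₀): y ≡ x₀ mod q and zᵢ ≡ x₀ + Σⱼ Aᵢⱼ (yⱼ - x₀) mod q².
    lattice   : ∀ {d} (As : Vec (Vec (Fin q) a) d) → Subring (d ℕ.+ suc a) (index a d)
    -- Mutual with `lattice`: `comb A` is multiplicative only on `Diagonal a`, so the next graph can
    -- be formed only once the trailing coordinates are known to lie there.
    lattice-↓ : ∀ {d} (As : Vec (Vec (Fin q) a) d) {x} →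
                x ∈ Subring.carrier (lattice As) → drop d x ∈ Diagonal a

    lattice         []       = diagonal a
    lattice {suc d} (A ∷ As) = Graph.graph (lattice As) (q ℕ.* q) (comb A ∘ drop d)
      (λ x y → trans (cong (comb A) (drop-zipWith ℤ._+_ x y)) (comb-+ A (drop d x) (drop d y)))
      (trans (cong (comb A) (drop-𝟙 d)) (comb-1 A))
      (λ {x} {y} x∈ y∈ → ∣-resp (q ℕ.* q)
        (cong (λ u → comb A u ℤ.- comb A (drop d x) ℤ.* comb A (drop d y)) (sym (drop-zipWith ℤ._*_ x y)))
        (comb-* A (lattice-↓ As x∈) (lattice-↓ As y∈)))

    lattice-↓ []               x∈       = x∈
    lattice-↓ (A ∷ As) {_ ∷ _} (x∈ , _) = lattice-↓ As x∈

    lift : ∀ {d} (As : Vec (Vec (Fin q) a) d) {y} → y ∈ Diagonal a →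
           ∃ λ x → x ∈ Subring.carrier (lattice As) × drop d x ≡ y
    lift         []       {y} y∈ = y , y∈ , refl
    lift {suc d} (A ∷ As)     y∈ = let x , x∈ , eq = lift As y∈ in
      comb A (drop d x) ∷ x , (x∈ , ≡ₘ-refl (q ℕ.* q) (comb A (drop d x))) , eq

    -- If one graph is contained in another, the two functions agree mod q² on the domain of the
    -- first; by `lift` this reaches every point of `Diagonal a`, where `comb-injective` applies.
    lattice-injective : ∀ {d} (As Bs : Vec (Vec (Fin q) a) d) →
                        Subring.carrier (lattice As) ⊆ Subring.carrier (lattice Bs) → As ≡ Bs
    lattice-injective         []       []       _ = refl
    lattice-injective {suc d} (A ∷ As) (B ∷ Bs) h = cong₂ _∷_
      (comb-injective A B λ y∈ → let x , x∈ , eq = lift As y∈ in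
        subst (λ y → _≡ₘ_ (q ℕ.* q) (comb A y) (comb B y)) eq (proj₂ (restrict x x∈)))
      (lattice-injective As Bs λ {x} x∈ → proj₁ (restrict x x∈))
      where
      restrict : ∀ x → x ∈ Subring.carrier (lattice As) →
                 comb A (drop d x) ∷ x ∈ Subring.carrier (lattice (B ∷ Bs))
      restrict x x∈ = h {comb A (drop d x) ∷ x} (x∈ , ≡ₘ-refl (q ℕ.* q) (comb A (drop d x)))

  index-^ : ∀ a d → index a d ≡ q ℕ.^ (a ℕ.+ d ℕ.+ d)
  index-^ a zero    = cong (q ℕ.^_) (sym (trans (ℕ.+-identityʳ _) (ℕ.+-identityʳ a)))
  index-^ a (suc d) = trans (ℕ.*-assoc q q (index a d)) (trans
    (cong (λ u → q ℕ.* (q ℕ.* u)) (index-^ a d))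
    (cong (q ℕ.^_) (solve′ 2 (λ a d → con′ 2 :+′ (a :+′ d :+′ d) :=′ a :+′ (con′ 1 :+′ d) :+′ (con′ 1 :+′ d)) refl a d)))
    where open ℕ-Solver renaming (solve to solve′; con to con′; _:+_ to _:+′_; _:=_ to _:=′_)

digits : ∀ {A : Set} {b} → (Fin b → A) → ∀ d → Fin (b ℕ.^ d) → Vec A d
digits         g zero    _ = []
digits {b = b} g (suc d) k = let i , l = remQuot {b} (b ℕ.^ d) k in g i ∷ digits g d l

digits-injective : ∀ {A : Set} {b} {g : Fin b → A} → (∀ {i j} → g i ≡ g j → i ≡ j) →
                   ∀ d {k l} → digits g d k ≡ digits g d l → k ≡ l
digits-injective         g-inj zero    {Fin.zero} {Fin.zero} _ = refl
digits-injective {b = b} g-inj (suc d) {k} {l} eq =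
  let eq₁ , eq₂ = ∷-injective eq in
  trans (sym (Fin.combine-remQuot {b} (b ℕ.^ d) k))
    (trans (cong₂ Fin.combine (g-inj eq₁) (digits-injective g-inj d eq₂)) (Fin.combine-remQuot {b} (b ℕ.^ d) l))

f-lower-bound : ∀ a d q .{{_ : ℕ.NonZero q}} → q ℕ.^ (d ℕ.* a) ℕ.≤ f (suc (a ℕ.+ d)) (q ℕ.^ (a ℕ.+ d ℕ.+ d))
f-lower-bound a d q =
  subst₂ ℕ._≤_ (trans (ℕ.^-*-assoc q a d) (cong (q ℕ.^_) (ℕ.*-comm a d)))
    (cong₂ f (trans (ℕ.+-comm d (suc a)) refl) (index-^ a d))
    (injection-≤-cardinality (subrings _ _) (proj₂ (subrings-finite (d ℕ.+ suc a) (index a d)))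
      (λ k → lattice (digits (digits id a) d k))
      (λ (h , _) → digits-injective (digits-injective id a) d (lattice-injective _ _ h)))
  where open Lattices q

-- The exponential series over ℚ and ℚ[i]

open ℚ-Lemmas
open ExpConvergence
open ℚ.≤-Reasoning
open ℚ-Solver using (solve; _:=_; _:+_; _:*_; :-_; con)

0≤1 : 0ℚ ℚ.≤ 1ℚ
0≤1 = ℚ.nonNegative⁻¹ 1ℚ

ℚ[i]-commutativeRing : CommutativeRing 0ℓ 0ℓ
ℚ[i]-commutativeRing = record
  { Carrier = ℚ[i] ; _≈_ = _≡_ ; _+_ = _+ᵍ_ ; _*_ = _*ᵍ_
  ; -_ = λ (a , b) → ℚ.- a , ℚ.- b ; 0# = 0ℚ , 0ℚ ; 1# = 1ℚ , 0ℚ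
  ; isCommutativeRing = record
    { isRing = record
      { +-isAbelianGroup = record
        { isGroup = record
          { isMonoid = record
            { isSemigroup = record
              { isMagma = record { isEquivalence = isEquivalence ; ∙-cong = cong₂ _+ᵍ_ }
              ; assoc   = λ (a , b) (c , d) (e , f) → cong₂ _,_ (ℚ.+-assoc a c e) (ℚ.+-assoc b d f)
              }
            ; identity = (λ (a , b) → cong₂ _,_ (ℚ.+-identityˡ a) (ℚ.+-identityˡ b))
                       , (λ (a , b) → cong₂ _,_ (ℚ.+-identityʳ a) (ℚ.+-identityʳ b))
            }
          ; inverse = (λ (a , b) → cong₂ _,_ (ℚ.+-inverseˡ a) (ℚ.+-inverseˡ b))
                    , (λ (a , b) → cong₂ _,_ (ℚ.+-inverseʳ a) (ℚ.+-inverseʳ b))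
          ; ⁻¹-cong = cong (λ (a , b) → ℚ.- a , ℚ.- b)
          }
        ; comm = λ (a , b) (c , d) → cong₂ _,_ (ℚ.+-comm a c) (ℚ.+-comm b d)
        }
      ; *-cong     = cong₂ _*ᵍ_
      ; *-assoc    = λ (a , b) (c , d) (e , f) → cong₂ _,_
          (solve 6 (λ a b c d e f → (a :* c :+ :- (b :* d)) :* e :+ :- ((a :* d :+ b :* c) :* f)
                      := a :* (c :* e :+ :- (d :* f)) :+ :- (b :* (c :* f :+ d :* e))) refl a b c d e f)
          (solve 6 (λ a b c d e f → (a :* c :+ :- (b :* d)) :* f :+ (a :* d :+ b :* c) :* e
                      := a :* (c :* f :+ d :* e) :+ b :* (c :* e :+ :- (d :* f))) refl a b c d e f)
      ; *-identity = 1-identityˡ , λ z → trans (*-comm z (1ℚ , 0ℚ)) (1-identityˡ z)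
      ; distrib    = distribˡ , λ z w v → trans (*-comm (w +ᵍ v) z) (trans (distribˡ z w v)
                                           (cong₂ _+ᵍ_ (*-comm z w) (*-comm z v)))
      }
    ; *-comm = *-comm
    }
  }
  where
  *-comm : ∀ z w → z *ᵍ w ≡ w *ᵍ z
  *-comm (a , b) (c , d) = cong₂ _,_
    (solve 4 (λ a b c d → a :* c :+ :- (b :* d) := c :* a :+ :- (d :* b)) refl a b c d)
    (solve 4 (λ a b c d → a :* d :+ b :* c := c :* b :+ d :* a) refl a b c d)
  1-identityˡ : ∀ z → (1ℚ , 0ℚ) *ᵍ z ≡ z
  1-identityˡ (a , b) = cong₂ _,_
    (solve 2 (λ a b → con 1ℚ :* a :+ :- (con 0ℚ :* b) := a) refl a b)
    (solve 2 (λ a b → con 1ℚ :* b :+ con 0ℚ :* a := b) refl a b)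
  distribˡ : ∀ z w v → z *ᵍ (w +ᵍ v) ≡ (z *ᵍ w) +ᵍ (z *ᵍ v)
  distribˡ (a , b) (c , d) (e , f) = cong₂ _,_
    (solve 6 (λ a b c d e f → a :* (c :+ e) :+ :- (b :* (d :+ f))
                := (a :* c :+ :- (b :* d)) :+ (a :* e :+ :- (b :* f))) refl a b c d e f)
    (solve 6 (λ a b c d e f → a :* (d :+ f) :+ b :* (c :+ e)
                := (a :* d :+ b :* c) :+ (a :* f :+ b :* e)) refl a b c d e f)

-- The series themselves live over ℚ[i]; their majorants, with nonnegative terms, live over ℚ in
-- `Q`.
module G where
  open CauchyProduct ℚ[i]-commutativeRing public
  open import Algebra.Properties.Semiring.Mult (CommutativeRing.semiring ℚ[i]-commutativeRing) public
    using () renaming (_×_ to _×#_)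

module Q where
  open CauchyProduct ℚ.+-*-commutativeRing public
  open import Algebra.Properties.Semiring.Mult (CommutativeRing.semiring ℚ.+-*-commutativeRing) public
    using () renaming (_×_ to _×#_)

×#≡fromℕ* : ∀ j x → j Q.×# x ≡ fromℕ j ℚ.* x
×#≡fromℕ* zero    x = sym (ℚ.*-zeroˡ x)
×#≡fromℕ* (suc j) x = trans (cong (x ℚ.+_) (×#≡fromℕ* j x)) (trans
  (solve 2 (λ x j → x :+ j :* x := (con 1ℚ :+ j) :* x) refl x (fromℕ j)) (cong (ℚ._* x) (sym (fromℕ-suc j))))

×#-pair : ∀ j a b → j G.×# (a , b) ≡ (j Q.×# a , j Q.×# b)
×#-pair zero    a b = refl
×#-pair (suc j) a b = cong ((a , b) +ᵍ_) (×#-pair j a b)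

suc-recip : ∀ k x → suc k Q.×# (recip k ℚ.* x) ≡ x
suc-recip k x = trans (×#≡fromℕ* (suc k) (recip k ℚ.* x)) (trans (sym (ℚ.*-assoc (fromℕ (suc k)) (recip k) x))
  (trans (cong (ℚ._* x) (fromℕ-*-recip (suc k) k 0 (ℕ.*-identityʳ (suc k)))) (ℚ.*-identityˡ x)))

recip-suc : ∀ k x → recip k ℚ.* (suc k Q.×# x) ≡ x
recip-suc k x = trans (cong (recip k ℚ.*_) (×#≡fromℕ* (suc k) x)) (trans (sym (ℚ.*-assoc (recip k) (fromℕ (suc k)) x))
  (trans (cong (ℚ._* x) (trans (ℚ.*-comm (recip k) (fromℕ (suc k))) (fromℕ-*-recip (suc k) k 0 (ℕ.*-identityʳ (suc k))))) (ℚ.*-identityˡ x)))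

Q-cancel : ∀ k {x y} → suc k Q.×# x ≡ suc k Q.×# y → x ≡ y
Q-cancel k {x} {y} eq = trans (sym (recip-suc k x)) (trans (cong (recip k ℚ.*_) eq) (recip-suc k y))

G-cancel : ∀ k {z w} → suc k G.×# z ≡ suc k G.×# w → z ≡ w
G-cancel k {a , b} {c , d} eq = cong₂ _,_ (Q-cancel k (cong proj₁ eq′)) (Q-cancel k (cong proj₂ eq′))
  where eq′ = trans (sym (×#-pair (suc k) a b)) (trans eq (×#-pair (suc k) c d))

terms : ℚ[i] → ℕ → ℚ[i]
terms z k = expTerm k z

terms-isExp : ∀ z → G.IsExp z (terms z)
terms-isExp z = G.isExp refl λ k → let a , b = z *ᵍ expTerm k z in
  trans (×#-pair (suc k) (recip k ℚ.* a) (recip k ℚ.* b)) (cong₂ _,_ (suc-recip k a) (suc-recip k b))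

expSum-Sum : ∀ m z → expSum m z ≡ G.Sum (terms z) m
expSum-Sum zero    z = refl
expSum-Sum (suc m) z = cong (_+ᵍ expTerm m z) (expSum-Sum m z)

realTerms : ℚ → ℕ → ℚ
realTerms x k = proj₁ (expTerm k (x , 0ℚ))

realTerms-suc : ∀ x k → realTerms x (suc k) ≡ recip k ℚ.* (x ℚ.* realTerms x k)
realTerms-suc x k = cong (recip k ℚ.*_)
  (solve 3 (λ x u v → x :* u :+ :- (con 0ℚ :* v) := x :* u) refl x (realTerms x k) (proj₂ (expTerm k (x , 0ℚ))))

realTerms-isExp : ∀ x → Q.IsExp x (realTerms x)
realTerms-isExp x = Q.isExp refl λ k → trans (cong (suc k Q.×#_) (realTerms-suc x k)) (suc-recip k _)

-- Only the m-term partial sum Σ xᵏ / k! over k < m.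
expᴿ : ℕ → ℚ → ℚ
expᴿ m x = Q.Sum (realTerms x) m

expSum-real : ∀ m x → proj₁ (expSum m (x , 0ℚ)) ≡ expᴿ m x
expSum-real zero    x = refl
expSum-real (suc m) x = cong (ℚ._+ realTerms x m) (expSum-real m x)

realTerms-nonNeg : ∀ {x} → 0ℚ ℚ.≤ x → ∀ k → 0ℚ ℚ.≤ realTerms x k
realTerms-nonNeg 0≤x zero    = 0≤1
realTerms-nonNeg {x} 0≤x (suc k) = subst (0ℚ ℚ.≤_) (sym (realTerms-suc x k))
  (*-nonNeg (recip-nonNeg k) (*-nonNeg 0≤x (realTerms-nonNeg 0≤x k)))

norm-terms : ∀ {z b} → norm z ℚ.≤ b → ∀ k → norm (terms z k) ℚ.≤ realTerms b k
norm-terms {z} {b} z≤b zero    = ℚ.≤-refl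
norm-terms {z} {b} z≤b (suc k) = begin
  norm (recip k ·ᵍ (z *ᵍ terms z k))       ≡⟨ norm-· (recip-nonNeg k) (z *ᵍ terms z k) ⟩
  recip k ℚ.* norm (z *ᵍ terms z k)        ≤⟨ *-mono (recip-nonNeg k) (norm-* z (terms z k)) ⟩
  recip k ℚ.* (norm z ℚ.* norm (terms z k))
    ≤⟨ *-mono (recip-nonNeg k) (*-mono₂ (norm-nonNeg (terms z k)) (ℚ.≤-trans (norm-nonNeg z) z≤b) z≤b (norm-terms {z} {b} z≤b k)) ⟩
  recip k ℚ.* (b ℚ.* realTerms b k)        ≡⟨ realTerms-suc b k ⟨
  realTerms b (suc k)                      ∎

-- Majorants for rectangles, triangles and corners of double sums

NonNeg : (ℕ → ℚ) → Set
NonNeg α = ∀ i → 0ℚ ℚ.≤ α i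

Sum-mono : ∀ {α} → NonNeg α → ∀ {m M} → m ℕ.≤ M → Q.Sum α m ℚ.≤ Q.Sum α M
Sum-mono {α} 0≤α {m} {M} m≤M = subst (λ M → Q.Sum α m ℚ.≤ Q.Sum α M) (ℕ.m+[n∸m]≡n m≤M) (go (M ℕ.∸ m))
  where
  go : ∀ j → Q.Sum α m ℚ.≤ Q.Sum α (m ℕ.+ j)
  go zero    = ℚ.≤-reflexive (cong (Q.Sum α) (sym (ℕ.+-identityʳ m)))
  go (suc j) rewrite ℕ.+-suc m j = subst (ℚ._≤ Q.Sum α (m ℕ.+ j) ℚ.+ α (m ℕ.+ j)) (ℚ.+-identityʳ _)
    (ℚ.+-mono-≤ (go j) (0≤α (m ℕ.+ j)))

Sum-nonNeg : ∀ {α} → NonNeg α → ∀ m → 0ℚ ℚ.≤ Q.Sum α m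
Sum-nonNeg 0≤α m = Sum-mono 0≤α {0} {m} ℕ.z≤n

triangle-nonNeg : ∀ {α β} → NonNeg α → NonNeg β → ∀ m → 0ℚ ℚ.≤ Q.triangle α β m
triangle-nonNeg 0≤α 0≤β zero    = ℚ.≤-refl
triangle-nonNeg 0≤α 0≤β (suc m) =
  +-nonNeg (*-nonNeg (0≤α 0) (Sum-nonNeg 0≤β (suc m))) (triangle-nonNeg (0≤α ∘ suc) 0≤β m)

corner-nonNeg : ∀ {α β} → NonNeg α → NonNeg β → ∀ {m M} → m ℕ.≤ M → 0ℚ ℚ.≤ Q.corner α β M m
corner-nonNeg 0≤α 0≤β {zero}  _   = ℚ.≤-refl
corner-nonNeg 0≤α 0≤β {suc m} m<M = +-nonNeg
  (*-nonNeg (0≤α 0) (p≤q⇒0≤q-p (Sum-mono 0≤β m<M)))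
  (corner-nonNeg (0≤α ∘ suc) 0≤β (ℕ.<⇒≤ m<M))

-- i < m and j < M imply i + j < m + M, and the additional terms are nonnegative.
box≤triangle : ∀ {α β} → NonNeg α → NonNeg β → ∀ m M →
               Q.Sum α m ℚ.* Q.Sum β M ℚ.≤ Q.triangle α β (m ℕ.+ M)
box≤triangle {α} {β} 0≤α 0≤β zero    M =
  subst (ℚ._≤ Q.triangle α β M) (sym (ℚ.*-zeroˡ (Q.Sum β M))) (triangle-nonNeg 0≤α 0≤β M)
box≤triangle {α} {β} 0≤α 0≤β (suc m) M = begin
  Q.Sum α (suc m) ℚ.* Q.Sum β M
    ≡⟨ cong (ℚ._* Q.Sum β M) (Q.Sum-head α m) ⟩
  (α 0 ℚ.+ Q.Sum (α ∘ suc) m) ℚ.* Q.Sum β M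
    ≡⟨ ℚ.*-distribʳ-+ (Q.Sum β M) (α 0) (Q.Sum (α ∘ suc) m) ⟩
  α 0 ℚ.* Q.Sum β M ℚ.+ Q.Sum (α ∘ suc) m ℚ.* Q.Sum β M
    ≤⟨ ℚ.+-mono-≤ (*-mono (0≤α 0) (Sum-mono 0≤β {M} {suc (m ℕ.+ M)} (ℕ.m≤n+m M (suc m))))
         (box≤triangle (0≤α ∘ suc) 0≤β m M) ⟩
  Q.triangle α β (suc m ℕ.+ M) ∎

norm-Sum-difference : ∀ {b β} → (∀ i → norm (b i) ℚ.≤ β i) → ∀ {m M} → m ℕ.≤ M →
                      norm (G.Sum b M -ᵍ G.Sum b m) ℚ.≤ Q.Sum β M ℚ.- Q.Sum β m
norm-Sum-difference {b} {β} b≤β {m} {M} m≤M =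
  subst (λ M → norm (G.Sum b M -ᵍ G.Sum b m) ℚ.≤ Q.Sum β M ℚ.- Q.Sum β m) (ℕ.m+[n∸m]≡n m≤M) (go (M ℕ.∸ m))
  where
  move : ∀ a b c → (a ℚ.+ b) ℚ.- c ≡ (a ℚ.- c) ℚ.+ b
  move = solve 3 (λ a b c → (a :+ b) :+ :- c := (a :+ :- c) :+ b) refl
  go : ∀ j → norm (G.Sum b (m ℕ.+ j) -ᵍ G.Sum b m) ℚ.≤ Q.Sum β (m ℕ.+ j) ℚ.- Q.Sum β m
  go zero    rewrite ℕ.+-identityʳ m = ℚ.≤-reflexive (trans
    (cong₂ (λ u v → ℚ.∣ u ∣ ℚ.+ ℚ.∣ v ∣) (ℚ.+-inverseʳ (proj₁ (G.Sum b m))) (ℚ.+-inverseʳ (proj₂ (G.Sum b m))))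
    (sym (ℚ.+-inverseʳ (Q.Sum β m))))
  go (suc j) rewrite ℕ.+-suc m j = begin
    norm ((G.Sum b (m ℕ.+ j) +ᵍ b (m ℕ.+ j)) -ᵍ G.Sum b m)
      ≡⟨ cong norm (cong₂ _,_ (move (proj₁ (G.Sum b (m ℕ.+ j))) _ _) (move (proj₂ (G.Sum b (m ℕ.+ j))) _ _)) ⟩
    norm ((G.Sum b (m ℕ.+ j) -ᵍ G.Sum b m) +ᵍ b (m ℕ.+ j))
      ≤⟨ norm-+ (G.Sum b (m ℕ.+ j) -ᵍ G.Sum b m) (b (m ℕ.+ j)) ⟩
    norm (G.Sum b (m ℕ.+ j) -ᵍ G.Sum b m) ℚ.+ norm (b (m ℕ.+ j))
      ≤⟨ ℚ.+-mono-≤ (go j) (b≤β (m ℕ.+ j)) ⟩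
    (Q.Sum β (m ℕ.+ j) ℚ.- Q.Sum β m) ℚ.+ β (m ℕ.+ j)
      ≡⟨ move (Q.Sum β (m ℕ.+ j)) (β (m ℕ.+ j)) (Q.Sum β m) ⟨
    (Q.Sum β (m ℕ.+ j) ℚ.+ β (m ℕ.+ j)) ℚ.- Q.Sum β m ∎

norm-corner : ∀ {a b α β} → (∀ i → norm (a i) ℚ.≤ α i) → (∀ i → norm (b i) ℚ.≤ β i) →
              ∀ {m M} → m ℕ.≤ M → norm (G.corner a b M m) ℚ.≤ Q.corner α β M m
norm-corner a≤α b≤β {zero}  _   = ℚ.≤-refl
norm-corner {a} {b} {α} {β} a≤α b≤β {suc m} {M} m<M = begin
  norm ((a 0 *ᵍ d) +ᵍ G.corner (a ∘ suc) b M m)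
    ≤⟨ norm-+ (a 0 *ᵍ d) (G.corner (a ∘ suc) b M m) ⟩
  norm (a 0 *ᵍ d) ℚ.+ norm (G.corner (a ∘ suc) b M m)
    ≤⟨ ℚ.+-mono-≤ (norm-* (a 0) d) (norm-corner (a≤α ∘ suc) b≤β (ℕ.<⇒≤ m<M)) ⟩
  norm (a 0) ℚ.* norm d ℚ.+ Q.corner (α ∘ suc) β M m
    ≤⟨ ℚ.+-monoˡ-≤ (Q.corner (α ∘ suc) β M m)
         (*-mono₂ (norm-nonNeg d) (ℚ.≤-trans (norm-nonNeg (a 0)) (a≤α 0)) (a≤α 0) (norm-Sum-difference b≤β m<M)) ⟩
  α 0 ℚ.* (Q.Sum β M ℚ.- Q.Sum β (suc m)) ℚ.+ Q.corner (α ∘ suc) β M m ∎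
  where d = G.Sum b M -ᵍ G.Sum b (suc m)

-- The approximate functional equation of the exponential

expSum-+ : ∀ m z w → expSum m z *ᵍ expSum m w ≡ expSum m (z +ᵍ w) +ᵍ G.corner (terms z) (terms w) m m
expSum-+ m z w rewrite expSum-Sum m z | expSum-Sum m w | expSum-Sum m (z +ᵍ w) = trans
  -- The triangle of the product, summed along antidiagonals, is exactly the m-term sum at z + w;
  -- the whole error is the corner.
  (G.Sum-*-Sum (terms z) (terms w) m m)
  (cong (_+ᵍ G.corner (terms z) (terms w) m m) (trans (sym (G.Sum-conv (terms z) (terms w) m))
    (G.Sum-cong (G.isExp-unique G-cancel (G.conv-isExp (terms-isExp z) (terms-isExp w)) (terms-isExp (z +ᵍ w))) m)))

expᴿ-triangle : ∀ m x y → Q.triangle (realTerms x) (realTerms y) m ≡ expᴿ m (x ℚ.+ y)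
expᴿ-triangle m x y = trans (sym (Q.Sum-conv (realTerms x) (realTerms y) m))
  (Q.Sum-cong (Q.isExp-unique Q-cancel (Q.conv-isExp (realTerms-isExp x) (realTerms-isExp y)) (realTerms-isExp (x ℚ.+ y))) m)

expᴿ-+ : ∀ m x y → expᴿ m x ℚ.* expᴿ m y ≡ expᴿ m (x ℚ.+ y) ℚ.+ Q.corner (realTerms x) (realTerms y) m m
expᴿ-+ m x y = trans (Q.Sum-*-Sum (realTerms x) (realTerms y) m m)
  (cong (ℚ._+ Q.corner (realTerms x) (realTerms y) m m) (expᴿ-triangle m x y))

expᴿ-submult : ∀ m {x y} → 0ℚ ℚ.≤ x → 0ℚ ℚ.≤ y → expᴿ m (x ℚ.+ y) ℚ.≤ expᴿ m x ℚ.* expᴿ m y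
expᴿ-submult m {x} {y} 0≤x 0≤y = begin
  expᴿ m (x ℚ.+ y)              ≡⟨ ℚ.+-identityʳ _ ⟨
  expᴿ m (x ℚ.+ y) ℚ.+ 0ℚ       ≤⟨ ℚ.+-monoʳ-≤ (expᴿ m (x ℚ.+ y)) (corner-nonNeg (realTerms-nonNeg 0≤x) (realTerms-nonNeg 0≤y) (ℕ.≤-refl {m})) ⟩
  expᴿ m (x ℚ.+ y) ℚ.+ Q.corner (realTerms x) (realTerms y) m m  ≡⟨ expᴿ-+ m x y ⟨
  expᴿ m x ℚ.* expᴿ m y ∎

-- The m × m square lies between the triangles of sizes m and 2 m, which are partial sums of the
-- series at 2 b. The corner is thus at most a block of that series.
corner≤tail : ∀ m {b} → 0ℚ ℚ.≤ b → Q.corner (realTerms b) (realTerms b) m m ℚ.≤ expᴿ (m ℕ.+ m) (b ℚ.+ b) ℚ.- expᴿ m (b ℚ.+ b)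
corner≤tail m {b} 0≤b = begin
  c                                          ≡⟨ solve 2 (λ c e → c := (e :+ c) :+ :- e) refl c e ⟩
  (e ℚ.+ c) ℚ.- e                            ≡⟨ cong (ℚ._- e) (expᴿ-+ m b b) ⟨
  expᴿ m b ℚ.* expᴿ m b ℚ.- e                ≤⟨ ℚ.+-monoˡ-≤ (ℚ.- e) (box≤triangle (realTerms-nonNeg 0≤b) (realTerms-nonNeg 0≤b) m m) ⟩
  Q.triangle (realTerms b) (realTerms b) (m ℕ.+ m) ℚ.- e  ≡⟨ cong (ℚ._- e) (expᴿ-triangle (m ℕ.+ m) b b) ⟩
  expᴿ (m ℕ.+ m) (b ℚ.+ b) ℚ.- e ∎
  where
  c = Q.corner (realTerms b) (realTerms b) m m
  e = expᴿ m (b ℚ.+ b)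

norm-real : ∀ {x} → 0ℚ ℚ.≤ x → norm (x , 0ℚ) ≡ x
norm-real {x} 0≤x = trans (ℚ.+-identityʳ ℚ.∣ x ∣) (ℚ.0≤p⇒∣p∣≡p 0≤x)

∣re∣≤norm : ∀ z → ℚ.∣ proj₁ z ∣ ℚ.≤ norm z
∣re∣≤norm (a , b) = subst (ℚ._≤ ℚ.∣ a ∣ ℚ.+ ℚ.∣ b ∣) (ℚ.+-identityʳ ℚ.∣ a ∣) (ℚ.+-monoʳ-≤ ℚ.∣ a ∣ (ℚ.0≤∣p∣ b))

∣p∣≤r⇒p≤r : ∀ {p r} → ℚ.∣ p ∣ ℚ.≤ r → p ℚ.≤ r
∣p∣≤r⇒p≤r {p} {r} h with ℚ.≤-total 0ℚ p
... | inj₁ 0≤p = subst (ℚ._≤ r) (ℚ.0≤p⇒∣p∣≡p 0≤p) h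
... | inj₂ p≤0 = ℚ.≤-trans p≤0 (ℚ.≤-trans (ℚ.0≤∣p∣ p) h)

∣p-q∣≤r⇒p≤q+r : ∀ {p q r} → ℚ.∣ p ℚ.- q ∣ ℚ.≤ r → p ℚ.≤ q ℚ.+ r
∣p-q∣≤r⇒p≤q+r {p} {q} {r} h = begin
  p                    ≡⟨ solve 2 (λ p q → p := q :+ (p :+ :- q)) refl p q ⟩
  q ℚ.+ (p ℚ.- q)      ≤⟨ ℚ.+-monoʳ-≤ q (∣p∣≤r⇒p≤r h) ⟩
  q ℚ.+ r              ∎

∣p-q∣≤r⇒q≤p+r : ∀ {p q r} → ℚ.∣ p ℚ.- q ∣ ℚ.≤ r → q ℚ.≤ p ℚ.+ r
∣p-q∣≤r⇒q≤p+r {p} {q} {r} h = ∣p-q∣≤r⇒p≤q+r (subst (ℚ._≤ r) (abs-sym p q) h)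

square-nonNeg : ∀ p → 0ℚ ℚ.≤ p ℚ.* p
square-nonNeg p with ℚ.≤-total 0ℚ p
... | inj₁ 0≤p = *-nonNeg 0≤p 0≤p
... | inj₂ p≤0 = subst (0ℚ ℚ.≤_) (solve 1 (λ p → :- p :* :- p := p :* p) refl p)
                   (*-nonNeg (ℚ.neg-antimono-≤ p≤0) (ℚ.neg-antimono-≤ p≤0))

expᴿ-tail : ∀ {b} → 0ℚ ℚ.≤ b → ∀ ε → 0ℚ ℚ.< ε → ∃ λ k → ∀ m → k ℕ.≤ m → expᴿ (m ℕ.+ m) b ℚ.- expᴿ m b ℚ.≤ ε
expᴿ-tail {b} 0≤b ε 0<ε =
  let B , b≤B = archimedean b
      k , t   = ExpTail.tail B (½ ℚ.* ε) (½-pos 0<ε)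
      close   = λ i k≤i → subst₂ (λ u v → ℚ.∣ u ℚ.- v ∣ ℚ.≤ ½ ℚ.* ε) (expSum-real i b) (expSum-real k b)
                  (ℚ.≤-trans (∣re∣≤norm (expSum i (b , 0ℚ) -ᵍ expSum k (b , 0ℚ)))
                             (t (b , 0ℚ) (subst (ℚ._≤ fromℕ B) (sym (norm-real 0≤b)) b≤B) i k≤i))
  in k , λ m k≤m → ∣p∣≤r⇒p≤r (begin
    ℚ.∣ expᴿ (m ℕ.+ m) b ℚ.- expᴿ m b ∣
      ≤⟨ tri (expᴿ (m ℕ.+ m) b) (expᴿ k b) (expᴿ m b) ⟩
    ℚ.∣ expᴿ (m ℕ.+ m) b ℚ.- expᴿ k b ∣ ℚ.+ ℚ.∣ expᴿ k b ℚ.- expᴿ m b ∣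
      ≡⟨ cong (λ u → ℚ.∣ expᴿ (m ℕ.+ m) b ℚ.- expᴿ k b ∣ ℚ.+ u) (abs-sym (expᴿ k b) (expᴿ m b)) ⟩
    ℚ.∣ expᴿ (m ℕ.+ m) b ℚ.- expᴿ k b ∣ ℚ.+ ℚ.∣ expᴿ m b ℚ.- expᴿ k b ∣
      ≤⟨ ℚ.+-mono-≤ (close (m ℕ.+ m) (ℕ.≤-trans k≤m (ℕ.m≤m+n m m))) (close m k≤m) ⟩
    ½ ℚ.* ε ℚ.+ ½ ℚ.* ε
      ≡⟨ ½+½ ε ⟩
    ε ∎)

-- k depends on b and ε alone. This uniformity is what the diagonal definition of `exp` requires,
-- since the argument changes with m.
expSum-homo : ∀ {b} → 0ℚ ℚ.≤ b → ∀ ε → 0ℚ ℚ.< ε → ∃ λ k → ∀ m → k ℕ.≤ m →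
              ∀ z w → norm z ℚ.≤ b → norm w ℚ.≤ b →
              norm ((expSum m z *ᵍ expSum m w) -ᵍ expSum m (z +ᵍ w)) ℚ.≤ ε
expSum-homo {b} 0≤b ε 0<ε =
  let k , t = expᴿ-tail (+-nonNeg 0≤b 0≤b) ε 0<ε in k , λ m k≤m z w z≤b w≤b → begin
    norm ((expSum m z *ᵍ expSum m w) -ᵍ expSum m (z +ᵍ w))
      ≡⟨ cong norm (trans (cong (_-ᵍ expSum m (z +ᵍ w)) (expSum-+ m z w)) (cong₂ _,_
           (cancel (proj₁ (expSum m (z +ᵍ w))) _) (cancel (proj₂ (expSum m (z +ᵍ w))) _))) ⟩
    norm (G.corner (terms z) (terms w) m m)
      ≤⟨ norm-corner (norm-terms {z} {b} z≤b) (norm-terms {w} {b} w≤b) (ℕ.≤-refl {m}) ⟩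
    Q.corner (realTerms b) (realTerms b) m m
      ≤⟨ corner≤tail m 0≤b ⟩
    expᴿ (m ℕ.+ m) (b ℚ.+ b) ℚ.- expᴿ m (b ℚ.+ b)
      ≤⟨ t m k≤m ⟩
    ε ∎
  where
  cancel : ∀ e c → (e ℚ.+ c) ℚ.- e ≡ c
  cancel = solve 2 (λ e c → (e :+ c) :+ :- e := c) refl

-- Conjugation and the squared modulus

conj : ℚ[i] → ℚ[i]
conj (a , b) = a , ℚ.- b

expTerm-conj : ∀ k z → expTerm k (conj z) ≡ conj (expTerm k z)
expTerm-conj zero    z       = refl
expTerm-conj (suc k) z@(x , y) rewrite expTerm-conj k z = cong₂ _,_
  (solve 5 (λ r x y u v → r :* (x :* u :+ :- (:- y :* :- v)) := r :* (x :* u :+ :- (y :* v))) refl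
    (recip k) x y (proj₁ (expTerm k z)) (proj₂ (expTerm k z)))
  (solve 5 (λ r x y u v → r :* (x :* :- v :+ :- y :* u) := :- (r :* (x :* v :+ y :* u))) refl
    (recip k) x y (proj₁ (expTerm k z)) (proj₂ (expTerm k z)))

expSum-conj : ∀ m z → expSum m (conj z) ≡ conj (expSum m z)
expSum-conj zero    z = refl
expSum-conj (suc m) z rewrite expSum-conj m z | expTerm-conj m z =
  cong (proj₁ (expSum m z) ℚ.+ proj₁ (expTerm m z) ,_) (sym (ℚ.neg-distrib-+ (proj₂ (expSum m z)) (proj₂ (expTerm m z))))

modulus² : ℚ[i] → ℚ
modulus² (a , b) = a ℚ.* a ℚ.+ b ℚ.* b

modulus²-nonNeg : ∀ z → 0ℚ ℚ.≤ modulus² z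
modulus²-nonNeg (a , b) = +-nonNeg (square-nonNeg a) (square-nonNeg b)

norm-conj : ∀ z → norm (conj z) ≡ norm z
norm-conj (a , b) = cong (ℚ.∣ a ∣ ℚ.+_) (ℚ.∣-p∣≡∣p∣ b)

-- The functional equation at z and its conjugate: the partial sums commute with conjugation, and z
-- plus its conjugate is 2 Re z.
modulus²-expSum : ∀ {b} → 0ℚ ℚ.≤ b → ∀ ε → 0ℚ ℚ.< ε → ∃ λ k → ∀ m → k ℕ.≤ m → ∀ z → norm z ℚ.≤ b →
                  ℚ.∣ modulus² (expSum m z) ℚ.- expᴿ m (proj₁ z ℚ.+ proj₁ z) ∣ ℚ.≤ ε
modulus²-expSum {b} 0≤b ε 0<ε = let k , h = expSum-homo 0≤b ε 0<ε in k , λ m k≤m z z≤b → begin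
  ℚ.∣ modulus² (expSum m z) ℚ.- expᴿ m (proj₁ z ℚ.+ proj₁ z) ∣
    ≡⟨ cong₂ (λ u v → ℚ.∣ u ℚ.- v ∣) (eq₁ m z) (eq₂ m z) ⟩
  ℚ.∣ proj₁ (expSum m z *ᵍ expSum m (conj z)) ℚ.- proj₁ (expSum m (z +ᵍ conj z)) ∣
    ≤⟨ ∣re∣≤norm ((expSum m z *ᵍ expSum m (conj z)) -ᵍ expSum m (z +ᵍ conj z)) ⟩
  norm ((expSum m z *ᵍ expSum m (conj z)) -ᵍ expSum m (z +ᵍ conj z))
    ≤⟨ h m k≤m z (conj z) z≤b (ℚ.≤-trans (ℚ.≤-reflexive (norm-conj z)) z≤b) ⟩
  ε ∎
  where
  eq₁ : ∀ m z → modulus² (expSum m z) ≡ proj₁ (expSum m z *ᵍ expSum m (conj z))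
  eq₁ m z rewrite expSum-conj m z =
    solve 2 (λ a b → a :* a :+ b :* b := a :* a :+ :- (b :* :- b)) refl (proj₁ (expSum m z)) (proj₂ (expSum m z))
  eq₂ : ∀ m z → expᴿ m (proj₁ z ℚ.+ proj₁ z) ≡ proj₁ (expSum m (z +ᵍ conj z))
  eq₂ m z@(x , y) = trans (sym (expSum-real m (x ℚ.+ x)))
    (cong (λ v → proj₁ (expSum m (x ℚ.+ x , v))) (sym (ℚ.+-inverseʳ y)))

expTerm-im : ∀ k x → proj₂ (expTerm k (x , 0ℚ)) ≡ 0ℚ
expTerm-im zero    x = refl
expTerm-im (suc k) x rewrite expTerm-im k x =
  solve 3 (λ r x u → r :* (x :* con 0ℚ :+ con 0ℚ :* u) := con 0ℚ) refl (recip k) x (realTerms x k)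

expSum-im : ∀ m x → proj₂ (expSum m (x , 0ℚ)) ≡ 0ℚ
expSum-im zero    x = refl
expSum-im (suc m) x rewrite expSum-im m x | expTerm-im m x = refl

expᴿ-homo : ∀ {b} → 0ℚ ℚ.≤ b → ∀ ε → 0ℚ ℚ.< ε → ∃ λ k → ∀ m → k ℕ.≤ m →
            ∀ x y → ℚ.∣ x ∣ ℚ.≤ b → ℚ.∣ y ∣ ℚ.≤ b → ℚ.∣ expᴿ m x ℚ.* expᴿ m y ℚ.- expᴿ m (x ℚ.+ y) ∣ ℚ.≤ ε
expᴿ-homo {b} 0≤b ε 0<ε = let k , h = expSum-homo 0≤b ε 0<ε in k , λ m k≤m x y x≤b y≤b → begin
  ℚ.∣ expᴿ m x ℚ.* expᴿ m y ℚ.- expᴿ m (x ℚ.+ y) ∣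
    ≡⟨ cong₂ (λ u v → ℚ.∣ u ℚ.- v ∣) (eq m x y) (sym (expSum-real m (x ℚ.+ y))) ⟩
  ℚ.∣ proj₁ (expSum m (x , 0ℚ) *ᵍ expSum m (y , 0ℚ)) ℚ.- proj₁ (expSum m ((x , 0ℚ) +ᵍ (y , 0ℚ))) ∣
    ≤⟨ ∣re∣≤norm ((expSum m (x , 0ℚ) *ᵍ expSum m (y , 0ℚ)) -ᵍ expSum m ((x , 0ℚ) +ᵍ (y , 0ℚ))) ⟩
  norm ((expSum m (x , 0ℚ) *ᵍ expSum m (y , 0ℚ)) -ᵍ expSum m ((x , 0ℚ) +ᵍ (y , 0ℚ)))
    ≤⟨ h m k≤m (x , 0ℚ) (y , 0ℚ) (+0 x≤b) (+0 y≤b) ⟩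
  ε ∎
  where
  +0 : ∀ {x} → ℚ.∣ x ∣ ℚ.≤ b → norm (x , 0ℚ) ℚ.≤ b
  +0 {x} = subst (ℚ._≤ b) (sym (ℚ.+-identityʳ ℚ.∣ x ∣))
  eq : ∀ m x y → expᴿ m x ℚ.* expᴿ m y ≡ proj₁ (expSum m (x , 0ℚ) *ᵍ expSum m (y , 0ℚ))
  eq m x y rewrite expSum-im m x | expSum-im m y | expSum-real m x | expSum-real m y =
    solve 2 (λ a b → a :* b := a :* b :+ :- (con 0ℚ :* con 0ℚ)) refl (expᴿ m x) (expᴿ m y)

-- Bounds for the real exponential and for exp (log p)

1≤expᴿ : ∀ {x} → 0ℚ ℚ.≤ x → ∀ {m} → 1 ℕ.≤ m → 1ℚ ℚ.≤ expᴿ m x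
1≤expᴿ {x} 0≤x {m} 1≤m = subst (ℚ._≤ expᴿ m x) (ℚ.+-identityˡ 1ℚ) (Sum-mono (realTerms-nonNeg 0≤x) 1≤m)

expᴿ-nonNeg : ∀ {x} → 0ℚ ℚ.≤ x → ∀ m → 0ℚ ℚ.≤ expᴿ m x
expᴿ-nonNeg 0≤x = Sum-nonNeg (realTerms-nonNeg 0≤x)

-- A truncation of eˣ (1 - x) ≤ 1. Keeping the term `realTerms x m` on the right makes the induction
-- close, since the next term is at most x times it.
expᴿ-*-[1-x] : ∀ {x} → 0ℚ ℚ.≤ x → ∀ m → expᴿ m x ℚ.* (1ℚ ℚ.- x) ℚ.≤ 1ℚ ℚ.- realTerms x m
expᴿ-*-[1-x] {x} 0≤x zero    = ℚ.≤-reflexive (ℚ.*-zeroˡ (1ℚ ℚ.- x))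
expᴿ-*-[1-x] {x} 0≤x (suc m) = begin
  (e ℚ.+ u) ℚ.* (1ℚ ℚ.- x)
    ≡⟨ solve 3 (λ e u x → (e :+ u) :* (con 1ℚ :+ :- x) := e :* (con 1ℚ :+ :- x) :+ (u :+ :- (x :* u))) refl e u x ⟩
  e ℚ.* (1ℚ ℚ.- x) ℚ.+ (u ℚ.- x ℚ.* u)
    ≤⟨ ℚ.+-monoˡ-≤ (u ℚ.- x ℚ.* u) (expᴿ-*-[1-x] 0≤x m) ⟩
  (1ℚ ℚ.- u) ℚ.+ (u ℚ.- x ℚ.* u)
    ≡⟨ solve 2 (λ u v → (con 1ℚ :+ :- u) :+ (u :+ :- v) := con 1ℚ :+ :- (con 1ℚ :* v)) refl u (x ℚ.* u) ⟩
  1ℚ ℚ.- 1ℚ ℚ.* (x ℚ.* u)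
    ≤⟨ ℚ.+-monoʳ-≤ 1ℚ (ℚ.neg-antimono-≤ (ℚ.*-monoʳ-≤-nonNeg (x ℚ.* u)
         {{ℚ.nonNegative (*-nonNeg 0≤x (realTerms-nonNeg 0≤x m))}} (recip-antimono {0} {m} ℕ.z≤n))) ⟩
  1ℚ ℚ.- recip m ℚ.* (x ℚ.* u)
    ≡⟨ cong (λ v → 1ℚ ℚ.- v) (realTerms-suc x m) ⟨
  1ℚ ℚ.- realTerms x (suc m) ∎
  where
  e = expᴿ m x
  u = realTerms x m

expᴿ-*-[1-x]≤1 : ∀ {x} → 0ℚ ℚ.≤ x → ∀ m → expᴿ m x ℚ.* (1ℚ ℚ.- x) ℚ.≤ 1ℚ
expᴿ-*-[1-x]≤1 {x} 0≤x m = ℚ.≤-trans (expᴿ-*-[1-x] 0≤x m)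
  (ℚ.+-monoʳ-≤ 1ℚ (ℚ.neg-antimono-≤ (realTerms-nonNeg 0≤x m)))

fromℕ-*-recip-suc : ∀ k → fromℕ (suc k) ℚ.* recip k ≡ 1ℚ
fromℕ-*-recip-suc k = fromℕ-*-recip (suc k) k 0 (ℕ.*-identityʳ (suc k))

fromℕ-+ : ∀ a b → fromℕ (a ℕ.+ b) ≡ fromℕ a ℚ.+ fromℕ b
fromℕ-+ zero    b = sym (ℚ.+-identityˡ (fromℕ b))
fromℕ-+ (suc a) b = trans (fromℕ-suc (a ℕ.+ b)) (trans (cong (1ℚ ℚ.+_) (fromℕ-+ a b))
  (trans (sym (ℚ.+-assoc 1ℚ (fromℕ a) (fromℕ b))) (cong (ℚ._+ fromℕ b) (sym (fromℕ-suc a)))))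

fromℕ-* : ∀ a b → fromℕ (a ℕ.* b) ≡ fromℕ a ℚ.* fromℕ b
fromℕ-* zero    b = sym (ℚ.*-zeroˡ (fromℕ b))
fromℕ-* (suc a) b = trans (fromℕ-+ b (a ℕ.* b)) (trans (cong (fromℕ b ℚ.+_) (fromℕ-* a b)) (trans
  (solve 2 (λ a b → b :+ a :* b := (con 1ℚ :+ a) :* b) refl (fromℕ a) (fromℕ b))
  (cong (ℚ._* fromℕ b) (sym (fromℕ-suc a)))))

-- As `recip M` is 1 / (M + 1), the preceding bound has 1 - x = M / (M + 1). Clearing denominators
-- keeps M = 0 meaningful.
expᴿ-recip : ∀ m M → expᴿ m (recip M) ℚ.* fromℕ M ℚ.≤ fromℕ (suc M)
expᴿ-recip m M = begin
  e ℚ.* fromℕ M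
    ≡⟨ solve 2 (λ e M → e :* M := e :* ((con 1ℚ :+ M) :+ :- con 1ℚ)) refl e (fromℕ M) ⟩
  e ℚ.* ((1ℚ ℚ.+ fromℕ M) ℚ.- 1ℚ)
    ≡⟨ cong₂ (λ u v → e ℚ.* (u ℚ.- v)) (sym (fromℕ-suc M)) (sym (fromℕ-*-recip-suc M)) ⟩
  e ℚ.* (fromℕ (suc M) ℚ.- fromℕ (suc M) ℚ.* recip M)
    ≡⟨ solve 3 (λ e s r → e :* (s :+ :- (s :* r)) := s :* (e :* (con 1ℚ :+ :- r))) refl e (fromℕ (suc M)) (recip M) ⟩
  fromℕ (suc M) ℚ.* (e ℚ.* (1ℚ ℚ.- recip M))
    ≤⟨ *-mono (fromℕ-nonNeg (suc M)) (expᴿ-*-[1-x]≤1 (recip-nonNeg M) m) ⟩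
  fromℕ (suc M) ℚ.* 1ℚ
    ≡⟨ ℚ.*-identityʳ (fromℕ (suc M)) ⟩
  fromℕ (suc M) ∎
  where e = expᴿ m (recip M)

0≤harmonic-difference : ∀ N j → 0ℚ ℚ.≤ harmonic (N ℕ.+ j) ℚ.- harmonic N
0≤harmonic-difference N zero    rewrite ℕ.+-identityʳ N = ℚ.≤-reflexive (sym (ℚ.+-inverseʳ (harmonic N)))
0≤harmonic-difference N (suc j) rewrite ℕ.+-suc N j = subst (0ℚ ℚ.≤_)
  (solve 3 (λ a r b → (a :+ :- b) :+ r := (a :+ r) :+ :- b) refl (harmonic (N ℕ.+ j)) (recip (N ℕ.+ j)) (harmonic N))
  (+-nonNeg (0≤harmonic-difference N j) (recip-nonNeg (N ℕ.+ j)))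

-- exp (1 / (M + 1)) ≤ (M + 1) / M, which telescopes.
expᴿ-harmonic : ∀ m N j → expᴿ m (harmonic (N ℕ.+ j) ℚ.- harmonic N) ℚ.* fromℕ N ℚ.≤ fromℕ (N ℕ.+ j)
expᴿ-harmonic m N zero rewrite ℕ.+-identityʳ N | ℚ.+-inverseʳ (harmonic N) = begin
  expᴿ m 0ℚ ℚ.* fromℕ N           ≤⟨ ℚ.*-monoʳ-≤-nonNeg (fromℕ N) {{ℚ.nonNegative (fromℕ-nonNeg N)}}
                                       (subst (ℚ._≤ 1ℚ) (ℚ.*-identityʳ (expᴿ m 0ℚ)) (expᴿ-*-[1-x]≤1 ℚ.≤-refl m)) ⟩
  1ℚ ℚ.* fromℕ N                  ≡⟨ ℚ.*-identityˡ (fromℕ N) ⟩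
  fromℕ N                         ∎
expᴿ-harmonic m N (suc j) rewrite ℕ.+-suc N j = begin
  expᴿ m ((harmonic M ℚ.+ recip M) ℚ.- harmonic N) ℚ.* fromℕ N
    ≡⟨ cong (λ u → expᴿ m u ℚ.* fromℕ N)
         (solve 3 (λ a r b → (a :+ r) :+ :- b := (a :+ :- b) :+ r) refl (harmonic M) (recip M) (harmonic N)) ⟩
  expᴿ m (h ℚ.+ recip M) ℚ.* fromℕ N
    ≤⟨ ℚ.*-monoʳ-≤-nonNeg (fromℕ N) {{ℚ.nonNegative (fromℕ-nonNeg N)}}
         (expᴿ-submult m (0≤harmonic-difference N j) (recip-nonNeg M)) ⟩
  (expᴿ m h ℚ.* expᴿ m (recip M)) ℚ.* fromℕ N
    ≡⟨ solve 3 (λ a b c → (a :* b) :* c := b :* (a :* c)) refl (expᴿ m h) (expᴿ m (recip M)) (fromℕ N) ⟩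
  expᴿ m (recip M) ℚ.* (expᴿ m h ℚ.* fromℕ N)
    ≤⟨ *-mono (expᴿ-nonNeg (recip-nonNeg M) m) (expᴿ-harmonic m N j) ⟩
  expᴿ m (recip M) ℚ.* fromℕ M
    ≤⟨ expᴿ-recip m M ⟩
  fromℕ (suc M) ∎
  where
  M = N ℕ.+ j
  h = harmonic M ℚ.- harmonic N

logᴿ : ℕ → ℕ → ℚ
logᴿ p N = harmonic (p ℕ.* N) ℚ.- harmonic N

0≤log : ∀ q N → 0ℚ ℚ.≤ logᴿ (suc q) N
0≤log q N = 0≤harmonic-difference N (q ℕ.* N)

-- Cancelling the factor in `expᴿ-harmonic` needs it positive, hence `suc N`. The number m of terms
-- and the mesh of the Riemann sum are independent.
expᴿ-log : ∀ m q N → expᴿ m (logᴿ (suc q) (suc N)) ℚ.≤ fromℕ (suc q)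
expᴿ-log m q N = begin
  e                                        ≡⟨ ℚ.*-identityʳ e ⟨
  e ℚ.* 1ℚ                                 ≡⟨ cong (e ℚ.*_) (fromℕ-*-recip-suc N) ⟨
  e ℚ.* (fromℕ (suc N) ℚ.* recip N)        ≡⟨ ℚ.*-assoc e (fromℕ (suc N)) (recip N) ⟨
  (e ℚ.* fromℕ (suc N)) ℚ.* recip N        ≤⟨ ℚ.*-monoʳ-≤-nonNeg (recip N) {{ℚ.nonNegative (recip-nonNeg N)}} (expᴿ-harmonic m (suc N) (q ℕ.* suc N)) ⟩
  fromℕ (suc q ℕ.* suc N) ℚ.* recip N      ≡⟨ cong (ℚ._* recip N) (fromℕ-* (suc q) (suc N)) ⟩
  (fromℕ (suc q) ℚ.* fromℕ (suc N)) ℚ.* recip N  ≡⟨ ℚ.*-assoc (fromℕ (suc q)) (fromℕ (suc N)) (recip N) ⟩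
  fromℕ (suc q) ℚ.* (fromℕ (suc N) ℚ.* recip N)  ≡⟨ cong (fromℕ (suc q) ℚ.*_) (fromℕ-*-recip-suc N) ⟩
  fromℕ (suc q) ℚ.* 1ℚ                     ≡⟨ ℚ.*-identityʳ (fromℕ (suc q)) ⟩
  fromℕ (suc q)                            ∎
  where e = expᴿ m (logᴿ (suc q) (suc N))

expᴿ-*≤^ : ∀ m {l} p → 0ℚ ℚ.≤ l → expᴿ m l ℚ.≤ fromℕ p → ∀ j → expᴿ m (fromℕ j ℚ.* l) ℚ.≤ fromℕ (p ℕ.^ j)
expᴿ-*≤^ m {l} p 0≤l h zero    = begin
  expᴿ m (0ℚ ℚ.* l)               ≡⟨ cong (expᴿ m) (ℚ.*-zeroˡ l) ⟩
  expᴿ m 0ℚ                       ≡⟨ ℚ.*-identityʳ (expᴿ m 0ℚ) ⟨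
  expᴿ m 0ℚ ℚ.* (1ℚ ℚ.- 0ℚ)       ≤⟨ expᴿ-*-[1-x]≤1 ℚ.≤-refl m ⟩
  1ℚ                              ∎
expᴿ-*≤^ m {l} p 0≤l h (suc j) = begin
  expᴿ m (fromℕ (suc j) ℚ.* l)
    ≡⟨ cong (expᴿ m) (trans (cong (ℚ._* l) (fromℕ-suc j)) (solve 2 (λ j l → (con 1ℚ :+ j) :* l := l :+ j :* l) refl (fromℕ j) l)) ⟩
  expᴿ m (l ℚ.+ fromℕ j ℚ.* l)
    ≤⟨ expᴿ-submult m 0≤l (*-nonNeg (fromℕ-nonNeg j) 0≤l) ⟩
  expᴿ m l ℚ.* expᴿ m (fromℕ j ℚ.* l)
    ≤⟨ *-mono₂ (expᴿ-nonNeg (*-nonNeg (fromℕ-nonNeg j) 0≤l) m) (fromℕ-nonNeg p) h (expᴿ-*≤^ m p 0≤l h j) ⟩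
  fromℕ p ℚ.* fromℕ (p ℕ.^ j)
    ≡⟨ fromℕ-* p (p ℕ.^ j) ⟨
  fromℕ (p ℕ.^ suc j) ∎

-- Lower bound for the modulus of an exponential

¼ : ℚ
¼ = + 1 ℚ./ 4

-- To be read with s = ∣ exp z ∣², A = exp (2 Re z), B = exp b and T = exp (2 Re z + b), all
-- truncated. Then P A ≥ A B ≥ T - ½ ≥ ½, and replacing A by s costs at most P r ≤ ¼.
modulus-lower-bound : ∀ {s A B T r} P → ℚ.∣ s ℚ.- A ∣ ℚ.≤ r → ℚ.∣ A ℚ.* B ℚ.- T ∣ ℚ.≤ ½ → 1ℚ ℚ.≤ T →
                      0ℚ ℚ.≤ B → B ℚ.≤ fromℕ P → fromℕ P ℚ.* r ℚ.≤ ¼ → ¼ ℚ.≤ fromℕ P ℚ.* s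
modulus-lower-bound {s} {A} {B} {T} {r} P s≈A AB≈T 1≤T 0≤B B≤P Pr≤¼ = 0≤q-p⇒p≤q (begin
  0ℚ
    ≤⟨ p≤q⇒0≤q-p Pr≤¼ ⟩
  ¼ ℚ.- fromℕ P ℚ.* r
    ≡⟨ solve 1 (λ u → con ¼ :+ :- u := (con ½ :+ :- u) :+ :- con ¼) refl (fromℕ P ℚ.* r) ⟩
  (½ ℚ.- fromℕ P ℚ.* r) ℚ.- ¼
    ≤⟨ ℚ.+-monoˡ-≤ (ℚ.- ¼) (ℚ.+-monoˡ-≤ (ℚ.- (fromℕ P ℚ.* r)) (ℚ.≤-trans ½≤AB AB≤PA)) ⟩
  (fromℕ P ℚ.* A ℚ.- fromℕ P ℚ.* r) ℚ.- ¼
    ≡⟨ cong (ℚ._- ¼) (solve 3 (λ P A r → P :* A :+ :- (P :* r) := P :* (A :+ :- r)) refl (fromℕ P) A r) ⟩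
  fromℕ P ℚ.* (A ℚ.- r) ℚ.- ¼
    ≤⟨ ℚ.+-monoˡ-≤ (ℚ.- ¼) (*-mono (fromℕ-nonNeg P) A-r≤s) ⟩
  fromℕ P ℚ.* s ℚ.- ¼ ∎)
  where
  ½≤AB : ½ ℚ.≤ A ℚ.* B
  ½≤AB = begin
    1ℚ ℚ.- ½                 ≤⟨ ℚ.+-monoˡ-≤ (ℚ.- ½) (ℚ.≤-trans 1≤T (∣p-q∣≤r⇒q≤p+r {A ℚ.* B} AB≈T)) ⟩
    (A ℚ.* B ℚ.+ ½) ℚ.- ½    ≡⟨ solve 1 (λ u → (u :+ con ½) :+ :- con ½ := u) refl (A ℚ.* B) ⟩
    A ℚ.* B                  ∎
  A-r≤s : A ℚ.- r ℚ.≤ s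
  A-r≤s = begin
    A ℚ.- r                  ≤⟨ ℚ.+-monoˡ-≤ (ℚ.- r) (∣p-q∣≤r⇒q≤p+r {s} s≈A) ⟩
    (s ℚ.+ r) ℚ.- r          ≡⟨ solve 2 (λ s r → (s :+ r) :+ :- r := s) refl s r ⟩
    s                        ∎
  AB≤PA : A ℚ.* B ℚ.≤ fromℕ P ℚ.* A
  -- A truncated exponential at a negative argument has no a priori sign; A ≤ 0 is excluded by A B ≥
  -- ½.
  AB≤PA with ℚ.≤-total 0ℚ A
  ... | inj₁ 0≤A = ℚ.≤-trans (*-mono 0≤A B≤P) (ℚ.≤-reflexive (ℚ.*-comm A (fromℕ P)))
  ... | inj₂ A≤0 = contradiction (ℚ.≤-<-trans (ℚ.≤-trans ½≤AB (ℚ.≤-trans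
      (ℚ.*-monoʳ-≤-nonNeg B {{ℚ.nonNegative 0≤B}} A≤0) (ℚ.≤-reflexive (ℚ.*-zeroˡ B)))) (ℚ.positive⁻¹ ½))
    (ℚ.<-irrefl refl)

Eventually : (ℕ → Set) → Set
Eventually P = ∃ λ N → ∀ i → N ℕ.≤ i → P i

infixr 6 _and_

_and_ : ∀ {P R} → Eventually P → Eventually R → Eventually (λ i → P i × R i)
(N , p) and (M , r) = N ℕ.⊔ M , λ i ≤i → p i (ℕ.m⊔n≤o⇒m≤o N M ≤i) , r i (ℕ.m⊔n≤o⇒n≤o N M ≤i)

map-eventually : ∀ {P R : ℕ → Set} → (∀ i → P i → R i) → Eventually P → Eventually R
map-eventually h (N , p) = N , λ i ≤i → h i (p i ≤i)

bounded-by : ∀ (x : ℝ) → ∃ λ B → Eventually λ i → ℚ.∣ seq x i ∣ ℚ.≤ fromℕ B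
bounded-by x = bounded {seq x} (cauchy x)

exp-lower-bound : ∀ (z : ℂ) (b : ℝ) P → Eventually (λ i → 0ℚ ℚ.≤ seq b i) →
                  Eventually (λ i → 0ℚ ℚ.≤ seq b i ℚ.+ (seq (Re z) i ℚ.+ seq (Re z) i)) →
                  Eventually (λ i → expᴿ i (seq b i) ℚ.≤ fromℕ P) →
                  Eventually (λ i → ¼ ℚ.≤ fromℕ P ℚ.* modulus² (approx (exp z) i))
exp-lower-bound z b P 0≤b 0≤b+2x expb≤P =
  let X , ∣x∣≤X = bounded-by (Re z)
      Y , ∣y∣≤Y = bounded-by (Im z)
      B , ∣b∣≤B = bounded-by b
      -- One radius that serves for z, for 2 Re z and for b, so that both uniform estimates apply.
      C  = ((fromℕ X ℚ.+ fromℕ X) ℚ.+ fromℕ Y) ℚ.+ fromℕ B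
      0≤X = fromℕ-nonNeg X
      0≤Y = fromℕ-nonNeg Y
      0≤B = fromℕ-nonNeg B
      0≤C = +-nonNeg (+-nonNeg (+-nonNeg 0≤X 0≤X) 0≤Y) 0≤B
      k , Pr≤¼ = small (fromℕ P) ¼ (ℚ.positive⁻¹ ¼)
  in map-eventually
       (λ i (0≤b , 0≤b+2x , expb≤P , ∣x∣≤X , ∣y∣≤Y , ∣b∣≤B , 1≤i , homo , mod) →
         let x = seq (Re z) i
             y = seq (Im z) i
         in modulus-lower-bound P
              (mod (x , y) (begin
                ℚ.∣ x ∣ ℚ.+ ℚ.∣ y ∣                        ≤⟨ ℚ.+-mono-≤ ∣x∣≤X ∣y∣≤Y ⟩
                fromℕ X ℚ.+ fromℕ Y                        ≤⟨ p≤p+q (+-nonNeg 0≤X 0≤B) ⟩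
                (fromℕ X ℚ.+ fromℕ Y) ℚ.+ (fromℕ X ℚ.+ fromℕ B)
                  ≡⟨ solve 3 (λ x y b → (x :+ y) :+ (x :+ b) := ((x :+ x) :+ y) :+ b) refl (fromℕ X) (fromℕ Y) (fromℕ B) ⟩
                C                                          ∎))
              (homo (x ℚ.+ x) (seq b i)
                (begin
                  ℚ.∣ x ℚ.+ x ∣                            ≤⟨ ℚ.∣p+q∣≤∣p∣+∣q∣ x x ⟩
                  ℚ.∣ x ∣ ℚ.+ ℚ.∣ x ∣                      ≤⟨ ℚ.+-mono-≤ ∣x∣≤X ∣x∣≤X ⟩
                  fromℕ X ℚ.+ fromℕ X                      ≤⟨ p≤p+q (+-nonNeg 0≤Y 0≤B) ⟩
                  (fromℕ X ℚ.+ fromℕ X) ℚ.+ (fromℕ Y ℚ.+ fromℕ B)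
                    ≡⟨ ℚ.+-assoc (fromℕ X ℚ.+ fromℕ X) (fromℕ Y) (fromℕ B) ⟨
                  C                                        ∎)
                (begin
                  ℚ.∣ seq b i ∣                            ≤⟨ ∣b∣≤B ⟩
                  fromℕ B                                  ≤⟨ p≤p+q (+-nonNeg (+-nonNeg 0≤X 0≤X) 0≤Y) ⟩
                  fromℕ B ℚ.+ ((fromℕ X ℚ.+ fromℕ X) ℚ.+ fromℕ Y)
                    ≡⟨ ℚ.+-comm (fromℕ B) _ ⟩
                  C                                        ∎))
              (1≤expᴿ (subst (0ℚ ℚ.≤_) (ℚ.+-comm (seq b i) (x ℚ.+ x)) 0≤b+2x) 1≤i)
              (expᴿ-nonNeg 0≤b i) expb≤P Pr≤¼)
       (0≤b and 0≤b+2x and expb≤P and ∣x∣≤X and ∣y∣≤Y and ∣b∣≤B and (1 , λ _ 1≤i → 1≤i)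
         and expᴿ-homo 0≤C ½ (ℚ.positive⁻¹ ½) and modulus²-expSum 0≤C (recip k) (recip-pos k))
  where
  p≤p+q : ∀ {p q} → 0ℚ ℚ.≤ q → p ℚ.≤ p ℚ.+ q
  p≤p+q {p} {q} 0≤q = subst (ℚ._≤ p ℚ.+ q) (ℚ.+-identityʳ p) (ℚ.+-monoʳ-≤ p 0≤q)

-- Squares replace moduli: ∣ u - v ∣² ≤ 2 ∣ u ∣² + 2 ∣ v ∣² with u = Sₑ₊₁ - L and v = Sₑ - L.
term-bound : ∀ {a L} → SumsTo a L → ∀ ε → 0ℚ ℚ.< ε → ∃ λ N → ∀ e → N ℕ.≤ e →
             Eventually λ i → modulus² (approx (a e) i) ℚ.≤ fromℕ 4 ℚ.* (ε ℚ.* ε ℚ.+ ε)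
term-bound {a} {L} sums ε 0<ε = let N , h = sums ε 0<ε in N , λ e N≤e → map-eventually
  (λ i (p , q) →
    let x , y = approx (a e) i
        s , t = approx (partialSum a e) i
        l , k = approx L i
        r     = ε ℚ.* ε ℚ.+ ε
    in begin
      x ℚ.* x ℚ.+ y ℚ.* y
        ≤⟨ ℚ.+-mono-≤ (parallelogram x s l) (parallelogram y t k) ⟩
      fromℕ 2 ℚ.* (sq (s ℚ.+ x ℚ.- l) ℚ.+ sq (s ℚ.- l)) ℚ.+ fromℕ 2 ℚ.* (sq (t ℚ.+ y ℚ.- k) ℚ.+ sq (t ℚ.- k))
        ≡⟨ solve 4 (λ a b c d → con (fromℕ 2) :* (a :+ b) :+ con (fromℕ 2) :* (c :+ d) := con (fromℕ 2) :* ((a :+ c) :+ (b :+ d)))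
             refl (sq (s ℚ.+ x ℚ.- l)) (sq (s ℚ.- l)) (sq (t ℚ.+ y ℚ.- k)) (sq (t ℚ.- k)) ⟩
      fromℕ 2 ℚ.* ((sq (s ℚ.+ x ℚ.- l) ℚ.+ sq (t ℚ.+ y ℚ.- k)) ℚ.+ (sq (s ℚ.- l) ℚ.+ sq (t ℚ.- k)))
        ≤⟨ *-mono (fromℕ-nonNeg 2) (ℚ.+-mono-≤ p q) ⟩
      fromℕ 2 ℚ.* (r ℚ.+ r)
        ≡⟨ solve 1 (λ r → con (fromℕ 2) :* (r :+ r) := con (fromℕ 4) :* r) refl r ⟩
      fromℕ 4 ℚ.* r ∎)
  -- The second ε is the slack allowed by `_≤ᴿ_`; this is the origin of ε * ε + ε.
  (h (suc e) (ℕ.m≤n⇒m≤1+n N≤e) ε 0<ε and h e N≤e ε 0<ε)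
  where
  sq : ℚ → ℚ
  sq u = u ℚ.* u
  parallelogram : ∀ x s l → sq x ℚ.≤ fromℕ 2 ℚ.* (sq (s ℚ.+ x ℚ.- l) ℚ.+ sq (s ℚ.- l))
  parallelogram x s l = 0≤q-p⇒p≤q (subst (0ℚ ℚ.≤_)
    (solve 3 (λ x s l → let u = (s :+ x) :+ :- l ; v = s :+ :- l in
       (u :+ v) :* (u :+ v) := con (fromℕ 2) :* (u :* u :+ v :* v) :+ :- (x :* x)) refl x s l)
    (square-nonNeg ((s ℚ.+ x ℚ.- l) ℚ.+ (s ℚ.- l))))

-- Divergence

modulus²-ℕ* : ∀ F w i → modulus² (approx (ℕ→ℂ F *ᶜ w) i) ≡ (fromℕ F ℚ.* fromℕ F) ℚ.* modulus² (approx w i)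
modulus²-ℕ* F w i = solve 3 (λ F x y →
    (F :* x :+ :- (con 0ℚ :* y)) :* (F :* x :+ :- (con 0ℚ :* y)) :+ (F :* y :+ con 0ℚ :* x) :* (F :* y :+ con 0ℚ :* x)
    := (F :* F) :* (x :* x :+ y :* y))
  refl (fromℕ F) (seq (Re w) i) (seq (Im w) i)

-- Here b = (j + 1) log p, so b + 2 Re z = log p (j + 1 - 2 e σ). With slack r = 1 / (2 e + 1) one
-- has 2 e σ ≤ 2 e c + 2 e r ≤ j + 1: the additional factor of p in the power absorbs the slack.
power-lower-bound : ∀ q s c e j → Re s ≤ᴿ fromℚ c → fromℕ (e ℕ.+ e) ℚ.* c ℚ.≤ fromℕ j →
  Eventually λ i → ¼ ℚ.≤ fromℕ (suc q ℕ.^ suc j) ℚ.* modulus² (approx (suc q ^ᶜ (-ᶜ (ℕ→ℂ e *ᶜ s))) i)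
power-lower-bound q s c e j σ≤c 2ec≤j = exp-lower-bound ((-ᶜ (ℕ→ℂ e *ᶜ s)) *ᶜ (log (suc q) +𝕚 fromℚ 0ℚ))
  (fromℚ (fromℕ (suc j)) *ᴿ log (suc q)) (suc q ℕ.^ suc j)
  (0 , λ i _ → *-nonNeg (fromℕ-nonNeg (suc j)) (0≤log q i))
  (map-eventually (λ i σ≤c+r → let σ = seq (Re s) i ; τ = seq (Im s) i ; l = logᴿ (suc q) i in begin
     0ℚ
       ≤⟨ *-nonNeg (0≤log q i) (p≤q⇒0≤q-p (begin
            fromℕ (e ℕ.+ e) ℚ.* σ
              ≤⟨ *-mono (fromℕ-nonNeg (e ℕ.+ e)) σ≤c+r ⟩
            fromℕ (e ℕ.+ e) ℚ.* (c ℚ.+ r)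
              ≡⟨ ℚ.*-distribˡ-+ (fromℕ (e ℕ.+ e)) c r ⟩
            fromℕ (e ℕ.+ e) ℚ.* c ℚ.+ fromℕ (e ℕ.+ e) ℚ.* r
              ≤⟨ ℚ.+-mono-≤ 2ec≤j (ℚ.*-monoʳ-≤-nonNeg r {{ℚ.nonNegative (recip-nonNeg (e ℕ.+ e))}} (fromℕ-mono (ℕ.n≤1+n (e ℕ.+ e)))) ⟩
            fromℕ j ℚ.+ fromℕ (suc (e ℕ.+ e)) ℚ.* r
              ≡⟨ trans (cong (fromℕ j ℚ.+_) (fromℕ-*-recip-suc (e ℕ.+ e))) (trans (ℚ.+-comm (fromℕ j) 1ℚ) (sym (fromℕ-suc j))) ⟩
            fromℕ (suc j) ∎)) ⟩
     l ℚ.* (fromℕ (suc j) ℚ.- fromℕ (e ℕ.+ e) ℚ.* σ)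
       ≡⟨ cong (λ u → l ℚ.* (fromℕ (suc j) ℚ.- u ℚ.* σ)) (fromℕ-+ e e) ⟩
     l ℚ.* (fromℕ (suc j) ℚ.- (fromℕ e ℚ.+ fromℕ e) ℚ.* σ)
       ≡⟨ solve 5 (λ l j e σ τ →
            let x = :- (e :* σ :+ :- (con 0ℚ :* τ)) :* l :+ :- (:- (e :* τ :+ con 0ℚ :* σ) :* con 0ℚ) in
            l :* (j :+ :- ((e :+ e) :* σ)) := j :* l :+ (x :+ x))
            refl l (fromℕ (suc j)) (fromℕ e) σ τ ⟩
     _ ∎)
    (σ≤c r (recip-pos (e ℕ.+ e))))
  -- Index 0 is skipped because `expᴿ-log` requires a positive mesh parameter.
  (1 , λ { (suc N) _ → expᴿ-*≤^ (suc N) (suc q) (0≤log q (suc N)) (expᴿ-log (suc N) q N) (suc j) })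
  where r = recip (e ℕ.+ e)

-- The arithmetic of subrings enters only through `f-bound`, which gives coefficients at least p^(e
-- c) along the multiples e of D.
diverges : ∀ n {p} (p-prime : Prime p) s c D E .{{_ : ℕ.NonZero D}} → fromℕ D ℚ.* c ≡ fromℕ E →
           (∀ k → p ℕ.^ (k ℕ.* E) ℕ.≤ f n (p ℕ.^ (k ℕ.* D))) →
           Re s ≤ᴿ fromℚ c → Diverges (localFactor n p-prime s)
diverges n {zero}  p-prime = contradiction p-prime ¬prime[0]
diverges n {p@(suc q)} p-prime s c D E Dc≡E f-bound σ≤c (L , sums) =
  -- ⅛ < ¼ by cross multiplication: 4 < 8, that is 5 ≤ 5 + 3.
  ℚ.<-irrefl refl (ℚ.≤-<-trans (ℚ.≤-trans ¼≤ ≤⅛) (ℚ.*<* (ℤ.+<+ (ℕ.m≤m+n 5 3))))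
  where
  ⅛ : ℚ
  ⅛ = + 1 ℚ./ 8
  -- Since ε ≤ 1, the bound 4 (ε² + ε) on the terms is at most 8 ε, so 8 p ε ≤ ⅛ contradicts the
  -- lower bound ¼ for p times a squared modulus.
  ε-choice = small (fromℕ (8 ℕ.* p)) ⅛ (ℚ.positive⁻¹ ⅛)
  ε   = recip (proj₁ ε-choice)
  small-terms = term-bound {localFactor n p-prime s} {L} sums ε (recip-pos (proj₁ ε-choice))
  N = proj₁ small-terms
  -- A multiple of D that is at least N, as D is nonzero; then 2 e c = 2 N E = j.
  e = N ℕ.* D
  j = N ℕ.* E ℕ.+ N ℕ.* E
  F = f n (p ℕ.^ e)
  w = p ^ᶜ (-ᶜ (ℕ→ℂ e *ᶜ s))
  2ec≤j : fromℕ (e ℕ.+ e) ℚ.* c ℚ.≤ fromℕ j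
  2ec≤j = ℚ.≤-reflexive (begin-equality
    fromℕ (e ℕ.+ e) ℚ.* c
      ≡⟨ cong (ℚ._* c) (trans (fromℕ-+ e e) (cong (λ u → u ℚ.+ u) (fromℕ-* N D))) ⟩
    (fromℕ N ℚ.* fromℕ D ℚ.+ fromℕ N ℚ.* fromℕ D) ℚ.* c
      ≡⟨ solve 3 (λ N D c → (N :* D :+ N :* D) :* c := N :* (D :* c) :+ N :* (D :* c)) refl (fromℕ N) (fromℕ D) c ⟩
    fromℕ N ℚ.* (fromℕ D ℚ.* c) ℚ.+ fromℕ N ℚ.* (fromℕ D ℚ.* c)
      ≡⟨ cong (λ u → fromℕ N ℚ.* u ℚ.+ fromℕ N ℚ.* u) Dc≡E ⟩
    fromℕ N ℚ.* fromℕ E ℚ.+ fromℕ N ℚ.* fromℕ E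
      ≡⟨ trans (fromℕ-+ (N ℕ.* E) (N ℕ.* E)) (cong (λ u → u ℚ.+ u) (fromℕ-* N E)) ⟨
    fromℕ j ∎)
  both = power-lower-bound q s c e j σ≤c 2ec≤j and proj₂ small-terms e (ℕ.m≤m*n N D)
  i = proj₁ both
  X = modulus² (approx w i)
  ¼≤pPX : ¼ ℚ.≤ fromℕ (p ℕ.^ suc j) ℚ.* X
  ¼≤pPX = proj₁ (proj₂ both i ℕ.≤-refl)
  p^j≤F² : p ℕ.^ j ℕ.≤ F ℕ.* F
  p^j≤F² = subst (ℕ._≤ F ℕ.* F) (sym (ℕ.^-distribˡ-+-* p (N ℕ.* E) (N ℕ.* E))) (ℕ.*-mono-≤ (f-bound N) (f-bound N))
  ¼≤ : ¼ ℚ.≤ fromℕ p ℚ.* modulus² (approx (localFactor n p-prime s e) i)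
  ¼≤ = begin
    ¼
      ≤⟨ ¼≤pPX ⟩
    fromℕ (p ℕ.* p ℕ.^ j) ℚ.* X
      ≤⟨ ℚ.*-monoʳ-≤-nonNeg X {{ℚ.nonNegative (modulus²-nonNeg (approx w i))}} (fromℕ-mono (ℕ.*-monoʳ-≤ p p^j≤F²)) ⟩
    fromℕ (p ℕ.* (F ℕ.* F)) ℚ.* X
      ≡⟨ cong (ℚ._* X) (trans (fromℕ-* p (F ℕ.* F)) (cong (fromℕ p ℚ.*_) (fromℕ-* F F))) ⟩
    (fromℕ p ℚ.* (fromℕ F ℚ.* fromℕ F)) ℚ.* X
      ≡⟨ trans (ℚ.*-assoc (fromℕ p) (fromℕ F ℚ.* fromℕ F) X) (cong (fromℕ p ℚ.*_) (sym (modulus²-ℕ* F w i))) ⟩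
    fromℕ p ℚ.* modulus² (approx (localFactor n p-prime s e) i) ∎
  ≤⅛ : fromℕ p ℚ.* modulus² (approx (localFactor n p-prime s e) i) ℚ.≤ ⅛
  ≤⅛ = begin
    fromℕ p ℚ.* modulus² (approx (localFactor n p-prime s e) i)
      ≤⟨ *-mono (fromℕ-nonNeg p) (proj₂ (proj₂ both i ℕ.≤-refl)) ⟩
    fromℕ p ℚ.* (fromℕ 4 ℚ.* (ε ℚ.* ε ℚ.+ ε))
      ≤⟨ *-mono (fromℕ-nonNeg p) (*-mono (fromℕ-nonNeg 4) (ℚ.+-monoˡ-≤ ε (*-mono 0≤ε (recip-antimono {0} {proj₁ ε-choice} ℕ.z≤n)))) ⟩
    fromℕ p ℚ.* (fromℕ 4 ℚ.* (ε ℚ.* 1ℚ ℚ.+ ε))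
      ≡⟨ solve 2 (λ p ε → p :* (con (fromℕ 4) :* (ε :* con 1ℚ :+ ε)) := (con (fromℕ 8) :* p) :* ε) refl (fromℕ p) ε ⟩
    (fromℕ 8 ℚ.* fromℕ p) ℚ.* ε
      ≡⟨ cong (ℚ._* ε) (fromℕ-* 8 p) ⟨
    fromℕ (8 ℕ.* p) ℚ.* ε
      ≤⟨ proj₂ ε-choice ⟩
    ⅛ ∎
    where 0≤ε = recip-nonNeg (proj₁ ε-choice)

-- The quotients in `c₇` and their maximum

fromℕ-*-/ : ∀ E D .{{_ : ℕ.NonZero D}} → fromℕ D ℚ.* (+ E ℚ./ D) ≡ fromℕ E
fromℕ-*-/ E D@(suc k) = ℚ.toℚᵘ-injective (ℚᵘ.≃-trans (ℚ.toℚᵘ-homo-* (fromℕ D) (+ E ℚ./ D))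
  (ℚᵘ.≃-trans (ℚᵘ.*-cong (/-toℚᵘ (+ D) 0) (/-toℚᵘ (+ E) k)) (ℚᵘ.≃-trans (ℚᵘ.*≡* eq) (ℚᵘ.≃-sym (/-toℚᵘ (+ E) 0)))))
  where
  eq : (+ D ℤ.* + E) ℤ.* + 1 ≡ + E ℤ.* + (1 ℕ.* D)
  eq = trans (ℤ.*-identityʳ (+ D ℤ.* + E)) (trans (ℤ.*-comm (+ D) (+ E))
    (cong (λ u → + E ℤ.* + u) (sym (ℕ.*-identityˡ D))))

-- A single d realises the maximum, so a single family of lattices settles every s in the
-- half-plane, boundary included.
max-attained : ∀ (g : ℕ → ℚ) d ds → ∃ λ c → c List.∈ d ∷ ds × max (g d) (List.map g ds) ≡ g c
max-attained g d ds = [ (λ eq → d , here refl , eq)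
                      , (λ m∈ → let c , c∈ , eq = ∈-map⁻ g m∈ in c , there c∈ , eq)
                      ]′ (argmax-sel id (g d) (List.map g ds))

c₇-attained : ∀ n .{{_ : NonTrivial n}} → ∃ λ d → d List.∈ 0 ∷ List.upTo n × c₇ n ≡ c₇-quotient n d
c₇-attained n = max-attained (c₇-quotient n) 0 (List.upTo n)

∈0∷upTo⇒≤ : ∀ n {d} → d List.∈ 0 ∷ List.upTo n → d ℕ.≤ ℕ.pred n
∈0∷upTo⇒≤ n       (here refl) = ℕ.z≤n
∈0∷upTo⇒≤ (suc n) (there d∈)  = ℕ.≤-pred (∈-upTo⁻ d∈)

diverges-quotient : ∀ n .{{_ : NonTrivial n}} {p} (p-prime : Prime p) s d → d ℕ.≤ ℕ.pred n →
                    Re s ≤ᴿ fromℚ (c₇-quotient n d) → Diverges (localFactor n p-prime s)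
diverges-quotient n@(suc (suc _)) {p} p-prime s d d≤ =
  diverges n p-prime s (c₇-quotient n d) (ℕ.pred n ℕ.+ d) (d ℕ.* a) (fromℕ-*-/ (d ℕ.* a) (ℕ.pred n ℕ.+ d)) f-bound
  where
  a = ℕ.pred n ℕ.∸ d
  instance p≢0 = prime⇒nonZero p-prime
  f-bound : ∀ k → p ℕ.^ (k ℕ.* (d ℕ.* a)) ℕ.≤ f n (p ℕ.^ (k ℕ.* (ℕ.pred n ℕ.+ d)))
  f-bound k = subst₂ ℕ._≤_ (ℕ.^-*-assoc p k (d ℕ.* a))
    -- Here d ≤ n - 1 matters: it makes the truncated difference a satisfy a + d = n - 1.
    (trans (cong (λ b → f (suc b) ((p ℕ.^ k) ℕ.^ (b ℕ.+ d))) (ℕ.m∸n+n≡m d≤))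
           (cong (f n) (ℕ.^-*-assoc p k (ℕ.pred n ℕ.+ d))))
    (f-lower-bound a d (p ℕ.^ k) {{ℕ.m^n≢0 p k}})

theorem1p10 : (n : ℕ) .{{_ : NonTrivial n}} (p : ℕ) (p-prime : Prime p) (s : ℂ) →
    Re s ≤ᴿ fromℚ (c₇ n) → Diverges (localFactor n p-prime s)
theorem1p10 n p p-prime s σ≤c₇ =
  let d , d∈ , c₇≡ = c₇-attained n in
  diverges-quotient n p-prime s d (∈0∷upTo⇒≤ n d∈) (subst (λ c → Re s ≤ᴿ fromℚ c) c₇≡ σ≤c₇)
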